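{- Let $n\ge 1$ and let $G$ be a graph on $n$ vertices with walk-matrix $W$ such that $\det(W)\neq 0$ and $\frac{\det(W)}{2^{\lfloor n/2\rfloor}}$ is an odd square-free integer (that is, $G\in\mathcal{F}_n$). Then $G$ is determined by its generalized spectrum (DGS).
   Context: All graphs are finite and simple. For a graph $G$ on $n$ vertices, $A=A(G)$ is its $(0,1)$-adjacency matrix, and the spectrum of $G$ is the multiset of eigenvalues of $A(G)$. The generalized spectrum of $G$ is the spectrum of $G$ together with the spectrum of its complement. $G$ is determined by its generalized spectrum (DGS) if every graph $H$ that is cospectral with $G$ and whose complement is cospectral with the complement of $G$ is isomorphic to $G$. The walk-matrix of $G$ is the $n\times n$ matrix $W=[e,Ae,A^2e,\dots,A^{n-1}e]$, where $e$ is the all-one column vector. $\mathcal{F}_n$ denotes the set of graphs $G$ on $n$ vertices with $\det(W)\ne 0$ such that $\det(W)/2^{\lfloor n/2\rfloor}$ is an odd square-free integer. -}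

module Defs where

open import Level using (0ℓ)
open import Data.Bool.Base using (Bool; true; false; not; _∧_; if_then_else_)
open import Data.Fin.Base using (Fin; zero; suc; toℕ; punchIn)
open import Data.Fin.Properties using () renaming (_≟_ to _≟ᶠ_)
open import Data.List.Base as List using (List; length)
open import Data.Nat.Base as ℕ using (ℕ; zero; suc; ⌊_/2⌋)
import Data.Nat.Properties as ℕₚ
open import Data.Nat.GeneralisedArithmetic using (fold)
open import Data.Integer.Base as ℤ using (ℤ; +_)
open import Data.Integer.Divisibility using (_∣_)
open import Data.Rational.Base as ℚ using (ℚ; 0ℚ; 1ℚ; ½)
import Data.Rational.Properties as ℚₚ
open import Algebra.Bundles using (CommutativeMonoid)
open import Algebra.Properties.CommutativeSemigroup
  (CommutativeMonoid.commutativeSemigroup ℚₚ.+-0-commutativeMonoid) using (interchange)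
open import Data.Product.Base using (_×_; _,_; Σ-syntax; ∃-syntax)
open import Data.Vec.Functional using (Vector)
open import Algebra.Bundles.Raw using (RawRing)
import Algebra.Definitions.RawSemiring as RawSemiringDefs
open import Function.Bundles using (_↔_; Inverse)
open import Relation.Nullary.Decidable using (⌊_⌋; yes; no)
open import Relation.Nullary.Negation using (¬_; contradiction)
open import Relation.Binary.PropositionalEquality
  using (_≡_; _≢_; refl; sym; trans; cong; cong₂; subst; subst₂)

-- ℝ is not quotiented: Cauchy sequences of rationals are compared by _≈ᴿ_.

Cauchy : (ℕ → ℚ) → Set
Cauchy s = ∀ ε → 0ℚ ℚ.< ε →
  ∃[ N ] ∀ m n → N ℕ.≤ m → N ℕ.≤ n → ℚ.∣ s m ℚ.- s n ∣ ℚ.< ε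

record ℝ : Set where
  constructor mkℝ
  field
    seq    : ℕ → ℚ
    cauchy : Cauchy seq

open ℝ public

infix 4 _≈ᴿ_

_≈ᴿ_ : ℝ → ℝ → Set
x ≈ᴿ y = ∀ ε → 0ℚ ℚ.< ε →
  ∃[ N ] ∀ n → N ℕ.≤ n → ℚ.∣ seq x n ℚ.- seq y n ∣ ℚ.< ε

private
  halves : ∀ ε → ½ ℚ.* ε ℚ.+ ½ ℚ.* ε ≡ ε
  halves ε = trans (sym (ℚₚ.*-distribʳ-+ ε ½ ½)) (ℚₚ.*-identityˡ ε)

  half-pos : ∀ ε → 0ℚ ℚ.< ε → 0ℚ ℚ.< ½ ℚ.* ε
  half-pos ε 0<ε =
    subst (ℚ._< ½ ℚ.* ε) (ℚₚ.*-zeroʳ ½) (ℚₚ.*-monoʳ-<-pos ½ 0<ε)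

  const-cauchy : ∀ q → Cauchy (λ _ → q)
  const-cauchy q ε 0<ε = 0 , λ _ _ _ _ →
    subst (ℚ._< ε) (sym (cong ℚ.∣_∣ (ℚₚ.+-inverseʳ q))) 0<ε

  +-cauchy : ∀ {s t} → Cauchy s → Cauchy t → Cauchy (λ n → s n ℚ.+ t n)
  +-cauchy {s} {t} cs ct ε 0<ε
    with cs (½ ℚ.* ε) (half-pos ε 0<ε) | ct (½ ℚ.* ε) (half-pos ε 0<ε)
  ... | M , p | N , q = M ℕ.⊔ N , λ m n h k →
    subst₂ ℚ._<_ refl (halves ε)
      (ℚₚ.≤-<-trans
        (subst (λ r → ℚ.∣ r ∣ ℚ.≤ ℚ.∣ s m ℚ.- s n ∣ ℚ.+ ℚ.∣ t m ℚ.- t n ∣)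
          (rearrange (s m) (s n) (t m) (t n))
          (ℚₚ.∣p+q∣≤∣p∣+∣q∣ (s m ℚ.- s n) (t m ℚ.- t n)))
        (ℚₚ.+-mono-<
          (p m n (ℕₚ.m⊔n≤o⇒m≤o M N h) (ℕₚ.m⊔n≤o⇒m≤o M N k))
          (q m n (ℕₚ.m⊔n≤o⇒n≤o M N h) (ℕₚ.m⊔n≤o⇒n≤o M N k))))
    where
    rearrange : ∀ a b c d →
      (a ℚ.- b) ℚ.+ (c ℚ.- d) ≡ (a ℚ.+ c) ℚ.- (b ℚ.+ d)
    rearrange a b c d =
      trans (interchange a (ℚ.- b) c (ℚ.- d))
            (cong ((a ℚ.+ c) ℚ.+_) (sym (ℚₚ.neg-distrib-+ b d)))

  neg-cauchy : ∀ {s} → Cauchy s → Cauchy (λ n → ℚ.- s n)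
  neg-cauchy {s} cs ε 0<ε with cs ε 0<ε
  ... | N , p = N , λ m n h k →
    subst (ℚ._< ε)
      (trans (sym (ℚₚ.∣-p∣≡∣p∣ (s m ℚ.- s n)))
             (cong ℚ.∣_∣ (ℚₚ.neg-distrib-+ (s m) (ℚ.- s n))))
      (p m n h k)

  cancel : ∀ a b → (a ℚ.- b) ℚ.+ b ≡ a
  cancel a b = trans (ℚₚ.+-assoc a (ℚ.- b) b)
    (trans (cong (a ℚ.+_) (ℚₚ.+-inverseˡ b)) (ℚₚ.+-identityʳ a))

  bounded : ∀ {s} → Cauchy s →
    ∃[ B ] (0ℚ ℚ.< B × (∃[ N ] ∀ n → N ℕ.≤ n → ℚ.∣ s n ∣ ℚ.≤ B))
  bounded {s} cs with cs 1ℚ (ℚₚ.positive⁻¹ 1ℚ)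
  ... | N , p = 1ℚ ℚ.+ ℚ.∣ s N ∣
    , ℚₚ.+-mono-<-≤ (ℚₚ.positive⁻¹ 1ℚ) (ℚₚ.0≤∣p∣ (s N))
    , N , λ n h →
      ℚₚ.≤-trans
        (subst (λ r → ℚ.∣ r ∣ ℚ.≤ ℚ.∣ s n ℚ.- s N ∣ ℚ.+ ℚ.∣ s N ∣)
          (cancel (s n) (s N))
          (ℚₚ.∣p+q∣≤∣p∣+∣q∣ (s n ℚ.- s N) (s N)))
        (ℚₚ.+-monoˡ-≤ ℚ.∣ s N ∣ (ℚₚ.<⇒≤ (p n N h ℕₚ.≤-refl)))

  *-mono-∣∣ : ∀ a b {A B} → 0ℚ ℚ.≤ A →
    ℚ.∣ a ∣ ℚ.≤ A → ℚ.∣ b ∣ ℚ.≤ B → ℚ.∣ a ℚ.* b ∣ ℚ.≤ A ℚ.* B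
  *-mono-∣∣ a b {A} {B} 0≤A a≤A b≤B =
    subst (ℚ._≤ A ℚ.* B) (sym (ℚₚ.∣p*q∣≡∣p∣*∣q∣ a b))
      (ℚₚ.≤-trans
        (ℚₚ.*-monoʳ-≤-nonNeg ℚ.∣ b ∣ {{ℚₚ.∣-∣-nonNeg b}} a≤A)
        (ℚₚ.*-monoˡ-≤-nonNeg A {{ℚ.nonNegative 0≤A}} b≤B))

  ∃δ : ∀ A B ε → 0ℚ ℚ.< A → 0ℚ ℚ.< B → 0ℚ ℚ.< ε →
    ∃[ δ ] (0ℚ ℚ.< δ × A ℚ.* δ ℚ.+ δ ℚ.* B ℚ.< ε)
  ∃δ A B ε 0<A 0<B 0<ε = δ , 0<δ , subst (ℚ._< ε) (sym total) half<
    where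
    C = A ℚ.+ B
    instance
      C>0 : ℚ.Positive C
      C>0 = ℚ.positive (ℚₚ.+-mono-< 0<A 0<B)
      C≢0 : ℚ.NonZero C
      C≢0 = ℚₚ.pos⇒nonZero C
      C⁻¹>0 : ℚ.Positive (ℚ.1/ C)
      C⁻¹>0 = ℚₚ.1/pos⇒pos C
    δ = ℚ.1/ C ℚ.* (½ ℚ.* ε)
    0<δ : 0ℚ ℚ.< δ
    0<δ = subst (ℚ._< δ) (ℚₚ.*-zeroʳ (ℚ.1/ C))
            (ℚₚ.*-monoʳ-<-pos (ℚ.1/ C) (half-pos ε 0<ε))
    half< : ½ ℚ.* ε ℚ.< ε
    half< = subst₂ ℚ._<_ (ℚₚ.+-identityʳ (½ ℚ.* ε)) (halves ε)
              (ℚₚ.+-monoʳ-< (½ ℚ.* ε) (half-pos ε 0<ε))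
    total : A ℚ.* δ ℚ.+ δ ℚ.* B ≡ ½ ℚ.* ε
    total = trans (cong (A ℚ.* δ ℚ.+_) (ℚₚ.*-comm δ B))
      (trans (sym (ℚₚ.*-distribʳ-+ δ A B))
        (trans (sym (ℚₚ.*-assoc C (ℚ.1/ C) (½ ℚ.* ε)))
          (trans (cong (ℚ._* (½ ℚ.* ε)) (ℚₚ.*-inverseʳ C))
                 (ℚₚ.*-identityˡ (½ ℚ.* ε)))))

  *-cauchy : ∀ {s t} → Cauchy s → Cauchy t → Cauchy (λ n → s n ℚ.* t n)
  *-cauchy {s} {t} cs ct ε 0<ε with bounded cs | bounded ct
  ... | A , 0<A , K , s≤A | B , 0<B , L , t≤B
    with ∃δ A B ε 0<A 0<B 0<ε
  ... | δ , 0<δ , small with cs δ 0<δ | ct δ 0<δ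
  ... | M , p | N , q = (K ℕ.⊔ L) ℕ.⊔ (M ℕ.⊔ N) , λ m n h k →
    let
      KL≤n = ℕₚ.m⊔n≤o⇒m≤o (K ℕ.⊔ L) (M ℕ.⊔ N) k
      KL≤m = ℕₚ.m⊔n≤o⇒m≤o (K ℕ.⊔ L) (M ℕ.⊔ N) h
      MN≤n = ℕₚ.m⊔n≤o⇒n≤o (K ℕ.⊔ L) (M ℕ.⊔ N) k
      MN≤m = ℕₚ.m⊔n≤o⇒n≤o (K ℕ.⊔ L) (M ℕ.⊔ N) h
      ds = ℚₚ.<⇒≤ (p m n (ℕₚ.m⊔n≤o⇒m≤o M N MN≤m) (ℕₚ.m⊔n≤o⇒m≤o M N MN≤n))
      dt = ℚₚ.<⇒≤ (q m n (ℕₚ.m⊔n≤o⇒n≤o M N MN≤m) (ℕₚ.m⊔n≤o⇒n≤o M N MN≤n))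
    in
    ℚₚ.≤-<-trans
      (ℚₚ.≤-trans
        (subst (λ r → ℚ.∣ r ∣ ℚ.≤ ℚ.∣ s m ℚ.* (t m ℚ.- t n) ∣
                                  ℚ.+ ℚ.∣ (s m ℚ.- s n) ℚ.* t n ∣)
          (split (s m) (s n) (t m) (t n))
          (ℚₚ.∣p+q∣≤∣p∣+∣q∣ (s m ℚ.* (t m ℚ.- t n)) ((s m ℚ.- s n) ℚ.* t n)))
        (ℚₚ.+-mono-≤
          (*-mono-∣∣ (s m) (t m ℚ.- t n) (ℚₚ.<⇒≤ 0<A)
            (s≤A m (ℕₚ.m⊔n≤o⇒m≤o K L KL≤m)) dt)
          (*-mono-∣∣ (s m ℚ.- s n) (t n) (ℚₚ.<⇒≤ 0<δ)
            ds (t≤B n (ℕₚ.m⊔n≤o⇒n≤o K L KL≤n)))))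
      small
    where
    split : ∀ a b c d →
      a ℚ.* (c ℚ.- d) ℚ.+ (a ℚ.- b) ℚ.* d ≡ a ℚ.* c ℚ.- b ℚ.* d
    split a b c d = trans
      (cong₂ ℚ._+_
        (trans (ℚₚ.*-distribˡ-+ a c (ℚ.- d))
               (cong (a ℚ.* c ℚ.+_) (sym (ℚₚ.neg-distribʳ-* a d))))
        (trans (ℚₚ.*-distribʳ-+ d a (ℚ.- b))
               (cong (a ℚ.* d ℚ.+_) (sym (ℚₚ.neg-distribˡ-* b d)))))
      (trans (sym (ℚₚ.+-assoc (a ℚ.* c ℚ.- a ℚ.* d) (a ℚ.* d) (ℚ.- (b ℚ.* d))))
             (cong (ℚ._- b ℚ.* d) (cancel (a ℚ.* c) (a ℚ.* d))))

fromℚ : ℚ → ℝ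
fromℚ q = mkℝ (λ _ → q) (const-cauchy q)

infix  8 -ᴿ_
infixl 7 _*ᴿ_
infixl 6 _+ᴿ_

_+ᴿ_ _*ᴿ_ : ℝ → ℝ → ℝ
x +ᴿ y = mkℝ (λ n → seq x n ℚ.+ seq y n)
  (+-cauchy {seq x} {seq y} (cauchy x) (cauchy y))
x *ᴿ y = mkℝ (λ n → seq x n ℚ.* seq y n)
  (*-cauchy {seq x} {seq y} (cauchy x) (cauchy y))

-ᴿ_ : ℝ → ℝ
-ᴿ x = mkℝ (λ n → ℚ.- seq x n) (neg-cauchy {seq x} (cauchy x))

ℝ-rawRing : RawRing 0ℓ 0ℓ
ℝ-rawRing = record
  { Carrier = ℝ
  ; _≈_     = _≈ᴿ_
  ; _+_     = _+ᴿ_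
  ; _*_     = _*ᴿ_
  ; -_      = -ᴿ_
  ; 0#      = fromℚ 0ℚ
  ; 1#      = fromℚ 1ℚ
  }

record Graph (n : ℕ) : Set where
  field
    adj    : Fin n → Fin n → Bool
    symm   : ∀ i j → adj i j ≡ adj j i
    irrefl : ∀ i → adj i i ≡ false

open Graph public

complement : ∀ {n} → Graph n → Graph n
complement {n} G = record
  { adj    = λ i j → not (adj G i j) ∧ not ⌊ i ≟ᶠ j ⌋
  ; symm   = λ i j → cong₂ _∧_ (cong not (symm G i j)) (cong not (≟-sym i j))
  ; irrefl = no-loop
  }
  where
  ≟-sym : (i j : Fin n) → ⌊ i ≟ᶠ j ⌋ ≡ ⌊ j ≟ᶠ i ⌋
  ≟-sym i j with i ≟ᶠ j | j ≟ᶠ i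
  ... | yes _ | yes _ = refl
  ... | no _  | no _  = refl
  ... | yes p | no q  = contradiction (sym p) q
  ... | no p  | yes q = contradiction (sym q) p
  no-loop : (i : Fin n) → not (adj G i i) ∧ not ⌊ i ≟ᶠ i ⌋ ≡ false
  no-loop i with i ≟ᶠ i
  ... | yes _ with adj G i i
  ...   | true  = refl
  ...   | false = refl
  no-loop i | no q = contradiction refl q

_≅_ : ∀ {m n} → Graph m → Graph n → Set
_≅_ {m} {n} G H =
  Σ[ f ∈ Fin m ↔ Fin n ] ∀ i j → adj G i j ≡ adj H (Inverse.to f i) (Inverse.to f j)

module Matrices (R : RawRing 0ℓ 0ℓ) where

  open RawRing R
  open RawSemiringDefs rawSemiring using (sum; _^_) public

  Matrix : ℕ → Set
  Matrix n = Fin n → Fin n → Carrier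

  -- Laplace expansion along the first row.
  det : ∀ {n} → Matrix n → Carrier
  det {zero}  M = 1#
  det {suc n} M = sum λ j →
    (- 1#) ^ toℕ j * (M zero j * det (λ i k → M (suc i) (punchIn j k)))

  _*ᵥ_ : ∀ {n} → Matrix n → Vector Carrier n → Vector Carrier n
  (M *ᵥ v) i = sum λ j → M i j * v j

  scalar : ∀ {n} → Carrier → Matrix n
  scalar x i j = if ⌊ i ≟ᶠ j ⌋ then x else 0#

  charPoly : ∀ {n} → Matrix n → Carrier → Carrier
  charPoly M x = det (λ i j → scalar x i j + (- M i j))

  adjacency : ∀ {n} → Graph n → Matrix n
  adjacency G i j = if adj G i j then 1# else 0#

  -- Column k is A^k e.
  walkMatrix : ∀ {n} → Graph n → Matrix n
  walkMatrix G i k = fold (λ _ → 1#) (adjacency G *ᵥ_) (toℕ k) i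

module MatZ = Matrices ℤ.+-*-rawRing
module MatR = Matrices ℝ-rawRing

∏⟨_-_⟩ : ℝ → List ℝ → ℝ
∏⟨ x - λs ⟩ = List.foldr (λ l p → (x +ᴿ (-ᴿ l)) *ᴿ p) (fromℚ 1ℚ) λs

-- The list λs enumerates the multiset of eigenvalues of A(G), i.e. of the
-- roots of det (x I − A(G)) with multiplicity.  Over the infinite field ℝ the
-- polynomial identity is the same as the identity at every point x.
IsSpectrum : ∀ {n} → Graph n → List ℝ → Set
IsSpectrum {n} G λs =
  length λs ≡ n × (∀ x → MatR.charPoly (MatR.adjacency G) x ≈ᴿ ∏⟨ x - λs ⟩)

-- Two multisets are equal when some list enumerates both.  Adjacency matrices
-- are real symmetric, so every graph does have a spectrum in ℝ.
Cospectral : ∀ {m n} → Graph m → Graph n → Set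
Cospectral G H = ∃[ λs ] (IsSpectrum G λs × IsSpectrum H λs)

-- H is not assumed to have as many vertices as G.
DGS : ∀ {n} → Graph n → Set
DGS G = ∀ {m} (H : Graph m) →
  Cospectral G H → Cospectral (complement G) (complement H) → G ≅ H

Odd : ℤ → Set
Odd d = ¬ (+ 2 ∣ d)

SquareFree : ℤ → Set
SquareFree d = ∀ k → k ℤ.* k ∣ d → ℤ.∣ k ∣ ≡ 1

detW : ∀ {n} → Graph n → ℤ
detW G = MatZ.det (MatZ.walkMatrix G)

-- d is the quotient det W / 2^⌊n/2⌋, asserted to be an integer.
𝓕 : ∀ n → Graph n → Set
𝓕 n G = detW G ≢ + 0 ×
  (∃[ d ] (detW G ≡ d ℤ.* (+ (2 ℕ.^ ⌊ n /2⌋)) × Odd d × SquareFree d))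

-- Cospectrality with cospectral complements makes G and H share all walk counts
-- eᵀAᵏe: with y = Σ tᵏAᵏe truncated, det(I − tA + tJ) ≡ (1 + t eᵀy) det(I − tA)
-- modulo a high power of t, for every integer t. Hence WᵀW and WᵀAW are the same
-- for G and H, so Q = W_G W_H⁻¹ is a rational orthogonal matrix with QᵀAQ = B and
-- eᵀQ = eᵀ; if Q is integral it is a permutation matrix and we are done.
--
-- Suppose N = ℓQ is integral and a prime p divides ℓ but not N. A column u of N
-- that is nonzero modulo p satisfies Wᵀu ≡ 0 (p) and uᵀAᵏu ≡ 0 (p²) for all k.
--
-- If p is odd, either p² | det W, or the kernels of W and Wᵀ modulo p are lines. In
-- the latter case u is an eigenvector, Au ≡ λu, and u ≡ c(A)e for some polynomial
-- c of degree < n − 1 because uᵀu ≡ 0. For f = (X − λ)c one gets f(A)e = p g with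
-- uᵀg ≡ 0 (p), and Cramer's rule again yields p² | det W.
--
-- If p = 2, the numbers eᵀAᵏe with k > 0 are even, so modulo 2 the Krylov space is
-- essentially its own orthogonal complement and is spanned by ⌈n/2⌉ vectors Aᵏe.
-- Writing u ≡ v(A)e with deg v < ⌈n/2⌉, the condition uᵀAᵏu ≡ 0 (4) becomes linear
-- in the squares of the coefficients, namely WᵀW v′ ≡ 0 (4) where v′ has the
-- entries vᵢ² in the positions 2i. As WᵀW, with its columns of even entries halved,
-- has odd determinant, all vᵢ are even, contradicting u ≢ 0 (2).

module Submission where

open import Defs
open import Data.Nat using (ℕ; _≤_)
open import Data.Nat.Base as ℕ using (zero; suc; s≤s; z≤n; ⌊_/2⌋; ⌈_/2⌉)
import Data.Nat.Properties as ℕₚ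
import Data.Nat.Divisibility as ℕ∣
open import Data.Nat.GeneralisedArithmetic using (fold)
open import Data.Fin.Base as Fin using (Fin; zero; suc; toℕ; punchIn; punchOut; inject₁; fromℕ)
open import Data.Fin.Properties using (_≟_; punchIn-injective; punchIn-punchOut; punchInᵢ≢i; punchOut-injective; any?; injective⇒≤; toℕ-inject₁; toℕ-fromℕ; fromℕ≢inject₁; splitAt⁻¹-↑ˡ; splitAt⁻¹-↑ʳ)
open import Data.Fin.Relation.Unary.Top using (view; ‵fromℕ; ‵inject₁)
import Data.List.Base as List
import Data.List.Relation.Unary.All as All
open import Data.Nat.ListAction using (product)
open import Data.Nat.Primality using (Prime; euclidsLemma; prime⇒nonZero; prime⇒nonTrivial; prime[2]; prime⇒irreducible; ¬prime[1])
open import Data.Nat.Primality.Factorisation using (factorise)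
open import Induction.WellFounded using (Acc; acc)
open import Data.Nat.Induction using (<-wellFounded)
open import Data.Integer.Base as ℤ using (ℤ; +_; _+_; _*_; -_; _-_; 0ℤ; 1ℤ; -1ℤ; ∣_∣)
import Data.Integer.DivMod as ℤ
import Data.Integer.Properties as ℤₚ
open import Data.Integer.Divisibility.Signed as Div using (_∣_; divides)
open import Data.Integer.Tactic.RingSolver using (solve-∀)
open import Data.Rational.Base as ℚ using (ℚ)
import Data.Rational.Properties as ℚₚ
open import Data.Rational.Unnormalised.Base as ℚᵘ using (mkℚᵘ)
import Data.Rational.Unnormalised.Properties as ℚᵘₚ
open import Data.Rational.Solver using (module +-*-Solver)
open import Data.Bool.Base using (Bool; true; false; if_then_else_)
open import Data.Product.Base using (_×_; _,_; proj₁; proj₂; Σ-syntax; ∃-syntax; ∃₂)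
open import Data.Sum.Base using (_⊎_; inj₁; inj₂; [_,_]′)
open import Data.Vec.Functional using (Vector; _∷_; _++_; updateAt; insertAt; transpose)
open import Data.Vec.Functional.Properties using (updateAt-updates; updateAt-minimal; insertAt-lookup; insertAt-punchIn; lookup-++ˡ; lookup-++ʳ)
open import Function.Base using (_∘_; _$_)
open import Function.Bundles using (mk↔ₛ′)
open import Relation.Nullary using (¬_; yes; no; contradiction)
open import Relation.Binary.PropositionalEquality
  using (_≡_; _≢_; _≗_; refl; sym; trans; cong; cong₂; subst; module ≡-Reasoning)
open import Relation.Binary.Definitions using (tri<; tri≈; tri>)
open import Level using (0ℓ)
open import Algebra.Bundles using (CommutativeRing; CommutativeMonoid)
open import Algebra.Bundles.Raw using (RawRing)
import Algebra.Properties.CommutativeSemigroup as CommutativeSemigroupProperties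
import Algebra.Properties.CommutativeMonoid.Sum as CommutativeMonoidSum
import Algebra.Properties.Semiring.Sum as SemiringSum

open MatZ using (Matrix; sum; det; _*ᵥ_; adjacency) renaming (_^_ to _^ᶻ_)
private module ℚSolver = +-*-Solver

private
  module Σℤ = CommutativeMonoidSum ℤₚ.+-0-commutativeMonoid
  module Σ*ℤ = SemiringSum ℤₚ.+-*-semiring

-- Finite sums and unit vectors

sum-cong : ∀ {n} {f g : Vector ℤ n} → f ≗ g → sum f ≡ sum g
sum-cong = Σℤ.sum-cong-≗

sum-zero : ∀ {n} {f : Vector ℤ n} → (∀ i → f i ≡ 0ℤ) → sum f ≡ 0ℤ
sum-zero {n} eq = trans (sum-cong eq) (Σℤ.sum-replicate-zero n)

sum-+ : ∀ {n} (f g : Vector ℤ n) → sum (λ i → f i + g i) ≡ sum f + sum g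
sum-+ = Σℤ.∑-distrib-+

*-sum : ∀ {n} x (f : Vector ℤ n) → sum (λ i → x * f i) ≡ x * sum f
*-sum x f = sym (Σ*ℤ.*-distribˡ-sum x f)

sum-* : ∀ {n} x (f : Vector ℤ n) → sum (λ i → f i * x) ≡ sum f * x
sum-* x f = sym (Σ*ℤ.*-distribʳ-sum x f)

sum-linear : ∀ {n} a b (f g : Vector ℤ n) →
  sum (λ i → a * f i + b * g i) ≡ a * sum f + b * sum g
sum-linear a b f g = trans (sum-+ (λ i → a * f i) (λ i → b * g i)) (cong₂ _+_ (*-sum a f) (*-sum b g))

sum-swap : ∀ {m n} (f : Fin m → Fin n → ℤ) →
  sum (λ i → sum (λ j → f i j)) ≡ sum (λ j → sum (λ i → f i j))
sum-swap = Σℤ.∑-comm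

sum-punchIn : ∀ {n} j (f : Vector ℤ (suc n)) → sum f ≡ f j + sum (f ∘ punchIn j)
sum-punchIn j f = Σℤ.sum-remove {i = j} f

sum-init-last : ∀ {n} (f : Vector ℤ (suc n)) → sum f ≡ sum (f ∘ inject₁) + f (fromℕ n)
sum-init-last = Σℤ.sum-init-last

unit : ∀ {n} → Fin n → Vector ℤ n
unit zero    zero    = 1ℤ
unit zero    (suc j) = 0ℤ
unit (suc i) zero    = 0ℤ
unit (suc i) (suc j) = unit i j

unit-sym : ∀ {n} (i j : Fin n) → unit i j ≡ unit j i
unit-sym zero    zero    = refl
unit-sym zero    (suc j) = refl
unit-sym (suc i) zero    = refl
unit-sym (suc i) (suc j) = unit-sym i j

unit-refl : ∀ {n} (i : Fin n) → unit i i ≡ 1ℤ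
unit-refl zero    = refl
unit-refl (suc i) = unit-refl i

unit-≢ : ∀ {n} {i j : Fin n} → i ≢ j → unit i j ≡ 0ℤ
unit-≢ {i = zero}  {zero}  i≢j = contradiction refl i≢j
unit-≢ {i = zero}  {suc j} i≢j = refl
unit-≢ {i = suc i} {zero}  i≢j = refl
unit-≢ {i = suc i} {suc j} i≢j = unit-≢ (i≢j ∘ cong suc)

sum-unit : ∀ {n} (i : Fin n) (f : Vector ℤ n) → sum (λ j → unit i j * f j) ≡ f i
sum-unit zero f = trans (cong₂ _+_ (ℤₚ.*-identityˡ (f zero)) (sum-zero {f = λ j → 0ℤ * f (suc j)} λ _ → refl)) (ℤₚ.+-identityʳ (f zero))
sum-unit (suc i) f = trans (ℤₚ.+-identityˡ _) (sum-unit i (f ∘ suc))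

infixl 8 _[_≔_]

_[_≔_] : ∀ {a} {A : Set a} {n} → Vector A n → Fin n → A → Vector A n
M [ i ≔ v ] = updateAt M i (λ _ → v)

≔-same : ∀ {a} {A : Set a} {n} (M : Vector A n) i {v} → (M [ i ≔ v ]) i ≡ v
≔-same M i = updateAt-updates i M

≔-other : ∀ {a} {A : Set a} {n} (M : Vector A n) {i k v} → k ≢ i → (M [ i ≔ v ]) k ≡ M k
≔-other M {i} {k} = updateAt-minimal k i M

-- Alternating multilinear functions of the rows of a matrix

infix 4 _≈₂_

_≈₂_ : ∀ {n m} → (M N : Fin n → Vector ℤ m) → Set
M ≈₂ N = ∀ i j → M i j ≡ N i j

Adjacent : ∀ {n} → Fin n → Fin n → Set
Adjacent i k = toℕ k ≡ suc (toℕ i)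

record Alternating {n m} (F : (Fin n → Vector ℤ m) → ℤ) : Set where
  field
    ext      : ∀ {M N} → M ≈₂ N → F M ≡ F N
    linear   : ∀ i a b {M N P} → (∀ j → M i j ≡ a * N i j + b * P i j) →
               (∀ k → k ≢ i → ∀ j → M k j ≡ N k j) → (∀ k → k ≢ i → ∀ j → M k j ≡ P k j) →
               F M ≡ a * F N + b * F P
    adjacent : ∀ {i k} → Adjacent i k → ∀ {M} → (∀ j → M i j ≡ M k j) → F M ≡ 0ℤ

∷-≈₂ : ∀ {n m} {x y : Vector ℤ m} {M N : Fin n → Vector ℤ m} → x ≗ y → M ≈₂ N → (x ∷ M) ≈₂ (y ∷ N)
∷-≈₂ p q zero    j = p j
∷-≈₂ p q (suc i) j = q i j

≔-≔ : ∀ {n m} (M : Fin n → Vector ℤ m) i {v w : Vector ℤ m} → (M [ i ≔ v ] [ i ≔ w ]) ≈₂ (M [ i ≔ w ])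
≔-≔ M zero    zero    j = refl
≔-≔ M zero    (suc k) j = refl
≔-≔ M (suc i) zero    j = refl
≔-≔ M (suc i) (suc k) j = ≔-≔ (M ∘ suc) i k j

tail-alternating : ∀ {n m} {F : (Fin (suc n) → Vector ℤ m) → ℤ} (x : Vector ℤ m) →
  Alternating F → Alternating (λ M → F (x ∷ M))
tail-alternating x alt = record
  { ext      = λ eq → ext (∷-≈₂ (λ _ → refl) eq)
  ; linear   = λ i a b eq eqN eqP → linear (suc i) a b eq (cons eqN) (cons eqP)
  ; adjacent = λ adj eq → adjacent (cong suc adj) eq
  }
  where
  open Alternating alt
  cons : ∀ {i M N} → (∀ k → k ≢ i → ∀ j → M k j ≡ N k j) →
    ∀ k → k ≢ suc i → ∀ j → (x ∷ M) k j ≡ (x ∷ N) k j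
  cons eq zero    _ j = refl
  cons eq (suc k) h j = eq k (h ∘ cong suc) j

module AlternatingProperties {n m} {F : (Fin n → Vector ℤ m) → ℤ} (alt : Alternating F) where
  open Alternating alt

  lincomb : ∀ {s} i M (c : Vector ℤ s) (w : Fin s → Vector ℤ m) →
    (∀ j → M i j ≡ sum (λ k → c k * w k j)) → F M ≡ sum (λ k → c k * F (M [ i ≔ w k ]))
  lincomb {zero} i M c w eq =
    trans (linear i 0ℤ 0ℤ {M} {M} {M} (λ j → trans (eq j) (sym (lem (M i j)))) (λ _ _ _ → refl) (λ _ _ _ → refl)) (lem (F M))
    where
    lem : ∀ x → 0ℤ * x + 0ℤ * x ≡ 0ℤ
    lem = solve-∀
  lincomb {suc s} i M c w eq = begin
    F M
      ≡⟨ linear i (c zero) 1ℤ {M} {M [ i ≔ w zero ]} {M [ i ≔ rest ]} split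
           (λ k k≢i j → cong (λ v → v j) (sym (≔-other M k≢i)))
           (λ k k≢i j → cong (λ v → v j) (sym (≔-other M k≢i))) ⟩
    c zero * F (M [ i ≔ w zero ]) + 1ℤ * F (M [ i ≔ rest ])
      ≡⟨ cong (_+_ (c zero * F (M [ i ≔ w zero ]))) (ℤₚ.*-identityˡ _) ⟩
    c zero * F (M [ i ≔ w zero ]) + F (M [ i ≔ rest ])
      ≡⟨ cong (_+_ (c zero * F (M [ i ≔ w zero ])))
           (trans (lincomb i (M [ i ≔ rest ]) (c ∘ suc) (w ∘ suc) (λ j → cong (λ v → v j) (≔-same M i)))
                  (sum-cong λ k → cong (c (suc k) *_) (ext (≔-≔ M i)))) ⟩
    sum (λ k → c k * F (M [ i ≔ w k ])) ∎
    where
    open ≡-Reasoning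
    rest : Vector ℤ m
    rest j = sum (λ k → c (suc k) * w (suc k) j)
    split : ∀ j → M i j ≡ c zero * (M [ i ≔ w zero ]) i j + 1ℤ * (M [ i ≔ rest ]) i j
    split j = trans (eq j) (cong₂ _+_ (cong (λ v → c zero * v j) (sym (≔-same M i)))
      (trans (cong (λ v → v j) (sym (≔-same M i {rest}))) (sym (ℤₚ.*-identityˡ _))))

  expand : ∀ i M → F M ≡ sum (λ j → M i j * F (M [ i ≔ unit j ]))
  expand i M = lincomb i M (M i) unit
    (λ j → sym (trans (sum-cong λ k → trans (ℤₚ.*-comm (M i k) (unit k j)) (cong (_* M i k) (unit-sym k j))) (sum-unit j (M i))))

swap₀₁ : ∀ {n m} {F : (Fin (suc (suc n)) → Vector ℤ m) → ℤ} → Alternating F →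
  ∀ x y R → F (x ∷ y ∷ R) ≡ - F (y ∷ x ∷ R)
swap₀₁ {n} {m} {F} alt x y R = solve-neg _ _ (begin
    F (x ∷ y ∷ R) + F (y ∷ x ∷ R)                    ≡⟨ cong₂ _+_ (sym toX) (sym toY) ⟩
    F (x ∷ s ∷ R) + F (y ∷ s ∷ R)                    ≡⟨ sym (one (F (x ∷ s ∷ R)) (F (y ∷ s ∷ R))) ⟩
    1ℤ * F (x ∷ s ∷ R) + 1ℤ * F (y ∷ s ∷ R)          ≡⟨ sym (linear zero 1ℤ 1ℤ {s ∷ s ∷ R} {x ∷ s ∷ R} {y ∷ s ∷ R} (λ j → sym (one (x j) (y j))) off₀ off₀) ⟩
    F (s ∷ s ∷ R)                                    ≡⟨ adjacent {zero} {suc zero} refl (λ _ → refl) ⟩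
    0ℤ ∎)
  where
  open ≡-Reasoning
  open Alternating alt
  s : Vector ℤ m
  s j = x j + y j
  one : ∀ a b → 1ℤ * a + 1ℤ * b ≡ a + b
  one = solve-∀
  solve-neg : ∀ a b → a + b ≡ 0ℤ → a ≡ - b
  solve-neg a b eq = trans (lem a b) (trans (cong (_+ - b) eq) (ℤₚ.+-identityˡ (- b)))
    where
    lem : ∀ a b → a ≡ (a + b) + - b
    lem = solve-∀
  off₀ : ∀ {v w : Vector ℤ m} {T : Fin (suc n) → Vector ℤ m} k → k ≢ zero → ∀ j → (v ∷ T) k j ≡ (w ∷ T) k j
  off₀ zero    h j = contradiction refl h
  off₀ (suc k) h j = refl
  off₁ : ∀ {u v w : Vector ℤ m} k → k ≢ suc zero → ∀ j → (u ∷ v ∷ R) k j ≡ (u ∷ w ∷ R) k j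
  off₁ zero          h j = refl
  off₁ (suc zero)    h j = contradiction refl h
  off₁ (suc (suc k)) h j = refl
  split : ∀ z → F (z ∷ s ∷ R) ≡ F (z ∷ x ∷ R) + F (z ∷ y ∷ R)
  split z = trans
    (linear (suc zero) 1ℤ 1ℤ {z ∷ s ∷ R} {z ∷ x ∷ R} {z ∷ y ∷ R} (λ j → sym (one (x j) (y j))) off₁ off₁)
    (one (F (z ∷ x ∷ R)) (F (z ∷ y ∷ R)))
  toX : F (x ∷ s ∷ R) ≡ F (x ∷ y ∷ R)
  toX = trans (split x) (trans (cong (_+ F (x ∷ y ∷ R)) (adjacent {zero} {suc zero} refl (λ _ → refl))) (ℤₚ.+-identityˡ _))
  toY : F (y ∷ s ∷ R) ≡ F (y ∷ x ∷ R)
  toY = trans (split y) (trans (cong (_+_ (F (y ∷ x ∷ R))) (adjacent {zero} {suc zero} refl (λ _ → refl))) (ℤₚ.+-identityʳ _))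

±_ : ∀ {n} → Fin n → ℤ
± i = -1ℤ ^ᶻ toℕ i

±-square : ∀ {n} (i : Fin n) → (± i) * (± i) ≡ 1ℤ
±-square zero = refl
±-square (suc i) = trans (lem (± i)) (±-square i)
  where
  lem : ∀ x → (-1ℤ * x) * (-1ℤ * x) ≡ x * x
  lem = solve-∀

to-front : ∀ {n m} {F : (Fin (suc n) → Vector ℤ m) → ℤ} → Alternating F →
  ∀ j R → F (R j ∷ R ∘ punchIn j) ≡ (± j) * F R
to-front {F = F} alt zero R =
  trans (Alternating.ext alt λ { zero _ → refl ; (suc _) _ → refl }) (sym (ℤₚ.*-identityˡ (F R)))
to-front {suc n} {F = F} alt (suc j) R = begin
  F (R (suc j) ∷ R ∘ punchIn (suc j))
    ≡⟨ Alternating.ext alt (λ { zero _ → refl ; (suc zero) _ → refl ; (suc (suc _)) _ → refl }) ⟩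
  F (R (suc j) ∷ R zero ∷ R ∘ suc ∘ punchIn j)
    ≡⟨ swap₀₁ alt (R (suc j)) (R zero) _ ⟩
  - F (R zero ∷ R (suc j) ∷ R ∘ suc ∘ punchIn j)
    ≡⟨ cong -_ (to-front (tail-alternating (R zero) alt) j (R ∘ suc)) ⟩
  - ((± j) * F (R zero ∷ R ∘ suc))
    ≡⟨ cong (λ x → - ((± j) * x)) (Alternating.ext alt λ { zero _ → refl ; (suc _) _ → refl }) ⟩
  - ((± j) * F R)
    ≡⟨ lem (± j) (F R) ⟩
  (± suc j) * F R ∎
  where
  open ≡-Reasoning
  lem : ∀ x y → - (x * y) ≡ (-1ℤ * x) * y
  lem = solve-∀

equal-rows : ∀ {n m} {F : (Fin n → Vector ℤ m) → ℤ} → Alternating F →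
  ∀ {i k} → i ≢ k → ∀ M → (∀ j → M i j ≡ M k j) → F M ≡ 0ℤ
equal-rows alt {zero} {zero} i≢k M eq = contradiction refl i≢k
equal-rows {suc n} {F = F} alt {zero} {suc k} i≢k M eq = begin
  F M                                              ≡⟨ sym (ℤₚ.*-identityˡ (F M)) ⟩
  1ℤ * F M                                         ≡⟨ cong (_* F M) (sym (±-square (suc k))) ⟩
  (± suc k) * (± suc k) * F M                      ≡⟨ ℤₚ.*-assoc (± suc k) (± suc k) (F M) ⟩
  (± suc k) * ((± suc k) * F M)                    ≡⟨ cong ((± suc k) *_) (sym (to-front alt (suc k) M)) ⟩
  (± suc k) * F (M (suc k) ∷ M ∘ punchIn (suc k))  ≡⟨ cong ((± suc k) *_) (front k eq) ⟩
  (± suc k) * 0ℤ                                   ≡⟨ ℤₚ.*-zeroʳ (± suc k) ⟩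
  0ℤ ∎
  where
  open ≡-Reasoning
  front : ∀ k → (∀ j → M zero j ≡ M (suc k) j) → F (M (suc k) ∷ M ∘ punchIn (suc k)) ≡ 0ℤ
  front zero    eq = Alternating.adjacent alt {zero} {suc zero} refl (sym ∘ eq)
  front (suc k) eq = Alternating.adjacent alt {zero} {suc zero} refl (sym ∘ eq)
equal-rows {suc n} alt {suc i} {zero} i≢k M eq = equal-rows alt (i≢k ∘ sym) M (sym ∘ eq)
equal-rows {suc n} {F = F} alt {suc i} {suc k} i≢k M eq =
  trans (Alternating.ext alt {M} {M zero ∷ M ∘ suc} λ { zero _ → refl ; (suc _) _ → refl })
        (equal-rows (tail-alternating (M zero) alt) (i≢k ∘ cong suc) (M ∘ suc) eq)

-- The induction follows the Laplace recursion of det; σ lists the coordinates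
-- that have not yet been used by the rows above.
unique : ∀ {n m} {F : (Fin n → Vector ℤ m) → ℤ} → Alternating F → (σ : Fin n → Fin m) →
  (∀ i M → F M ≡ sum (λ j → M i (σ j) * F (M [ i ≔ unit (σ j) ]))) →
  ∀ M → F M ≡ det (λ i j → M i (σ j)) * F (unit ∘ σ)
unique {zero} {F = F} alt σ expand M =
  trans (Alternating.ext alt λ ()) (sym (ℤₚ.*-identityˡ (F (unit ∘ σ))))
unique {suc n} {m} {F} alt σ expand M = begin
  F M                                                          ≡⟨ expand zero M ⟩
  sum (λ j → M zero (σ j) * F (M [ zero ≔ unit (σ j) ]))       ≡⟨ sum-cong term ⟩
  sum (λ j → (± j) * (M zero (σ j) * minor j) * F (unit ∘ σ))  ≡⟨ sum-* (F (unit ∘ σ)) (λ j → (± j) * (M zero (σ j) * minor j)) ⟩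
  det (λ i j → M i (σ j)) * F (unit ∘ σ) ∎
  where
  open ≡-Reasoning
  minor : Fin (suc n) → ℤ
  minor j = det (λ i k → M (suc i) (σ (punchIn j k)))
  lem : ∀ a b c d → a * (b * (c * d)) ≡ c * (a * b) * d
  lem = solve-∀
  expandTail : ∀ j i R → F (unit (σ j) ∷ R) ≡
    sum (λ k → R i (σ (punchIn j k)) * F (unit (σ j) ∷ (R [ i ≔ unit (σ (punchIn j k)) ])))
  expandTail j i R = begin
    F (unit (σ j) ∷ R)    ≡⟨ expand (suc i) (unit (σ j) ∷ R) ⟩
    sum f                 ≡⟨ sum-punchIn j f ⟩
    f j + sum (f ∘ punchIn j)
      ≡⟨ cong (_+ sum (f ∘ punchIn j)) (trans (cong (R i (σ j) *_) vanish) (ℤₚ.*-zeroʳ (R i (σ j)))) ⟩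
    0ℤ + sum (f ∘ punchIn j)
      ≡⟨ ℤₚ.+-identityˡ _ ⟩
    sum (f ∘ punchIn j)
      ≡⟨ sum-cong (λ k → cong (R i (σ (punchIn j k)) *_) (Alternating.ext alt λ { zero _ → refl ; (suc _) _ → refl })) ⟩
    sum (λ k → R i (σ (punchIn j k)) * F (unit (σ j) ∷ (R [ i ≔ unit (σ (punchIn j k)) ]))) ∎
    where
    f : Vector ℤ (suc n)
    f l = R i (σ l) * F ((unit (σ j) ∷ R) [ suc i ≔ unit (σ l) ])
    vanish : F ((unit (σ j) ∷ R) [ suc i ≔ unit (σ j) ]) ≡ 0ℤ
    vanish = equal-rows alt {zero} {suc i} (λ ()) _ (λ k → cong (λ v → v k) (sym (≔-same R i)))
  term : ∀ j → M zero (σ j) * F (M [ zero ≔ unit (σ j) ]) ≡ (± j) * (M zero (σ j) * minor j) * F (unit ∘ σ)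
  term j = begin
    M zero (σ j) * F (M [ zero ≔ unit (σ j) ])
      ≡⟨ cong (M zero (σ j) *_) (Alternating.ext alt λ { zero _ → refl ; (suc _) _ → refl }) ⟩
    M zero (σ j) * F (unit (σ j) ∷ M ∘ suc)
      ≡⟨ cong (M zero (σ j) *_) (unique (tail-alternating (unit (σ j)) alt) (σ ∘ punchIn j) (expandTail j) (M ∘ suc)) ⟩
    M zero (σ j) * (minor j * F (unit (σ j) ∷ unit ∘ σ ∘ punchIn j))
      ≡⟨ cong (λ x → M zero (σ j) * (minor j * x)) (to-front alt j (unit ∘ σ)) ⟩
    M zero (σ j) * (minor j * ((± j) * F (unit ∘ σ)))
      ≡⟨ lem (M zero (σ j)) (minor j) (± j) (F (unit ∘ σ)) ⟩
    (± j) * (M zero (σ j) * minor j) * F (unit ∘ σ) ∎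

-- Determinants

det-ext : ∀ {n} {M N : Matrix n} → M ≈₂ N → det M ≡ det N
det-ext {zero}  eq = refl
det-ext {suc n} eq = sum-cong λ j →
  cong ((± j) *_) (cong₂ _*_ (eq zero j) (det-ext λ i k → eq (suc i) (punchIn j k)))

det-column-linear : ∀ {n} c a b {M N P : Matrix n} → (∀ i → M i c ≡ a * N i c + b * P i c) →
  (∀ k → k ≢ c → ∀ i → M i k ≡ N i k) → (∀ k → k ≢ c → ∀ i → M i k ≡ P i k) →
  det M ≡ a * det N + b * det P
det-column-linear {suc n} c a b {M} {N} {P} eq eqN eqP =
  trans (sum-cong term) (sum-linear a b (summand N) (summand P))
  where
  open ≡-Reasoning
  minor : Matrix (suc n) → Fin (suc n) → Matrix n
  minor M j i k = M (suc i) (punchIn j k)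
  summand : Matrix (suc n) → Vector ℤ (suc n)
  summand M j = (± j) * (M zero j * det (minor M j))
  lem₁ : ∀ s x y d → s * ((a * x + b * y) * d) ≡ a * (s * (x * d)) + b * (s * (y * d))
  lem₁ = go a b
    where
    go : ∀ a b s x y d → s * ((a * x + b * y) * d) ≡ a * (s * (x * d)) + b * (s * (y * d))
    go = solve-∀
  lem₂ : ∀ s m d e → s * (m * (a * d + b * e)) ≡ a * (s * (m * d)) + b * (s * (m * e))
  lem₂ = go a b
    where
    go : ∀ a b s m d e → s * (m * (a * d + b * e)) ≡ a * (s * (m * d)) + b * (s * (m * e))
    go = solve-∀
  term : ∀ j → summand M j ≡ a * summand N j + b * summand P j
  term j with j ≟ c
  ... | yes refl = begin
    (± j) * (M zero j * det (minor M j))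
      ≡⟨ cong (λ x → (± j) * (x * det (minor M j))) (eq zero) ⟩
    (± j) * ((a * N zero j + b * P zero j) * det (minor M j))
      ≡⟨ lem₁ (± j) (N zero j) (P zero j) (det (minor M j)) ⟩
    a * ((± j) * (N zero j * det (minor M j))) + b * ((± j) * (P zero j * det (minor M j)))
      ≡⟨ cong₂ (λ x y → a * ((± j) * (N zero j * x)) + b * ((± j) * (P zero j * y)))
           (det-ext λ i k → eqN (punchIn j k) (punchInᵢ≢i j k) (suc i))
           (det-ext λ i k → eqP (punchIn j k) (punchInᵢ≢i j k) (suc i)) ⟩
    a * summand N j + b * summand P j ∎
  ... | no j≢c = begin
    (± j) * (M zero j * det (minor M j))
      ≡⟨ cong (λ x → (± j) * (M zero j * x)) (det-column-linear c′ a b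
           (λ i → subst (λ z → M (suc i) z ≡ a * N (suc i) z + b * P (suc i) z) (sym c′≡) (eq (suc i)))
           (λ k k≢c′ i → eqN (punchIn j k) (off k≢c′) (suc i))
           (λ k k≢c′ i → eqP (punchIn j k) (off k≢c′) (suc i))) ⟩
    (± j) * (M zero j * (a * det (minor N j) + b * det (minor P j)))
      ≡⟨ lem₂ (± j) (M zero j) (det (minor N j)) (det (minor P j)) ⟩
    a * ((± j) * (M zero j * det (minor N j))) + b * ((± j) * (M zero j * det (minor P j)))
      ≡⟨ cong₂ (λ x y → a * ((± j) * (x * det (minor N j))) + b * ((± j) * (y * det (minor P j))))
           (eqN j j≢c zero) (eqP j j≢c zero) ⟩
    a * summand N j + b * summand P j ∎
    where
    c′ = punchOut j≢c
    c′≡ : punchIn j c′ ≡ c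
    c′≡ = punchIn-punchOut j≢c
    off : ∀ {k} → k ≢ c′ → punchIn j k ≢ c
    off {k} k≢c′ eq′ = k≢c′ (punchIn-injective j k c′ (trans eq′ (sym c′≡)))

punchOut-adjacent : ∀ {n} {j i k : Fin (suc n)} (j≢i : j ≢ i) (j≢k : j ≢ k) →
  Adjacent i k → Adjacent (punchOut j≢i) (punchOut j≢k)
punchOut-adjacent {j = zero}  {zero}  {k}     j≢i j≢k adj = contradiction refl j≢i
punchOut-adjacent {j = zero}  {suc i} {suc k} j≢i j≢k adj = ℕₚ.suc-injective adj
punchOut-adjacent {suc n} {suc zero}    {zero}  {suc zero} j≢i j≢k adj = contradiction refl j≢k
punchOut-adjacent {suc (suc n)} {suc (suc j)} {zero}  {suc zero} j≢i j≢k adj = refl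
punchOut-adjacent {suc n} {suc j} {suc i} {suc k} j≢i j≢k adj =
  cong suc (punchOut-adjacent (j≢i ∘ cong suc) (j≢k ∘ cong suc) (ℕₚ.suc-injective adj))

punchIn-adjacent : ∀ {n} {i k : Fin (suc n)} → Adjacent i k → ∀ l →
  punchIn i l ≡ punchIn k l ⊎ (punchIn i l ≡ k × punchIn k l ≡ i)
punchIn-adjacent {i = zero}  {suc zero} adj zero    = inj₂ (refl , refl)
punchIn-adjacent {i = zero}  {suc zero} adj (suc l) = inj₁ refl
punchIn-adjacent {i = suc i} {suc k}    adj zero    = inj₁ refl
punchIn-adjacent {i = suc i} {suc k}    adj (suc l) with punchIn-adjacent (ℕₚ.suc-injective adj) l
... | inj₁ eq        = inj₁ (cong suc eq)
... | inj₂ (eq , eq′) = inj₂ (cong suc eq , cong suc eq′)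

sum-adjacent : ∀ {n} {i k : Fin n} → Adjacent i k → (f : Vector ℤ n) →
  f i + f k ≡ 0ℤ → (∀ j → j ≢ i → j ≢ k → f j ≡ 0ℤ) → sum f ≡ 0ℤ
sum-adjacent {i = zero} {suc zero} adj f eq rest = begin
  f zero + (f (suc zero) + sum (λ j → f (suc (suc j))))
    ≡⟨ cong (λ x → f zero + (f (suc zero) + x)) (sum-zero {f = λ j → f (suc (suc j))} λ j → rest (suc (suc j)) (λ ()) (λ ())) ⟩
  f zero + (f (suc zero) + 0ℤ)  ≡⟨ cong (_+_ (f zero)) (ℤₚ.+-identityʳ (f (suc zero))) ⟩
  f zero + f (suc zero)         ≡⟨ eq ⟩
  0ℤ ∎
  where open ≡-Reasoning
sum-adjacent {i = suc i} {suc k} adj f eq rest =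
  trans (cong₂ _+_ (rest zero (λ ()) (λ ()))
    (sum-adjacent (ℕₚ.suc-injective adj) (f ∘ suc) eq
      (λ j j≢i j≢k → rest (suc j) (j≢i ∘ λ { refl → refl }) (j≢k ∘ λ { refl → refl })))) refl

det-adjacent-columns : ∀ {n} {i k : Fin n} → Adjacent i k → ∀ {M : Matrix n} →
  (∀ r → M r i ≡ M r k) → det M ≡ 0ℤ
det-adjacent-columns {suc n} {i} {k} adj {M} eq = sum-adjacent adj summand cancel rest
  where
  open ≡-Reasoning
  minor : Fin (suc n) → Matrix n
  minor j r l = M (suc r) (punchIn j l)
  summand : Vector ℤ (suc n)
  summand j = (± j) * (M zero j * det (minor j))
  lem : ∀ s m d → s * (m * d) + -1ℤ * s * (m * d) ≡ 0ℤ
  lem = solve-∀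
  minors : minor i ≈₂ minor k
  minors r l with punchIn-adjacent adj l
  ... | inj₁ eq′ = cong (M (suc r)) eq′
  ... | inj₂ (eq₁ , eq₂) = trans (cong (M (suc r)) eq₁) (trans (sym (eq (suc r))) (cong (M (suc r)) (sym eq₂)))
  cancel : summand i + summand k ≡ 0ℤ
  cancel = begin
    summand i + (± k) * (M zero k * det (minor k))
      ≡⟨ cong (_+_ (summand i)) (cong₂ (λ s x → s * x) (cong (-1ℤ ^ᶻ_) adj)
           (cong₂ _*_ (sym (eq zero)) (sym (det-ext minors)))) ⟩
    summand i + -1ℤ * (± i) * (M zero i * det (minor i))
      ≡⟨ lem (± i) (M zero i) (det (minor i)) ⟩
    0ℤ ∎
  rest : ∀ j → j ≢ i → j ≢ k → summand j ≡ 0ℤ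
  rest j j≢i j≢k = begin
    (± j) * (M zero j * det (minor j))
      ≡⟨ cong (λ x → (± j) * (M zero j * x)) (det-adjacent-columns (punchOut-adjacent j≢i j≢k adj)
           (λ r → trans (cong (M (suc r)) (punchIn-punchOut j≢i))
                    (trans (eq (suc r)) (cong (M (suc r)) (sym (punchIn-punchOut j≢k)))))) ⟩
    (± j) * (M zero j * 0ℤ) ≡⟨ cong ((± j) *_) (ℤₚ.*-zeroʳ (M zero j)) ⟩
    (± j) * 0ℤ              ≡⟨ ℤₚ.*-zeroʳ (± j) ⟩
    0ℤ ∎

det-unit : ∀ {n} → det (unit {n}) ≡ 1ℤ
det-unit {zero}  = refl
det-unit {suc n} = begin
  1ℤ * (1ℤ * det (unit {n})) + sum f  ≡⟨ cong (_+_ (1ℤ * (1ℤ * det (unit {n})))) (sum-zero {f = f} λ j → ℤₚ.*-zeroʳ (± suc j)) ⟩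
  1ℤ * (1ℤ * det (unit {n})) + 0ℤ     ≡⟨ lem (det (unit {n})) ⟩
  det (unit {n})                      ≡⟨ det-unit {n} ⟩
  1ℤ ∎
  where
  open ≡-Reasoning
  f : Vector ℤ n
  f j = (± suc j) * (0ℤ * det (λ i k → unit {suc n} (suc i) (punchIn (suc j) k)))
  lem : ∀ x → 1ℤ * (1ℤ * x) + 0ℤ ≡ x
  lem = solve-∀

det-transpose-alternating : ∀ {n} → Alternating (λ (M : Matrix n) → det (transpose M))
det-transpose-alternating = record
  { ext      = λ eq → det-ext (λ i j → eq j i)
  ; linear   = λ i a b eq eqN eqP → det-column-linear i a b eq eqN eqP
  ; adjacent = λ adj eq → det-adjacent-columns adj eq
  }

det-transpose : ∀ {n} (M : Matrix n) → det (transpose M) ≡ det M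
det-transpose {n} M = begin
  det (transpose M)               ≡⟨ unique det-transpose-alternating (λ i → i) (AlternatingProperties.expand det-transpose-alternating) M ⟩
  det M * det (transpose (unit {n})) ≡⟨ cong (det M *_) (trans (det-ext {n} {transpose unit} {unit} (λ i j → unit-sym j i)) (det-unit {n})) ⟩
  det M * 1ℤ                      ≡⟨ ℤₚ.*-identityʳ (det M) ⟩
  det M ∎
  where open ≡-Reasoning

det-alternating : ∀ {n} → Alternating (det {n})
det-alternating = record
  { ext      = det-ext
  ; linear   = λ i a b {M} {N} {P} eq eqN eqP →
      trans (sym (det-transpose M)) (trans
        (Alternating.linear det-transpose-alternating i a b {M} {N} {P} eq eqN eqP)
        (cong₂ (λ x y → a * x + b * y) (det-transpose N) (det-transpose P)))
  ; adjacent = λ adj {M} eq →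
      trans (sym (det-transpose M)) (Alternating.adjacent det-transpose-alternating adj {M} eq)
  }

infixl 7 _∙_

_∙_ : ∀ {n} → Vector ℤ n → Vector ℤ n → ℤ
x ∙ y = sum (λ i → x i * y i)

∙-cong : ∀ {n} {x x′ y y′ : Vector ℤ n} → x ≗ x′ → y ≗ y′ → x ∙ y ≡ x′ ∙ y′
∙-cong p q = sum-cong λ i → cong₂ _*_ (p i) (q i)

∙-comm : ∀ {n} (x y : Vector ℤ n) → x ∙ y ≡ y ∙ x
∙-comm x y = sum-cong λ i → ℤₚ.*-comm (x i) (y i)

∙-linearˡ : ∀ {n} a b (x y z : Vector ℤ n) → (λ i → a * x i + b * y i) ∙ z ≡ a * (x ∙ z) + b * (y ∙ z)
∙-linearˡ a b x y z = trans (sum-cong λ i → lem a b (x i) (y i) (z i)) (sum-linear a b (λ i → x i * z i) (λ i → y i * z i))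
  where
  lem : ∀ a b x y z → (a * x + b * y) * z ≡ a * (x * z) + b * (y * z)
  lem = solve-∀

∙-linearʳ : ∀ {n} a b (z x y : Vector ℤ n) → z ∙ (λ i → a * x i + b * y i) ≡ a * (z ∙ x) + b * (z ∙ y)
∙-linearʳ a b z x y = trans (∙-comm z _) (trans (∙-linearˡ a b x y z) (cong₂ (λ s t → a * s + b * t) (∙-comm x z) (∙-comm y z)))

infixl 7 _⊡_

_⊡_ : ∀ {l m n} → (Fin l → Vector ℤ m) → (Fin m → Vector ℤ n) → Fin l → Vector ℤ n
(M ⊡ N) i k = M i ∙ (λ j → N j k)

∙-*ᵥ : ∀ {m n} (M : Fin m → Vector ℤ n) (x : Vector ℤ m) (y : Vector ℤ n) →
  x ∙ (λ i → M i ∙ y) ≡ (λ j → transpose M j ∙ x) ∙ y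
∙-*ᵥ M x y = begin
  sum (λ i → x i * sum (λ j → M i j * y j))    ≡⟨ sum-cong (λ i → sym (*-sum (x i) (λ j → M i j * y j))) ⟩
  sum (λ i → sum (λ j → x i * (M i j * y j)))  ≡⟨ sum-swap (λ i j → x i * (M i j * y j)) ⟩
  sum (λ j → sum (λ i → x i * (M i j * y j)))  ≡⟨ sum-cong (λ j → trans (sum-cong λ i → lem (x i) (M i j) (y j)) (sum-* (y j) (λ i → M i j * x i))) ⟩
  sum (λ j → sum (λ i → M i j * x i) * y j) ∎
  where
  open ≡-Reasoning
  lem : ∀ x m y → x * (m * y) ≡ m * x * y
  lem = solve-∀

⊡-cong : ∀ {l m n} {M M′ : Fin l → Vector ℤ m} {N N′ : Fin m → Vector ℤ n} → M ≈₂ M′ → N ≈₂ N′ → (M ⊡ N) ≈₂ (M′ ⊡ N′)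
⊡-cong p q i k = ∙-cong (p i) (λ j → q j k)

unit-∙ : ∀ {n} (i : Fin n) x → unit i ∙ x ≡ x i
unit-∙ = sum-unit

∙-unit : ∀ {n} (i : Fin n) x → x ∙ unit i ≡ x i
∙-unit i x = trans (∙-comm x (unit i)) (unit-∙ i x)

det-⊡ : ∀ {n} (M N : Matrix n) → det (M ⊡ N) ≡ det M * det N
det-⊡ {n} M N = begin
  det (M ⊡ N)             ≡⟨ unique alt (λ i → i) (AlternatingProperties.expand alt) M ⟩
  det M * det (unit ⊡ N)  ≡⟨ cong (det M *_) (det-ext λ i k → unit-∙ i (λ j → N j k)) ⟩
  det M * det N ∎
  where
  open ≡-Reasoning
  alt : Alternating (λ (M : Matrix n) → det (M ⊡ N))
  alt = record
    { ext = λ eq → det-ext (⊡-cong {N = N} eq (λ _ _ → refl))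
    ; linear = λ i a b {M} {P} {Q} eq eqP eqQ → Alternating.linear det-alternating i a b
        (λ k → trans (∙-cong {y = λ j → N j k} eq (λ _ → refl)) (∙-linearˡ a b (P i) (Q i) (λ j → N j k)))
        (λ r r≢i k → ∙-cong {y = λ j → N j k} (eqP r r≢i) (λ _ → refl))
        (λ r r≢i k → ∙-cong {y = λ j → N j k} (eqQ r r≢i) (λ _ → refl))
    ; adjacent = λ adj {M} eq → Alternating.adjacent det-alternating adj
        (λ k → ∙-cong {y = λ j → N j k} eq (λ _ → refl))
    }

adjugate : ∀ {n} → Matrix n → Matrix n
adjugate M j i = det (transpose M [ j ≔ unit i ])

det-≔ : ∀ {n} (M : Matrix n) j v → det (M [ j ≔ v ]) ≡ sum (λ i → v i * det (M [ j ≔ unit i ]))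
det-≔ M j v = begin
  det (M [ j ≔ v ])  ≡⟨ AlternatingProperties.expand det-alternating j (M [ j ≔ v ]) ⟩
  sum (λ i → (M [ j ≔ v ]) j i * det (M [ j ≔ v ] [ j ≔ unit i ]))
    ≡⟨ sum-cong (λ i → cong₂ _*_ (cong (λ w → w i) (≔-same M j)) (det-ext (≔-≔ M j))) ⟩
  sum (λ i → v i * det (M [ j ≔ unit i ])) ∎
  where open ≡-Reasoning

adjugate-∙ : ∀ {n} (M : Matrix n) j v → adjugate M j ∙ v ≡ det (transpose M [ j ≔ v ])
adjugate-∙ M j v = sym (trans (det-≔ (transpose M) j v) (sum-cong λ i → ℤₚ.*-comm (v i) (adjugate M j i)))

≔-row : ∀ {n} (M : Matrix n) j k → det (M [ j ≔ M k ]) ≡ det M * unit j k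
≔-row M j k with j ≟ k
... | yes refl = trans (Alternating.ext det-alternating {M [ j ≔ M j ]} {M} same)
                   (sym (trans (cong (det M *_) (unit-refl j)) (ℤₚ.*-identityʳ (det M))))
  where
  same : (M [ j ≔ M j ]) ≈₂ M
  same r c with r ≟ j
  ... | yes refl = cong (λ v → v c) (≔-same M j)
  ... | no r≢j   = cong (λ v → v c) (≔-other M r≢j)
... | no j≢k = trans (equal-rows det-alternating j≢k (M [ j ≔ M k ])
                 (λ c → cong (λ v → v c) (trans (≔-same M j) (sym (≔-other M (j≢k ∘ sym))))))
                 (sym (trans (cong (det M *_) (unit-≢ j≢k)) (ℤₚ.*-zeroʳ (det M))))

adjugate-⊡ : ∀ {n} (M : Matrix n) j k → (adjugate M ⊡ M) j k ≡ det M * unit j k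
adjugate-⊡ M j k = trans (adjugate-∙ M j (transpose M k))
  (trans (≔-row (transpose M) j k) (cong (_* unit j k) (det-transpose M)))

adjugate-minor : ∀ {n} (M : Matrix (suc n)) j i →
  det (M [ j ≔ unit i ]) ≡ (± j) * ((± i) * det (λ r c → M (punchIn j r) (punchIn i c)))
adjugate-minor {n} M j i = begin
  det R                       ≡⟨ sym (ℤₚ.*-identityˡ (det R)) ⟩
  1ℤ * det R                  ≡⟨ cong (_* det R) (sym (±-square j)) ⟩
  (± j) * (± j) * det R       ≡⟨ ℤₚ.*-assoc (± j) (± j) (det R) ⟩
  (± j) * ((± j) * det R)     ≡⟨ cong ((± j) *_) (sym (to-front det-alternating j R)) ⟩
  (± j) * det (R j ∷ R ∘ punchIn j)
    ≡⟨ cong ((± j) *_) (det-ext {M = R j ∷ R ∘ punchIn j} {unit i ∷ M ∘ punchIn j}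
         λ { zero c → cong (λ v → v c) (≔-same M j)
           ; (suc r) c → cong (λ v → v c) (≔-other M (punchInᵢ≢i j r)) }) ⟩
  (± j) * det (unit i ∷ M ∘ punchIn j)
    ≡⟨ cong ((± j) *_) (trans (sum-cong {f = λ c → (± c) * (unit i c * minor c)} λ c → lem (± c) (unit i c) (minor c)) (sum-unit i (λ c → (± c) * minor c))) ⟩
  (± j) * ((± i) * minor i) ∎
  where
  open ≡-Reasoning
  R = M [ j ≔ unit i ]
  minor : Fin (suc n) → ℤ
  minor c = det (λ r k → M (punchIn j r) (punchIn c k))
  lem : ∀ s u d → s * (u * d) ≡ u * (s * d)
  lem = solve-∀

adjugate-transpose : ∀ {n} (M : Matrix n) i j → adjugate (transpose M) i j ≡ adjugate M j i
adjugate-transpose {suc n} M i j = begin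
  det (M [ i ≔ unit j ])             ≡⟨ adjugate-minor M i j ⟩
  (± i) * ((± j) * det minor)        ≡⟨ lem (± i) (± j) (det minor) ⟩
  (± j) * ((± i) * det minor)        ≡⟨ cong (λ x → (± j) * ((± i) * x)) (sym (det-transpose minor)) ⟩
  (± j) * ((± i) * det (transpose minor)) ≡⟨ sym (adjugate-minor (transpose M) j i) ⟩
  adjugate M j i ∎
  where
  open ≡-Reasoning
  minor : Matrix n
  minor r c = M (punchIn i r) (punchIn j c)
  lem : ∀ s u d → s * (u * d) ≡ u * (s * d)
  lem = solve-∀

⊡-adjugate : ∀ {n} (M : Matrix n) j k → (M ⊡ adjugate M) j k ≡ det M * unit j k
⊡-adjugate M j k = begin
  M j ∙ (λ i → adjugate M i k)              ≡⟨ ∙-cong {x = M j} (λ _ → refl) (λ i → sym (adjugate-transpose M k i)) ⟩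
  M j ∙ adjugate (transpose M) k            ≡⟨ ∙-comm (M j) (adjugate (transpose M) k) ⟩
  (adjugate (transpose M) ⊡ transpose M) k j ≡⟨ adjugate-⊡ (transpose M) k j ⟩
  det (transpose M) * unit k j         ≡⟨ cong₂ _*_ (det-transpose M) (unit-sym k j) ⟩
  det M * unit j k ∎
  where open ≡-Reasoning

-- Congruences

infix 4 _≡[_]_

record _≡[_]_ (x m y : ℤ) : Set where
  constructor congruent
  field difference : m ∣ x - y

open _≡[_]_

∣-subst : ∀ {m x y} → x ≡ y → m ∣ x → m ∣ y
∣-subst {m} = subst (m ∣_)

∣0 : ∀ {m} → m ∣ 0ℤ
∣0 = divides 0ℤ refl

mod-reflexive : ∀ {m x y} → x ≡ y → x ≡[ m ] y
mod-reflexive {m} {x} refl = congruent (∣-subst (sym (ℤₚ.+-inverseʳ x)) ∣0)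

mod-refl : ∀ {m x} → x ≡[ m ] x
mod-refl = mod-reflexive refl

mod-sym : ∀ {m x y} → x ≡[ m ] y → y ≡[ m ] x
mod-sym {m} {x} {y} (congruent d) = congruent (∣-subst (lem x y) (Div.∣m⇒∣-m d))
  where
  lem : ∀ x y → - (x - y) ≡ y - x
  lem = solve-∀

mod-trans : ∀ {m x y z} → x ≡[ m ] y → y ≡[ m ] z → x ≡[ m ] z
mod-trans {m} {x} {y} {z} (congruent d) (congruent e) = congruent (∣-subst (lem x y z) (Div.∣m∣n⇒∣m+n d e))
  where
  lem : ∀ x y z → (x - y) + (y - z) ≡ x - z
  lem = solve-∀

mod-+ : ∀ {m x x′ y y′} → x ≡[ m ] x′ → y ≡[ m ] y′ → x + y ≡[ m ] x′ + y′
mod-+ {m} {x} {x′} {y} {y′} (congruent d) (congruent e) = congruent (∣-subst (lem x x′ y y′) (Div.∣m∣n⇒∣m+n d e))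
  where
  lem : ∀ x x′ y y′ → (x - x′) + (y - y′) ≡ (x + y) - (x′ + y′)
  lem = solve-∀

mod-* : ∀ {m x x′ y y′} → x ≡[ m ] x′ → y ≡[ m ] y′ → x * y ≡[ m ] x′ * y′
mod-* {m} {x} {x′} {y} {y′} (congruent d) (congruent e) =
  congruent (∣-subst (lem x x′ y y′) (Div.∣m∣n⇒∣m+n (Div.∣n⇒∣m*n x e) (Div.∣n⇒∣m*n y′ d)))
  where
  lem : ∀ x x′ y y′ → x * (y - y′) + y′ * (x - x′) ≡ x * y - x′ * y′
  lem = solve-∀

∣-sum : ∀ {m n} (f : Vector ℤ n) → (∀ i → m ∣ f i) → m ∣ sum f
∣-sum {n = zero}  f d = ∣0
∣-sum {n = suc n} f d = Div.∣m∣n⇒∣m+n (d zero) (∣-sum (f ∘ suc) (d ∘ suc))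

mod-sum : ∀ {m n} (f g : Vector ℤ n) → (∀ i → f i ≡[ m ] g i) → sum f ≡[ m ] sum g
mod-sum {n = zero}  f g d = mod-refl
mod-sum {n = suc n} f g d = mod-+ (d zero) (mod-sum (f ∘ suc) (g ∘ suc) (d ∘ suc))

det-mod : ∀ {m n} (M N : Matrix n) → (∀ i j → M i j ≡[ m ] N i j) → det M ≡[ m ] det N
det-mod {m} {zero}  M N d = mod-refl
det-mod {m} {suc n} M N d = mod-sum
  (λ j → (± j) * (M zero j * det (λ i k → M (suc i) (punchIn j k))))
  (λ j → (± j) * (N zero j * det (λ i k → N (suc i) (punchIn j k)))) λ j →
  mod-* (mod-refl {x = ± j}) (mod-* (d zero j)
    (det-mod (λ i k → M (suc i) (punchIn j k)) (λ i k → N (suc i) (punchIn j k)) (λ i k → d (suc i) (punchIn j k))))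

-- The matrix determinant lemma

det-first-row : ∀ {n} (M : Matrix (suc n)) → (∀ j → M zero (suc j) ≡ 0ℤ) →
  det M ≡ M zero zero * det (λ i k → M (suc i) (suc k))
det-first-row {n} M eq = begin
  1ℤ * (M zero zero * minor zero) + sum (λ j → (± suc j) * (M zero (suc j) * minor (suc j)))
    ≡⟨ cong (_+_ (1ℤ * (M zero zero * minor zero))) (sum-zero {f = λ j → (± suc j) * (M zero (suc j) * minor (suc j))}
         λ j → trans (cong (λ x → (± suc j) * (x * minor (suc j))) (eq j)) (ℤₚ.*-zeroʳ (± suc j))) ⟩
  1ℤ * (M zero zero * minor zero) + 0ℤ
    ≡⟨ lem (M zero zero * minor zero) ⟩
  M zero zero * minor zero ∎
  where
  open ≡-Reasoning
  minor : Fin (suc n) → ℤ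
  minor j = det (λ i k → M (suc i) (punchIn j k))
  lem : ∀ x → 1ℤ * x + 0ℤ ≡ x
  lem = solve-∀

det-first-column : ∀ {n} (M : Matrix (suc n)) → (∀ i → M (suc i) zero ≡ 0ℤ) →
  det M ≡ M zero zero * det (λ i k → M (suc i) (suc k))
det-first-column M eq = trans (sym (det-transpose M))
  (trans (det-first-row (transpose M) eq) (cong (M zero zero *_) (det-transpose (λ i k → M (suc i) (suc k)))))

block : ∀ {n} → ℤ → Vector ℤ n → Vector ℤ n → Matrix n → Matrix (suc n)
block a v u M = (a ∷ v) ∷ λ i → u i ∷ M i

-- Both sides are the determinant of the bordered matrix [[1, v], [-u, M]].
det-rank-one : ∀ {n} (M : Matrix n) (v y : Vector ℤ n) →
  det (λ i j → M i j + (M i ∙ y) * v j) ≡ (1ℤ + v ∙ y) * det M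
det-rank-one {n} M v y = begin
  det X                                                  ≡⟨ lem₁ (det X) ⟩
  1ℤ * det X * (1ℤ * 1ℤ)                                 ≡⟨ cong (λ d → 1ℤ * det X * (1ℤ * d)) (sym (det-unit {n})) ⟩
  1ℤ * det X * (1ℤ * det (unit {n}))
    ≡⟨ cong₂ _*_ (sym (det-first-row (block 1ℤ 𝟎 -u X) (λ _ → refl)))
                 (sym (det-first-column (block 1ℤ v 𝟎 unit) (λ _ → refl))) ⟩
  det (block 1ℤ 𝟎 -u X) * det (block 1ℤ v 𝟎 unit)        ≡⟨ sym (det-⊡ (block 1ℤ 𝟎 -u X) (block 1ℤ v 𝟎 unit)) ⟩
  det (block 1ℤ 𝟎 -u X ⊡ block 1ℤ v 𝟎 unit)              ≡⟨ det-ext left ⟩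
  det (block 1ℤ v -u M)                                  ≡⟨ sym (det-ext right) ⟩
  det (block c v 𝟎 M ⊡ block 1ℤ 𝟎 -y unit)               ≡⟨ det-⊡ (block c v 𝟎 M) (block 1ℤ 𝟎 -y unit) ⟩
  det (block c v 𝟎 M) * det (block 1ℤ 𝟎 -y unit)
    ≡⟨ cong₂ _*_ (det-first-column (block c v 𝟎 M) (λ _ → refl))
                 (trans (det-first-row (block 1ℤ 𝟎 -y unit) (λ _ → refl)) (cong (1ℤ *_) (det-unit {n}))) ⟩
  c * det M * 1ℤ                                         ≡⟨ ℤₚ.*-identityʳ (c * det M) ⟩
  c * det M ∎
  where
  open ≡-Reasoning
  c = 1ℤ + v ∙ y
  X : Matrix n
  X i j = M i j + (M i ∙ y) * v j
  𝟎 -u -y : Vector ℤ n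
  𝟎 _ = 0ℤ
  -u i = - (M i ∙ y)
  -y i = - y i
  lem₁ : ∀ x → x ≡ 1ℤ * x * (1ℤ * 1ℤ)
  lem₁ = solve-∀
  ∙𝟎 : ∀ x → x ∙ 𝟎 ≡ 0ℤ
  ∙𝟎 x = sum-zero λ i → ℤₚ.*-zeroʳ (x i)
  𝟎∙ : ∀ x → 𝟎 ∙ x ≡ 0ℤ
  𝟎∙ x = sum-zero {f = λ i → 𝟎 i * x i} λ i → refl
  ∙unit : ∀ x j → x ∙ (λ i → unit i j) ≡ x j
  ∙unit x j = trans (∙-cong {x = x} (λ _ → refl) (λ i → unit-sym i j)) (∙-unit j x)
  ∙-neg : ∀ x → x ∙ -y ≡ - (x ∙ y)
  ∙-neg x = trans (sum-cong (λ i → lem (x i) (y i))) (trans (*-sum -1ℤ (λ i → x i * y i)) (ℤₚ.-1*i≡-i (x ∙ y)))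
    where
    lem : ∀ a b → a * - b ≡ -1ℤ * (a * b)
    lem = solve-∀
  left : (block 1ℤ 𝟎 -u X ⊡ block 1ℤ v 𝟎 unit) ≈₂ block 1ℤ v -u M
  left zero zero = cong (_+_ (1ℤ * 1ℤ)) (𝟎∙ 𝟎)
  left zero (suc j) = trans (cong (_+_ (1ℤ * v j)) (𝟎∙ (λ i → unit i j))) (lem (v j))
    where
    lem : ∀ x → 1ℤ * x + 0ℤ ≡ x
    lem = solve-∀
  left (suc i) zero = trans (cong (_+_ (-u i * 1ℤ)) (∙𝟎 (X i))) (lem (-u i))
    where
    lem : ∀ x → x * 1ℤ + 0ℤ ≡ x
    lem = solve-∀
  left (suc i) (suc j) = trans (cong (_+_ (-u i * v j)) (∙unit (X i) j)) (lem (M i ∙ y) (v j) (M i j))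
    where
    lem : ∀ u v m → - u * v + (m + u * v) ≡ m
    lem = solve-∀
  right : (block c v 𝟎 M ⊡ block 1ℤ 𝟎 -y unit) ≈₂ block 1ℤ v -u M
  right zero zero = trans (cong (_+_ (c * 1ℤ)) (∙-neg v)) (lem (v ∙ y))
    where
    lem : ∀ x → (1ℤ + x) * 1ℤ + - x ≡ 1ℤ
    lem = solve-∀
  right zero (suc j) = trans (cong (_+_ (c * 0ℤ)) (∙unit v j)) (lem c (v j))
    where
    lem : ∀ c x → c * 0ℤ + x ≡ x
    lem = solve-∀
  right (suc i) zero = trans (ℤₚ.+-identityˡ _) (∙-neg (M i))
  right (suc i) (suc j) = trans (ℤₚ.+-identityˡ _) (∙unit (M i) j)

-- Walk counts

ones : ∀ {n} → Vector ℤ n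
ones _ = 1ℤ

iter : ∀ {n} → Matrix n → Vector ℤ n → ℕ → Vector ℤ n
iter A v k = fold v (A *ᵥ_) k

walks : ∀ {n} → Matrix n → ℕ → ℤ
walks A k = ones ∙ iter A ones k

horner : ℤ → ℕ → (ℕ → ℤ) → ℤ
horner t zero    a = 0ℤ
horner t (suc N) a = a 0 + t * horner t N (a ∘ suc)

∙-horner : ∀ {n} t N (x : Vector ℤ n) (a : Fin n → ℕ → ℤ) →
  x ∙ (λ j → horner t N (a j)) ≡ horner t N (λ k → x ∙ (λ j → a j k))
∙-horner t zero    x a = sum-zero λ j → ℤₚ.*-zeroʳ (x j)
∙-horner t (suc N) x a = begin
  x ∙ (λ j → a j 0 + t * h j)
    ≡⟨ ∙-cong {x = x} (λ _ → refl) (λ j → cong (_+ t * h j) (sym (ℤₚ.*-identityˡ (a j 0)))) ⟩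
  x ∙ (λ j → 1ℤ * a j 0 + t * h j)         ≡⟨ ∙-linearʳ 1ℤ t x (λ j → a j 0) h ⟩
  1ℤ * (x ∙ (λ j → a j 0)) + t * (x ∙ h)   ≡⟨ cong₂ (λ p q → p + t * q) (ℤₚ.*-identityˡ (x ∙ (λ j → a j 0))) (∙-horner t N x (λ j → a j ∘ suc)) ⟩
  x ∙ (λ j → a j 0) + t * horner t N (λ k → x ∙ (λ j → a j (suc k))) ∎
  where
  open ≡-Reasoning
  h : _ → ℤ
  h j = horner t N (a j ∘ suc)

horner-telescope : ∀ t N a → horner t N a - t * horner t N (a ∘ suc) ≡ a 0 - t ℤ.^ N * a N
horner-telescope t zero    a = lem t (a 0)
  where
  lem : ∀ t x → 0ℤ - t * 0ℤ ≡ x - 1ℤ * x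
  lem = solve-∀
horner-telescope t (suc N) a = begin
  (a 0 + t * h₁) - t * (a 1 + t * h₂)       ≡⟨ lem t (a 0) (a 1) h₁ h₂ ⟩
  a 0 + t * ((h₁ - t * h₂) - a 1)           ≡⟨ cong (λ x → a 0 + t * (x - a 1)) (horner-telescope t N (a ∘ suc)) ⟩
  a 0 + t * ((a 1 - t ℤ.^ N * a (suc N)) - a 1) ≡⟨ lem′ t (a 0) (a 1) (t ℤ.^ N) (a (suc N)) ⟩
  a 0 - t * t ℤ.^ N * a (suc N) ∎
  where
  open ≡-Reasoning
  h₁ = horner t N (a ∘ suc)
  h₂ = horner t N (λ k → a (suc (suc k)))
  lem : ∀ t a b x y → (a + t * x) - t * (b + t * y) ≡ a + t * ((x - t * y) - b)
  lem = solve-∀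
  lem′ : ∀ t a b p z → a + t * ((b - p * z) - b) ≡ a - t * p * z
  lem′ = solve-∀

resolvent : ∀ {n} → Matrix n → ℤ → Matrix n
resolvent A t i j = unit i j - t * A i j

resolvent-horner : ∀ {n} (A : Matrix n) t N i →
  resolvent A t i ∙ (λ j → horner t N (λ k → iter A ones k j)) ≡ 1ℤ - t ℤ.^ N * iter A ones N i
resolvent-horner A t N i = begin
  resolvent A t i ∙ h                  ≡⟨ ∙-cong {y = h} (λ j → lem t (unit i j) (A i j)) (λ _ → refl) ⟩
  (λ j → 1ℤ * unit i j + - t * A i j) ∙ h ≡⟨ ∙-linearˡ 1ℤ (- t) (unit i) (A i) h ⟩
  1ℤ * (unit i ∙ h) + - t * (A i ∙ h)  ≡⟨ cong₂ (λ p q → 1ℤ * p + - t * q) (unit-∙ i h) (∙-horner t N (A i) (λ j k → iter A ones k j)) ⟩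
  1ℤ * h i + - t * horner t N (λ k → iter A ones (suc k) i) ≡⟨ lem′ t (h i) _ ⟩
  h i - t * horner t N (λ k → iter A ones (suc k) i) ≡⟨ horner-telescope t N (λ k → iter A ones k i) ⟩
  1ℤ - t ℤ.^ N * iter A ones N i ∎
  where
  open ≡-Reasoning
  h : _ → ℤ
  h j = horner t N (λ k → iter A ones k j)
  lem : ∀ t u a → u - t * a ≡ 1ℤ * u + - t * a
  lem = solve-∀
  lem′ : ∀ t x y → 1ℤ * x + - t * y ≡ x - t * y
  lem′ = solve-∀

det-resolvent+J : ∀ {n} (A : Matrix n) t N →
  det (λ i j → resolvent A t i j + t) ≡[ t ℤ.^ suc N ] (1ℤ + t * horner t N (walks A)) * det (resolvent A t)
det-resolvent+J A t N = mod-trans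
  (det-mod (λ i j → resolvent A t i j + t) X λ i j →
    congruent $ divides (iter A ones N i) (trans (cong (λ u → (resolvent A t i j + t) - (resolvent A t i j + u * t)) (resolvent-horner A t N i))
      (lem (resolvent A t i j) t (t ℤ.^ N) (iter A ones N i))))
  (mod-reflexive (trans (det-rank-one (resolvent A t) (λ _ → t) h)
    (cong (λ x → (1ℤ + x) * det (resolvent A t)) eq)))
  where
  h : _ → ℤ
  h j = horner t N (λ k → iter A ones k j)
  X : Matrix _
  X i j = resolvent A t i j + (resolvent A t i ∙ h) * t
  lem : ∀ m t p a → (m + t) - (m + (1ℤ - p * a) * t) ≡ a * (t * p)
  lem = solve-∀
  eq : (λ _ → t) ∙ h ≡ t * horner t N (walks A)
  eq = trans (sum-cong (λ i → cong (t *_) (sym (ℤₚ.*-identityˡ (h i)))))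
    (trans (*-sum t (λ i → 1ℤ * h i)) (cong (t *_) (∙-horner t N ones (λ j k → iter A ones k j))))

suc∣⇒≡0 : ∀ x → + suc ∣ x ∣ ∣ x → x ≡ 0ℤ
suc∣⇒≡0 x d with ∣ x ∣ in eq
... | zero  = ℤₚ.∣i∣≡0⇒i≡0 eq
... | suc m = contradiction (ℕ∣.∣⇒≤ (subst (suc (suc m) ℕ∣.∣_) eq (Div.∣⇒∣ᵤ d))) ℕₚ.1+n≰n

horner-injective : (d : ℕ → ℤ) → (∀ s → d s ≡[ + suc s ] 1ℤ) → ∀ a b →
  (∀ s N → (+ suc s) ℤ.^ N ∣ d s * (horner (+ suc s) N a - horner (+ suc s) N b)) → ∀ k → a k ≡ b k
horner-injective d d≡1 a b h = go
  where
  lem : ∀ t d x y → (x - y) - (d * ((x + t * 0ℤ) - (y + t * 0ℤ))) ≡ - (x - y) * (d - 1ℤ)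
  lem = solve-∀
  lem′ : ∀ x z → (x - z) + z ≡ x
  lem′ = solve-∀
  head : ∀ s → + suc s ∣ a 0 - b 0
  head s = ∣-subst (lem′ (a 0 - b 0) (d s * ((a 0 + t * 0ℤ) - (b 0 + t * 0ℤ))))
    (Div.∣m∣n⇒∣m+n (∣-subst (sym (lem t (d s) (a 0) (b 0))) (Div.∣n⇒∣m*n (- (a 0 - b 0)) (difference (d≡1 s))))
                   (subst (_∣ d s * ((a 0 + t * 0ℤ) - (b 0 + t * 0ℤ))) (ℤₚ.*-identityʳ t) (h s 1)))
    where t = + suc s
  a0≡b0 : a 0 ≡ b 0
  a0≡b0 = ℤₚ.i-j≡0⇒i≡j (a 0) (b 0) (suc∣⇒≡0 (a 0 - b 0) (head ∣ a 0 - b 0 ∣))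
  lem″ : ∀ t d x p q → d * ((x + t * p) - (x + t * q)) ≡ t * (d * (p - q))
  lem″ = solve-∀
  tails : ∀ s N → (+ suc s) ℤ.^ N ∣ d s * (horner (+ suc s) N (a ∘ suc) - horner (+ suc s) N (b ∘ suc))
  tails s N = Div.*-cancelˡ-∣ (+ suc s) (∣-subst
    (trans (cong (λ x → d s * ((a 0 + t * p) - (x + t * q))) (sym a0≡b0)) (lem″ t (d s) (a 0) p q)) (h s (suc N)))
    where
    t = + suc s
    p = horner t N (a ∘ suc)
    q = horner t N (b ∘ suc)
  go : ∀ k → a k ≡ b k
  go zero    = a0≡b0
  go (suc k) = horner-injective d d≡1 (a ∘ suc) (b ∘ suc) tails k

walks-determined : ∀ {n} (A B : Matrix n) →
  (∀ s → det (resolvent A (+ suc s)) ≡ det (resolvent B (+ suc s))) →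
  (∀ s → det (λ i j → resolvent A (+ suc s) i j + + suc s) ≡ det (λ i j → resolvent B (+ suc s) i j + + suc s)) →
  ∀ k → walks A k ≡ walks B k
walks-determined {n} A B hdet hdetJ = horner-injective (λ s → det (resolvent A (+ suc s))) d≡1 (walks A) (walks B) div
  where
  d≡1 : ∀ s → det (resolvent A (+ suc s)) ≡[ + suc s ] 1ℤ
  d≡1 s = mod-trans
    (det-mod (resolvent A (+ suc s)) (unit {n}) λ i j → congruent $ divides (- A i j) (lem (+ suc s) (unit i j) (A i j)))
    (mod-reflexive (det-unit {n}))
    where
    lem : ∀ t u a → (u - t * a) - u ≡ - a * t
    lem = solve-∀
  div : ∀ s N → (+ suc s) ℤ.^ N ∣ det (resolvent A (+ suc s)) * (horner (+ suc s) N (walks A) - horner (+ suc s) N (walks B))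
  div s N = Div.*-cancelˡ-∣ t (∣-subst (lem t d p q) (difference congr))
    where
    t = + suc s
    d = det (resolvent A t)
    p = horner t N (walks A)
    q = horner t N (walks B)
    lem : ∀ t d p q → (1ℤ + t * p) * d - (1ℤ + t * q) * d ≡ t * (d * (p - q))
    lem = solve-∀
    congr : (1ℤ + t * p) * d ≡[ t ℤ.^ suc N ] (1ℤ + t * q) * d
    congr = mod-trans (mod-sym (det-resolvent+J A t N))
      (mod-trans (mod-reflexive (hdetJ s))
        (mod-trans (det-resolvent+J B t N)
          (mod-reflexive (cong ((1ℤ + t * q) *_) (sym (hdet s))))))

-- From real spectra to integer determinants

record StrictHomomorphism (R S : RawRing 0ℓ 0ℓ) : Set where
  private
    module R = RawRing R
    module S = RawRing S
  field
    ⟦_⟧    : R.Carrier → S.Carrier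
    +-homo : ∀ x y → ⟦ x R.+ y ⟧ ≡ ⟦ x ⟧ S.+ ⟦ y ⟧
    *-homo : ∀ x y → ⟦ x R.* y ⟧ ≡ ⟦ x ⟧ S.* ⟦ y ⟧
    -‿homo : ∀ x → ⟦ R.- x ⟧ ≡ S.- ⟦ x ⟧
    0#-homo : ⟦ R.0# ⟧ ≡ S.0#
    1#-homo : ⟦ R.1# ⟧ ≡ S.1#

module _ {R S : RawRing 0ℓ 0ℓ} (h : StrictHomomorphism R S) where
  private
    module R = RawRing R
    module S = RawRing S
    module MatR′ = Matrices R
    module MatS′ = Matrices S
  open StrictHomomorphism h

  sum-homo : ∀ {n} (f : Fin n → R.Carrier) (g : Fin n → S.Carrier) → (∀ i → ⟦ f i ⟧ ≡ g i) → ⟦ MatR′.sum f ⟧ ≡ MatS′.sum g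
  sum-homo {zero}  f g eq = 0#-homo
  sum-homo {suc n} f g eq = trans (+-homo _ _) (cong₂ S._+_ (eq zero) (sum-homo (f ∘ suc) (g ∘ suc) (eq ∘ suc)))

  ^-homo : ∀ x k → ⟦ x MatR′.^ k ⟧ ≡ ⟦ x ⟧ MatS′.^ k
  ^-homo x zero    = 1#-homo
  ^-homo x (suc k) = trans (*-homo x (x MatR′.^ k)) (cong (⟦ x ⟧ S.*_) (^-homo x k))

  det-homo : ∀ {n} (M : MatR′.Matrix n) (N : MatS′.Matrix n) → (∀ i j → ⟦ M i j ⟧ ≡ N i j) → ⟦ MatR′.det M ⟧ ≡ MatS′.det N
  det-homo {zero}  M N eq = 1#-homo
  det-homo {suc n} M N eq = sum-homo (λ j → (R.- R.1#) MatR′.^ toℕ j R.* (M zero j R.* MatR′.det (λ i k → M (suc i) (punchIn j k))))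
    (λ j → (S.- S.1#) MatS′.^ toℕ j S.* (N zero j S.* MatS′.det (λ i k → N (suc i) (punchIn j k)))) λ j →
    trans (*-homo _ _) (cong₂ S._*_
      (trans (^-homo _ (toℕ j)) (cong (MatS′._^ toℕ j) (trans (-‿homo R.1#) (cong S.-_ 1#-homo))))
      (trans (*-homo _ _) (cong₂ S._*_ (eq zero j)
        (det-homo (λ i k → M (suc i) (punchIn j k)) (λ i k → N (suc i) (punchIn j k)) (λ i k → eq (suc i) (punchIn j k))))))

  charPoly-homo : ∀ {n} (G : Graph n) {x y} → ⟦ x ⟧ ≡ y →
    ⟦ MatR′.charPoly (MatR′.adjacency G) x ⟧ ≡ MatS′.charPoly (MatS′.adjacency G) y
  charPoly-homo G {x} {y} eq = det-homo _ _ entry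
    where
    neg : ∀ {a b} → ⟦ a ⟧ ≡ b → ⟦ R.- a ⟧ ≡ S.- b
    neg p = trans (-‿homo _) (cong S.-_ p)
    entry : ∀ i j → ⟦ MatR′.scalar x i j R.+ (R.- MatR′.adjacency G i j) ⟧
                  ≡ MatS′.scalar y i j S.+ (S.- MatS′.adjacency G i j)
    entry i j with i ≟ j | Graph.adj G i j
    ... | yes _ | true  = trans (+-homo _ _) (cong₂ S._+_ eq (neg 1#-homo))
    ... | yes _ | false = trans (+-homo _ _) (cong₂ S._+_ eq (neg 0#-homo))
    ... | no _  | true  = trans (+-homo _ _) (cong₂ S._+_ 0#-homo (neg 1#-homo))
    ... | no _  | false = trans (+-homo _ _) (cong₂ S._+_ 0#-homo (neg 0#-homo))

private
  module MatQ = Matrices ℚ.+-*-rawRing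
  module Σℚ = SemiringSum (CommutativeRing.semiring ℚₚ.+-*-commutativeRing)

seq-homo : ℕ → StrictHomomorphism ℝ-rawRing ℚ.+-*-rawRing
seq-homo k = record
  { ⟦_⟧ = λ x → seq x k
  ; +-homo = λ _ _ → refl ; *-homo = λ _ _ → refl ; -‿homo = λ _ → refl
  ; 0#-homo = refl ; 1#-homo = refl
  }

opaque
  ι : ℤ → ℚ
  ι z = ℚ.fromℚᵘ (mkℚᵘ z 0)

  toℚᵘ-ι : ∀ z → ℚ.toℚᵘ (ι z) ℚᵘ.≃ mkℚᵘ z 0
  toℚᵘ-ι z = ℚₚ.toℚᵘ-fromℚᵘ (mkℚᵘ z 0)

  ι-injective : ∀ {x y} → ι x ≡ ι y → x ≡ y
  ι-injective {x} {y} eq = trans (sym (ℤₚ.*-identityʳ x)) (trans (ℚᵘₚ.drop-*≡* (ℚₚ.fromℚᵘ-injective {mkℚᵘ x 0} {mkℚᵘ y 0} eq)) (ℤₚ.*-identityʳ y))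

  ι-+ : ∀ x y → ι (x + y) ≡ ι x ℚ.+ ι y
  ι-+ x y = ℚₚ.toℚᵘ-injective (ℚᵘₚ.≃-trans (toℚᵘ-ι (x + y))
    (ℚᵘₚ.≃-trans (ℚᵘ.*≡* (lem x y))
      (ℚᵘₚ.≃-sym (ℚᵘₚ.≃-trans (ℚₚ.toℚᵘ-homo-+ (ι x) (ι y)) (ℚᵘₚ.+-cong (toℚᵘ-ι x) (toℚᵘ-ι y))))))
    where
    lem : ∀ x y → (x + y) * 1ℤ ≡ (x * 1ℤ + y * 1ℤ) * 1ℤ
    lem = solve-∀

  ι-* : ∀ x y → ι (x * y) ≡ ι x ℚ.* ι y
  ι-* x y = ℚₚ.toℚᵘ-injective (ℚᵘₚ.≃-trans (toℚᵘ-ι (x * y))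
    (ℚᵘₚ.≃-sym (ℚᵘₚ.≃-trans (ℚₚ.toℚᵘ-homo-* (ι x) (ι y)) (ℚᵘₚ.*-cong (toℚᵘ-ι x) (toℚᵘ-ι y)))))

  ι-neg : ∀ x → ι (- x) ≡ ℚ.- ι x
  ι-neg x = ℚₚ.toℚᵘ-injective (ℚᵘₚ.≃-trans (toℚᵘ-ι (- x))
    (ℚᵘₚ.≃-sym (ℚᵘₚ.≃-trans (ℚₚ.toℚᵘ-homo‿- (ι x)) (ℚᵘₚ.-‿cong (toℚᵘ-ι x)))))

  ι-0 : ι 0ℤ ≡ ℚ.0ℚ
  ι-0 = refl

  ι-1 : ι 1ℤ ≡ ℚ.1ℚ
  ι-1 = refl

  ι-fraction : ∀ m p r s → m * p ≡ r * + suc s → ∃[ q ] ι m ℚ.* q ≡ ι r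
  ι-fraction m p r s eq = ℚ.fromℚᵘ (mkℚᵘ p s) , ℚₚ.toℚᵘ-injective
    (ℚᵘₚ.≃-trans (ℚₚ.toℚᵘ-homo-* (ι m) (ℚ.fromℚᵘ (mkℚᵘ p s)))
      (ℚᵘₚ.≃-trans (ℚᵘₚ.*-cong (toℚᵘ-ι m) (ℚₚ.toℚᵘ-fromℚᵘ (mkℚᵘ p s)))
        (ℚᵘₚ.≃-trans (ℚᵘ.*≡* (trans (ℤₚ.*-identityʳ (m * p)) (trans eq (cong (λ k → r * + suc k) (sym (ℕₚ.+-identityʳ s))))))
          (ℚᵘₚ.≃-sym (toℚᵘ-ι r)))))

ι-homo : StrictHomomorphism ℤ.+-*-rawRing ℚ.+-*-rawRing
ι-homo = record
  { ⟦_⟧ = ι ; +-homo = ι-+ ; *-homo = ι-* ; -‿homo = ι-neg ; 0#-homo = ι-0 ; 1#-homo = ι-1 }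

det-scale : ∀ {n} c (M : MatQ.Matrix n) → MatQ.det (λ i j → c ℚ.* M i j) ≡ c MatQ.^ n ℚ.* MatQ.det M
det-scale {zero}  c M = sym (ℚₚ.*-identityˡ ℚ.1ℚ)
det-scale {suc n} c M = trans
  (Σℚ.sum-cong-≗ λ j → trans (cong (λ d → sign j ℚ.* (c ℚ.* M zero j ℚ.* d)) (det-scale c (minor j)))
    (trans (cong (sign j ℚ.*_) (Q*.interchange c (M zero j) (c MatQ.^ n) (MatQ.det (minor j))))
      (Q*.x∙yz≈y∙xz (sign j) (c ℚ.* c MatQ.^ n) (M zero j ℚ.* MatQ.det (minor j)))))
  (sym (Σℚ.*-distribˡ-sum (c ℚ.* c MatQ.^ n) (λ j → sign j ℚ.* (M zero j ℚ.* MatQ.det (minor j)))))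
  where
  module Q* = CommutativeSemigroupProperties (CommutativeMonoid.commutativeSemigroup ℚₚ.*-1-commutativeMonoid)
  sign : Fin (suc n) → ℚ
  sign j = (ℚ.- ℚ.1ℚ) MatQ.^ toℕ j
  minor : Fin (suc n) → MatQ.Matrix n
  minor j i k = M (suc i) (punchIn j k)

constant-limit : ∀ (c d : ℚ) (x y z : ℝ) → (∀ k → seq x k ≡ c) → (∀ k → seq y k ≡ d) → x ≈ᴿ z → y ≈ᴿ z → c ≡ d
constant-limit c d x y z xc yd xz yz with ℚₚ.<-cmp ℚ.0ℚ ℚ.∣ c ℚ.- d ∣
... | tri> _ _ r<0 = contradiction (ℚₚ.≤-<-trans (ℚₚ.0≤∣p∣ (c ℚ.- d)) r<0) (ℚₚ.<-irrefl refl)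
... | tri≈ _ 0≡r _ = trans (lem c d) (trans (cong (ℚ._+ d) (ℚₚ.∣p∣≡0⇒p≡0 (c ℚ.- d) (sym 0≡r))) (ℚₚ.+-identityˡ d))
  where
  lem : ∀ c d → c ≡ (c ℚ.- d) ℚ.+ d
  lem = ℚSolver.solve 2 (λ c d → c ℚSolver.:= ((c ℚSolver.:- d) ℚSolver.:+ d)) refl
... | tri< 0<r _ _ = contradiction r<r (ℚₚ.<-irrefl refl)
  where
  r = ℚ.∣ c ℚ.- d ∣
  ε = ℚ.½ ℚ.* r
  0<ε : ℚ.0ℚ ℚ.< ε
  0<ε = subst (ℚ._< ε) (ℚₚ.*-zeroʳ ℚ.½) (ℚₚ.*-monoʳ-<-pos ℚ.½ 0<r)
  N = proj₁ (xz ε 0<ε) ℕ.⊔ proj₁ (yz ε 0<ε)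
  s = seq z N
  c-s : ℚ.∣ c ℚ.- s ∣ ℚ.< ε
  c-s = subst (λ w → ℚ.∣ w ℚ.- s ∣ ℚ.< ε) (xc N) (proj₂ (xz ε 0<ε) N (ℕₚ.m≤m⊔n _ _))
  d-s : ℚ.∣ d ℚ.- s ∣ ℚ.< ε
  d-s = subst (λ w → ℚ.∣ w ℚ.- s ∣ ℚ.< ε) (yd N) (proj₂ (yz ε 0<ε) N (ℕₚ.m≤n⊔m (proj₁ (xz ε 0<ε)) _))
  lem : ∀ c d s → (c ℚ.- s) ℚ.- (d ℚ.- s) ≡ c ℚ.- d
  lem = ℚSolver.solve 3 (λ c d s → ((c ℚSolver.:- s) ℚSolver.:- (d ℚSolver.:- s)) ℚSolver.:= (c ℚSolver.:- d)) refl
  r<r : r ℚ.< r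
  r<r = ℚₚ.≤-<-trans (subst (λ w → ℚ.∣ w ∣ ℚ.≤ ℚ.∣ c ℚ.- s ∣ ℚ.+ ℚ.∣ d ℚ.- s ∣) (lem c d s) (ℚₚ.∣p-q∣≤∣p∣+∣q∣ (c ℚ.- s) (d ℚ.- s)))
    (ℚₚ.<-≤-trans (ℚₚ.+-mono-< c-s d-s)
      (ℚₚ.≤-reflexive (trans (sym (ℚₚ.*-distribʳ-+ r ℚ.½ ℚ.½)) (ℚₚ.*-identityˡ r))))

cospectral-charPoly : ∀ {n} {G H : Graph n} → Cospectral G H → ∀ q →
  MatQ.charPoly (MatQ.adjacency G) q ≡ MatQ.charPoly (MatQ.adjacency H) q
cospectral-charPoly {n} {G} {H} (λs , (_ , sG) , (_ , sH)) q = constant-limit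
  (MatQ.charPoly (MatQ.adjacency G) q) (MatQ.charPoly (MatQ.adjacency H) q)
  (MatR.charPoly (MatR.adjacency G) (fromℚ q)) (MatR.charPoly (MatR.adjacency H) (fromℚ q)) ∏⟨ fromℚ q - λs ⟩
  (λ k → charPoly-homo (seq-homo k) G refl) (λ k → charPoly-homo (seq-homo k) H refl)
  (sG (fromℚ q)) (sH (fromℚ q))

scalarQ-unit : ∀ {n} q (i j : Fin n) → MatQ.scalar q i j ≡ q ℚ.* ι (unit i j)
scalarQ-unit q i j with i ≟ j
... | yes refl = sym (trans (cong (q ℚ.*_) (trans (cong ι (unit-refl i)) ι-1)) (ℚₚ.*-identityʳ q))
... | no i≢j   = sym (trans (cong (q ℚ.*_) (trans (cong ι (unit-≢ i≢j)) ι-0)) (ℚₚ.*-zeroʳ q))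

adjacencyQ-ι : ∀ {n} (G : Graph n) i j → MatQ.adjacency G i j ≡ ι (adjacency G i j)
adjacencyQ-ι G i j with Graph.adj G i j
... | true  = sym ι-1
... | false = sym ι-0

pencil : ∀ {n} → ℤ → ℤ → Graph n → Matrix n
pencil r m G i j = r * unit i j - m * adjacency G i j

ι-cleared : ∀ r m u a q → ι m ℚ.* q ≡ ι r → ι (r * u - m * a) ≡ ι m ℚ.* (q ℚ.* ι u ℚ.+ (ℚ.- ι a))
ι-cleared r m u a q mq≡r = begin
  ι (r * u - m * a)                          ≡⟨ ι-+ (r * u) (- (m * a)) ⟩
  ι (r * u) ℚ.+ ι (- (m * a))                ≡⟨ cong₂ ℚ._+_ (ι-* r u) (trans (ι-neg (m * a)) (cong ℚ.-_ (ι-* m a))) ⟩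
  ι r ℚ.* ι u ℚ.+ ℚ.- (ι m ℚ.* ι a)          ≡⟨ cong₂ (λ x y → x ℚ.* ι u ℚ.+ y) (sym mq≡r) (ℚₚ.neg-distribʳ-* (ι m) (ι a)) ⟩
  ι m ℚ.* q ℚ.* ι u ℚ.+ ι m ℚ.* (ℚ.- ι a)    ≡⟨ cong (ℚ._+ ι m ℚ.* (ℚ.- ι a)) (ℚₚ.*-assoc (ι m) q (ι u)) ⟩
  ι m ℚ.* (q ℚ.* ι u) ℚ.+ ι m ℚ.* (ℚ.- ι a)  ≡⟨ sym (ℚₚ.*-distribˡ-+ (ι m) (q ℚ.* ι u) (ℚ.- ι a)) ⟩
  ι m ℚ.* (q ℚ.* ι u ℚ.+ (ℚ.- ι a)) ∎
  where open ≡-Reasoning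

det-pencil : ∀ {n} r m q (G : Graph n) → ι m ℚ.* q ≡ ι r →
  ι (det (pencil r m G)) ≡ ι m MatQ.^ n ℚ.* MatQ.charPoly (MatQ.adjacency G) q
det-pencil {n} r m q G mq≡r = trans
  (det-homo ι-homo (pencil r m G) (λ i j → ι m ℚ.* char i j) entry)
  (det-scale (ι m) char)
  where
  char : MatQ.Matrix n
  char i j = MatQ.scalar q i j ℚ.+ (ℚ.- MatQ.adjacency G i j)
  entry : ∀ i j → ι (pencil r m G i j) ≡ ι m ℚ.* char i j
  entry i j = trans (ι-cleared r m (unit i j) (adjacency G i j) q mq≡r)
    (cong₂ (λ x y → ι m ℚ.* (x ℚ.+ (ℚ.- y))) (sym (scalarQ-unit q i j)) (sym (adjacencyQ-ι G i j)))

cospectral-pencil : ∀ {n} {G H : Graph n} → Cospectral G H → ∀ m p r s → m * p ≡ r * + suc s →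
  det (pencil r m G) ≡ det (pencil r m H)
cospectral-pencil {n} {G} {H} cosp m p r s eq = go (ι-fraction m p r s eq)
  where
  go : ∃[ q ] ι m ℚ.* q ≡ ι r → det (pencil r m G) ≡ det (pencil r m H)
  go (q , mq≡r) = ι-injective (trans (det-pencil r m q G mq≡r)
    (trans (cong (ι m MatQ.^ n ℚ.*_) (cospectral-charPoly {n} {G} {H} cosp q)) (sym (det-pencil r m q H mq≡r))))

complement-adjacency : ∀ {n} (G : Graph n) i j → adjacency (complement G) i j ≡ 1ℤ - unit i j - adjacency G i j
complement-adjacency G i j with i ≟ j
... | yes refl rewrite Graph.irrefl G i | unit-refl i = refl
... | no i≢j rewrite unit-≢ i≢j with Graph.adj G i j
...   | true  = refl
...   | false = refl

cospectral-walks : ∀ {n} {G H : Graph n} → Cospectral G H → Cospectral (complement G) (complement H) →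
  ∀ k → walks (adjacency G) k ≡ walks (adjacency H) k
cospectral-walks {n} {G} {H} cosp cospᶜ = walks-determined (adjacency G) (adjacency H) hdet hdetJ
  where
  hdet : ∀ s → det (resolvent (adjacency G) (+ suc s)) ≡ det (resolvent (adjacency H) (+ suc s))
  hdet s = trans (sym (det-ext (entry G))) (trans (cospectral-pencil {n} {G} {H} cosp (+ suc s) 1ℤ 1ℤ s (ℤₚ.*-comm (+ suc s) 1ℤ)) (det-ext (entry H)))
    where
    entry : ∀ G → pencil 1ℤ (+ suc s) G ≈₂ resolvent (adjacency G) (+ suc s)
    entry G i j = cong (_- + suc s * adjacency G i j) (ℤₚ.*-identityˡ (unit i j))
  -- x = −1 − 1/t, scaled by −t.
  hdetJ : ∀ s → det (λ i j → resolvent (adjacency G) (+ suc s) i j + + suc s) ≡ det (λ i j → resolvent (adjacency H) (+ suc s) i j + + suc s)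
  hdetJ s = trans (sym (det-ext (entry G)))
    (trans (cospectral-pencil {n} {complement G} {complement H} cospᶜ (- t) (- (t + 1ℤ)) (t + 1ℤ) s (lem t)) (det-ext (entry H)))
    where
    t = + suc s
    lem : ∀ t → - t * - (t + 1ℤ) ≡ (t + 1ℤ) * t
    lem = solve-∀
    lem′ : ∀ t u a → (t + 1ℤ) * u - - t * (1ℤ - u - a) ≡ u - t * a + t
    lem′ = solve-∀
    entry : ∀ G → pencil (t + 1ℤ) (- t) (complement G) ≈₂ (λ i j → resolvent (adjacency G) t i j + t)
    entry G i j = trans (cong (λ a → (t + 1ℤ) * unit i j - - t * a) (complement-adjacency G i j))
      (lem′ t (unit i j) (adjacency G i j))

-- Integral similarities between two symmetric matrices with equal walk counts

∙-congʳ : ∀ {n} (x : Vector ℤ n) {y y′ : Vector ℤ n} → y ≗ y′ → x ∙ y ≡ x ∙ y′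
∙-congʳ x q = ∙-cong {x = x} (λ _ → refl) q

∙-scaleʳ : ∀ {n} a (x y : Vector ℤ n) → x ∙ (λ i → a * y i) ≡ a * (x ∙ y)
∙-scaleʳ a x y = trans (sum-cong λ i → lem a (x i) (y i)) (*-sum a (λ i → x i * y i))
  where
  lem : ∀ a x y → x * (a * y) ≡ a * (x * y)
  lem = solve-∀

∙-scaleˡ : ∀ {n} a (x y : Vector ℤ n) → (λ i → a * x i) ∙ y ≡ a * (x ∙ y)
∙-scaleˡ a x y = trans (∙-comm (λ i → a * x i) y) (trans (∙-scaleʳ a y x) (cong (a *_) (∙-comm y x)))

Symmetric : ∀ {n} → Matrix n → Set
Symmetric A = ∀ i j → A i j ≡ A j i

*ᵥ-symmetric : ∀ {n} {A : Matrix n} → Symmetric A → ∀ u v → (A *ᵥ u) ∙ v ≡ u ∙ (A *ᵥ v)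
*ᵥ-symmetric {A = A} symm u v = sym (trans (∙-*ᵥ A u v)
  (∙-cong {y = v} (λ j → ∙-cong {x = transpose A j} {y = u} (λ i → symm i j) (λ _ → refl)) (λ _ → refl)))

iter-cong : ∀ {n} (A : Matrix n) {u v : Vector ℤ n} → u ≗ v → ∀ k → iter A u k ≗ iter A v k
iter-cong A eq zero    i = eq i
iter-cong A eq (suc k) i = ∙-congʳ (A i) (iter-cong A eq k)

iter-scale : ∀ {n} (A : Matrix n) a v k → iter A (λ i → a * v i) k ≗ (λ i → a * iter A v k i)
iter-scale A a v zero    i = refl
iter-scale A a v (suc k) i = trans (∙-congʳ (A i) (iter-scale A a v k)) (∙-scaleʳ a (A i) (iter A v k))

iter-linear : ∀ {n} (A : Matrix n) a b u v k →
  iter A (λ i → a * u i + b * v i) k ≗ (λ i → a * iter A u k i + b * iter A v k i)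
iter-linear A a b u v zero    i = refl
iter-linear A a b u v (suc k) i = trans (∙-congʳ (A i) (iter-linear A a b u v k)) (∙-linearʳ a b (A i) (iter A u k) (iter A v k))

iter-+ : ∀ {n} (A : Matrix n) v k l → iter A (iter A v l) k ≗ iter A v (k ℕ.+ l)
iter-+ A v zero    l i = refl
iter-+ A v (suc k) l i = ∙-congʳ (A i) (iter-+ A v k l)

iter-suc : ∀ {n} (A : Matrix n) v k → iter A (A *ᵥ v) k ≗ iter A v (suc k)
iter-suc A v zero    i = refl
iter-suc A v (suc k) i = ∙-congʳ (A i) (iter-suc A v k)

iter-symmetric : ∀ {n} {A : Matrix n} → Symmetric A → ∀ u v k → iter A u k ∙ v ≡ u ∙ iter A v k
iter-symmetric symm u v zero = refl
iter-symmetric {A = A} symm u v (suc k) =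
  trans (*ᵥ-symmetric symm (iter A u k) v)
    (trans (iter-symmetric symm u (A *ᵥ v) k) (∙-congʳ u (iter-suc A v k)))

iter-∙-iter : ∀ {n} {A : Matrix n} → Symmetric A → ∀ u v k l → iter A u k ∙ iter A v l ≡ u ∙ iter A v (k ℕ.+ l)
iter-∙-iter {A = A} symm u v k l = trans (iter-symmetric symm u (iter A v l) k) (∙-congʳ u (iter-+ A v k l))

krylov : ∀ {n} → Matrix n → Matrix n
krylov A i k = iter A ones (toℕ k) i

∙-krylov : ∀ {n} (A : Matrix n) v c → v ∙ (krylov A *ᵥ c) ≡ (λ k → iter A ones (toℕ k) ∙ v) ∙ c
∙-krylov A v c = ∙-*ᵥ (krylov A) v c

record Similarity {n} (A B : Matrix n) (ℓ : ℤ) (N : Fin n → Vector ℤ n) : Set where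
  field
    walk : ∀ k j → iter A ones k ∙ N j ≡ ℓ * iter B ones k j
    gram : ∀ k i j → N i ∙ iter A (N j) k ≡ ℓ * ℓ * iter B (unit j) k i

module _ {n} {A B : Matrix n} (symA : Symmetric A) (symB : Symmetric B) (w≡w : ∀ k → walks A k ≡ walks B k) where

  walks-∙ : ∀ k l → iter A ones k ∙ iter A ones l ≡ iter B ones k ∙ iter B ones l
  walks-∙ k l = trans (iter-∙-iter symA ones ones k l) (trans (w≡w (k ℕ.+ l)) (sym (iter-∙-iter symB ones ones k l)))

  krylov-det² : det (krylov A) * det (krylov A) ≡ det (krylov B) * det (krylov B)
  krylov-det² = trans (square A) (trans (det-ext {n} {transpose (krylov A) ⊡ krylov A} {transpose (krylov B) ⊡ krylov B} (λ k l → walks-∙ (toℕ k) (toℕ l))) (sym (square B)))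
    where
    square : ∀ A → det (krylov A) * det (krylov A) ≡ det (transpose (krylov A) ⊡ krylov A)
    square A = trans (cong (_* det (krylov A)) (sym (det-transpose (krylov A)))) (sym (det-⊡ (transpose (krylov A)) (krylov A)))

  private
    D : ℤ
    D = det (krylov B)
    c : Fin n → Vector ℤ n
    c j k = adjugate (krylov B) k j
    N : Fin n → Vector ℤ n
    N j = krylov A *ᵥ c j

    Bc : ∀ j → krylov B *ᵥ c j ≗ (λ i → D * unit j i)
    Bc j i = trans (⊡-adjugate (krylov B) i j) (cong (D *_) (unit-sym i j))

    N-walk : ∀ k j → iter A ones k ∙ N j ≡ D * iter B ones k j
    N-walk k j = begin
      iter A ones k ∙ N j                                ≡⟨ ∙-krylov A (iter A ones k) (c j) ⟩
      (λ l → iter A ones (toℕ l) ∙ iter A ones k) ∙ c j  ≡⟨ ∙-cong {y = c j} (λ l → walks-∙ (toℕ l) k) (λ _ → refl) ⟩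
      (λ l → iter B ones (toℕ l) ∙ iter B ones k) ∙ c j  ≡⟨ sym (∙-krylov B (iter B ones k) (c j)) ⟩
      iter B ones k ∙ (krylov B *ᵥ c j)                  ≡⟨ ∙-congʳ (iter B ones k) (Bc j) ⟩
      iter B ones k ∙ (λ i → D * unit j i)               ≡⟨ ∙-scaleʳ D (iter B ones k) (unit j) ⟩
      D * (iter B ones k ∙ unit j)                       ≡⟨ cong (D *_) (∙-unit j (iter B ones k)) ⟩
      D * iter B ones k j ∎
      where open ≡-Reasoning

    N-gram : ∀ k i j → N i ∙ iter A (N j) k ≡ D * D * iter B (unit j) k i
    N-gram k i j = begin
      N i ∙ iter A (N j) k
        ≡⟨ trans (∙-comm (N i) (iter A (N j) k)) (∙-krylov A (iter A (N j) k) (c i)) ⟩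
      (λ l → iter A ones (toℕ l) ∙ iter A (N j) k) ∙ c i
        ≡⟨ ∙-cong {y = c i} (λ l → move (toℕ l)) (λ _ → refl) ⟩
      (λ l → D * (iter B ones (toℕ l) ∙ iter B (unit j) k)) ∙ c i
        ≡⟨ ∙-scaleˡ D (λ l → iter B ones (toℕ l) ∙ iter B (unit j) k) (c i) ⟩
      D * ((λ l → iter B ones (toℕ l) ∙ iter B (unit j) k) ∙ c i)
        ≡⟨ cong (D *_) (sym (∙-krylov B (iter B (unit j) k) (c i))) ⟩
      D * (iter B (unit j) k ∙ (krylov B *ᵥ c i))
        ≡⟨ cong (D *_) (trans (∙-congʳ (iter B (unit j) k) (Bc i)) (∙-scaleʳ D (iter B (unit j) k) (unit i))) ⟩
      D * (D * (iter B (unit j) k ∙ unit i))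
        ≡⟨ cong (λ x → D * (D * x)) (∙-unit i (iter B (unit j) k)) ⟩
      D * (D * iter B (unit j) k i)
        ≡⟨ sym (ℤₚ.*-assoc D D (iter B (unit j) k i)) ⟩
      D * D * iter B (unit j) k i ∎
      where
      open ≡-Reasoning
      move : ∀ l → iter A ones l ∙ iter A (N j) k ≡ D * (iter B ones l ∙ iter B (unit j) k)
      move l = begin
        iter A ones l ∙ iter A (N j) k            ≡⟨ sym (iter-symmetric symA (iter A ones l) (N j) k) ⟩
        iter A (iter A ones l) k ∙ N j            ≡⟨ ∙-cong {y = N j} (iter-+ A ones k l) (λ _ → refl) ⟩
        iter A ones (k ℕ.+ l) ∙ N j               ≡⟨ N-walk (k ℕ.+ l) j ⟩
        D * iter B ones (k ℕ.+ l) j               ≡⟨ cong (D *_) (sym (iter-+ B ones k l j)) ⟩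
        D * iter B (iter B ones l) k j            ≡⟨ cong (D *_) (sym (∙-unit j (iter B (iter B ones l) k))) ⟩
        D * (iter B (iter B ones l) k ∙ unit j)   ≡⟨ cong (D *_) (iter-symmetric symB (iter B ones l) (unit j) k) ⟩
        D * (iter B ones l ∙ iter B (unit j) k) ∎

  similarity : ∃[ N ] Similarity A B (det (krylov B)) N
  similarity = N , record { walk = N-walk ; gram = N-gram }

-- Unimodular similarities are permutations

square-abs : ∀ x → x * x ≡ + (∣ x ∣ ℕ.* ∣ x ∣)
square-abs (+ k)        = sym (ℤₚ.pos-* k k)
square-abs (ℤ.-[1+ k ]) = refl

Σ²-cases : ∀ {n} (f : Vector ℤ n) → ∃[ s ] f ∙ f ≡ + s × (s ≡ 0 → ∀ i → f i ≡ 0ℤ) × (s ≡ 1 → ∃[ i ] ∀ j → j ≢ i → f j ≡ 0ℤ)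
Σ²-cases {zero} f = 0 , refl , (λ _ ()) , λ ()
Σ²-cases {suc n} f with f zero in eq | Σ²-cases (f ∘ suc)
... | x | s , f∙f≡s , zeros , one =
  ∣ x ∣ ℕ.* ∣ x ∣ ℕ.+ s , cong₂ _+_ (square-abs x) f∙f≡s , zeros′ , one′
  where
  abs-zero : ∣ x ∣ ℕ.* ∣ x ∣ ≡ 0 → x ≡ 0ℤ
  abs-zero h = ℤₚ.∣i∣≡0⇒i≡0 ([ (λ p → p) , (λ p → p) ]′ (ℕₚ.m*n≡0⇒m≡0∨n≡0 ∣ x ∣ h))
  zeros′ : ∣ x ∣ ℕ.* ∣ x ∣ ℕ.+ s ≡ 0 → ∀ i → f i ≡ 0ℤ
  zeros′ h zero    = trans eq (abs-zero (ℕₚ.m+n≡0⇒m≡0 _ h))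
  zeros′ h (suc i) = zeros (ℕₚ.m+n≡0⇒n≡0 (∣ x ∣ ℕ.* ∣ x ∣) h) i
  one′ : ∣ x ∣ ℕ.* ∣ x ∣ ℕ.+ s ≡ 1 → ∃[ i ] ∀ j → j ≢ i → f j ≡ 0ℤ
  one′ h with ∣ x ∣ ℕ.* ∣ x ∣ in eq²
  ... | zero = suc (proj₁ (one h)) , λ { zero _ → trans eq (abs-zero eq²) ; (suc j) j≢i → proj₂ (one h) j (j≢i ∘ cong suc) }
  ... | suc m = zero , λ { zero j≢i → contradiction refl j≢i
                         ; (suc j) _ → zeros (ℕₚ.m+n≡0⇒n≡0 m (ℕₚ.suc-injective h)) j }

sum-single : ∀ {n} (i : Fin n) (f : Vector ℤ n) → (∀ j → j ≢ i → f j ≡ 0ℤ) → f ≗ (λ j → f i * unit i j)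
sum-single i f eq j with i ≟ j
... | yes refl = sym (trans (cong (f i *_) (unit-refl i)) (ℤₚ.*-identityʳ (f i)))
... | no i≢j = trans (eq j (i≢j ∘ sym)) (sym (trans (cong (f i *_) (unit-≢ i≢j)) (ℤₚ.*-zeroʳ (f i))))

injective⇒surjective : ∀ {n} (π : Fin n → Fin n) → (∀ {i j} → π i ≡ π j → i ≡ j) → ∀ j → ∃[ i ] π i ≡ j
injective⇒surjective {suc n} π inj j with any? (λ i → π i ≟ j)
... | yes p = p
... | no ¬p = contradiction
  (injective⇒≤ {f = λ i → punchOut (λ eq → ¬p (i , sym eq))} (λ {i} {k} eq → inj (punchOut-injective {i = j} _ _ eq)))
  ℕₚ.1+n≰n

module _ {n} {A B : Matrix n} {ℓ : ℤ} {N : Fin n → Vector ℤ n} (sim : Similarity A B ℓ N) (ℓ²≡1 : ℓ * ℓ ≡ 1ℤ) where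
  open Similarity sim

  private
    gram-1 : ∀ k i j → N i ∙ iter A (N j) k ≡ iter B (unit j) k i
    gram-1 k i j = trans (gram k i j) (trans (cong (_* iter B (unit j) k i) ℓ²≡1) (ℤₚ.*-identityˡ (iter B (unit j) k i)))

    column : ∀ j → ∃[ i ] N j ≗ (λ k → ℓ * unit i k)
    column j with Σ²-cases (N j)
    ... | s , N∙N≡s , _ , one with one (ℤₚ.+-injective (trans (sym N∙N≡s) (trans (gram-1 0 j j) (unit-refl j))))
    ...   | i , off = i , λ k → trans (single k) (cong (_* unit i k) Nji≡ℓ)
      where
      single : N j ≗ (λ k → N j i * unit i k)
      single = sum-single i (N j) off
      Nji≡ℓ : N j i ≡ ℓ
      Nji≡ℓ = begin
        N j i                              ≡⟨ sym (ℤₚ.*-identityʳ (N j i)) ⟩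
        N j i * 1ℤ                         ≡⟨ cong (N j i *_) (sym (∙-unit i ones)) ⟩
        N j i * (ones ∙ unit i)            ≡⟨ sym (∙-scaleʳ (N j i) ones (unit i)) ⟩
        ones ∙ (λ k → N j i * unit i k)    ≡⟨ ∙-congʳ ones (sym ∘ single) ⟩
        ones ∙ N j                         ≡⟨ walk 0 j ⟩
        ℓ * 1ℤ                             ≡⟨ ℤₚ.*-identityʳ ℓ ⟩
        ℓ ∎
        where open ≡-Reasoning

  perm : Fin n → Fin n
  perm j = proj₁ (column j)

  private
    entry : ∀ k i j → iter A (unit (perm j)) k (perm i) ≡ iter B (unit j) k i
    entry k i j = begin
      v (perm i)                                   ≡⟨ sym (ℤₚ.*-identityˡ (v (perm i))) ⟩
      1ℤ * v (perm i)                              ≡⟨ cong (_* v (perm i)) (sym ℓ²≡1) ⟩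
      ℓ * ℓ * v (perm i)                           ≡⟨ ℤₚ.*-assoc ℓ ℓ (v (perm i)) ⟩
      ℓ * (ℓ * v (perm i))                         ≡⟨ cong (λ x → ℓ * (ℓ * x)) (sym (unit-∙ (perm i) v)) ⟩
      ℓ * (ℓ * (unit (perm i) ∙ v))                ≡⟨ cong (ℓ *_) (sym (∙-scaleʳ ℓ (unit (perm i)) v)) ⟩
      ℓ * (unit (perm i) ∙ (λ x → ℓ * v x))        ≡⟨ sym (∙-scaleˡ ℓ (unit (perm i)) (λ x → ℓ * v x)) ⟩
      (λ x → ℓ * unit (perm i) x) ∙ (λ x → ℓ * v x)
        ≡⟨ ∙-cong {y′ = iter A (N j) k} (sym ∘ proj₂ (column i))
             (λ x → trans (sym (iter-scale A ℓ (unit (perm j)) k x)) (iter-cong A (sym ∘ proj₂ (column j)) k x)) ⟩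
      N i ∙ iter A (N j) k                         ≡⟨ gram-1 k i j ⟩
      iter B (unit j) k i ∎
      where
      open ≡-Reasoning
      v = iter A (unit (perm j)) k

  perm-injective : ∀ {i j} → perm i ≡ perm j → i ≡ j
  perm-injective {i} {j} eq with j ≟ i
  ... | yes refl = refl
  ... | no j≢i = contradiction (trans (sym (unit-refl (perm j)))
    (trans (cong (unit (perm j)) (sym eq)) (trans (entry 0 i j) (unit-≢ j≢i)))) λ ()

  perm-matrix : ∀ i j → A (perm i) (perm j) ≡ B i j
  perm-matrix i j = trans (sym (∙-unit (perm j) (A (perm i)))) (trans (entry 1 i j) (∙-unit j (B i)))

adjacency-symmetric : ∀ {n} (G : Graph n) → Symmetric (adjacency G)
adjacency-symmetric G i j = cong (λ b → if b then 1ℤ else 0ℤ) (symm G i j)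

unimodular⇒≅ : ∀ {n} {G H : Graph n} {ℓ N} → Similarity (adjacency G) (adjacency H) ℓ N → ℓ * ℓ ≡ 1ℤ → G ≅ H
unimodular⇒≅ {n} {G} {H} sim ℓ²≡1 = mk↔ₛ′ inv π (λ j → inj (proj₂ (surj (π j)))) (λ i → proj₂ (surj i)) , λ i j →
  indicator (trans (cong₂ (adjacency G) (sym (proj₂ (surj i))) (sym (proj₂ (surj j)))) (perm-matrix sim ℓ²≡1 (inv i) (inv j)))
  where
  π = perm sim ℓ²≡1
  inj : ∀ {i j} → π i ≡ π j → i ≡ j
  inj = perm-injective sim ℓ²≡1
  surj = injective⇒surjective π inj
  inv : Fin n → Fin n
  inv i = proj₁ (surj i)
  indicator : ∀ {b b′ : Bool} → (if b then 1ℤ else 0ℤ) ≡ (if b′ then 1ℤ else 0ℤ) → b ≡ b′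
  indicator {true}  {true}  _ = refl
  indicator {false} {false} _ = refl

-- Primes dividing the level of a similarity

euclid : ∀ {q} → Prime q → ∀ x y → + q ∣ x * y → (+ q ∣ x) ⊎ (+ q ∣ y)
euclid {q} pr x y d with euclidsLemma ∣ x ∣ ∣ y ∣ pr (subst (q ℕ∣.∣_) (ℤₚ.abs-* x y) (Div.∣⇒∣ᵤ d))
... | inj₁ e = inj₁ (Div.∣ᵤ⇒∣ e)
... | inj₂ e = inj₂ (Div.∣ᵤ⇒∣ e)

module _ {q} (pr : Prime q) where
  private
    p : ℤ
    p = + q
    instance
      q≢0 : ℕ.NonZero q
      q≢0 = prime⇒nonZero pr

  euclid-cancel : ∀ x y → ¬ (p ∣ x) → p ∣ x * y → p ∣ y
  euclid-cancel x y p∤x d with euclid pr x y d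
  ... | inj₁ e = contradiction e p∤x
  ... | inj₂ e = e

  euclid-cancel² : ∀ x y → ¬ (p ∣ x) → p * p ∣ x * y → p * p ∣ y
  euclid-cancel² x y p∤x d with euclid-cancel x y p∤x (Div.∣-trans (Div.∣n⇒∣m*n p Div.∣-refl) d)
  ... | divides y′ refl = Div.*-monoˡ-∣ p (euclid-cancel x y′ p∤x
    (Div.*-cancelʳ-∣ p (∣-subst (sym (ℤₚ.*-assoc x y′ p)) d)))

Isotropic : ∀ {n} → Matrix n → ℤ → Vector ℤ n → Set
Isotropic A p u = (∀ k → p ∣ iter A ones k ∙ u) × (∀ k → p * p ∣ u ∙ iter A u k)

NoIsotropic : ∀ {n} → Matrix n → ℕ → Set
NoIsotropic A q = ∀ u → Isotropic A (+ q) u → ∀ i → + q ∣ u i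

prime-divisor : ∀ m → ∃[ q ] Prime q × q ℕ∣.∣ suc (suc m)
prime-divisor m with factorise (suc (suc m))
... | record { factors = q List.∷ qs ; isFactorisation = eq ; factorsPrime = pr All.∷ _ } =
  q , pr , ℕ∣.divides (product qs) (trans eq (ℕₚ.*-comm q (product qs)))

descent : ∀ {n} {A B : Matrix n} → (∀ q → Prime q → NoIsotropic A q) →
  ∀ {ℓ N} → Acc ℕ._<_ ∣ ℓ ∣ → ℓ ≢ 0ℤ → Similarity A B ℓ N → ∃₂ λ ℓ′ N′ → Similarity A B ℓ′ N′ × ℓ′ * ℓ′ ≡ 1ℤ
descent {n} {A} {B} none {ℓ} {N} (acc rec) ℓ≢0 sim with ∣ ℓ ∣ in eq
... | zero = contradiction (ℤₚ.∣i∣≡0⇒i≡0 eq) ℓ≢0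
... | suc zero = ℓ , N , sim , trans (square-abs ℓ) (cong (λ m → + (m ℕ.* m)) eq)
... | suc (suc m) with prime-divisor m
...   | q , pr , q∣ℓ = step (Div.∣ᵤ⇒∣ (subst (q ℕ∣.∣_) (sym eq) q∣ℓ))
  where
  open Similarity sim
  p = + q
  instance
    q≢0 : ℕ.NonZero q
    q≢0 = prime⇒nonZero pr
    nonTrivial : ℕ.NonTrivial q
    nonTrivial = prime⇒nonTrivial pr
  p∣N : p ∣ ℓ → ∀ j i → p ∣ N j i
  p∣N p∣ℓ j = none q pr (N j)
    ( (λ k → ∣-subst (sym (walk k j)) (Div.∣m⇒∣m*n (iter B ones k j) p∣ℓ))
    , (λ k → ∣-subst (sym (gram k j j)) (Div.∣m⇒∣m*n (iter B (unit j) k j)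
        (Div.∣-trans (Div.*-monoʳ-∣ p p∣ℓ) (Div.*-monoˡ-∣ ℓ p∣ℓ)))) )
  step : p ∣ ℓ → _
  step p∣ℓ@(divides ℓ′ ℓ≡ℓ′p) = descent none (rec smaller) ℓ′≢0 sim′
    where
    N′ : Fin n → Vector ℤ n
    N′ j i = Div.quotient (p∣N p∣ℓ j i)
    N≗ : ∀ j → N j ≗ (λ i → p * N′ j i)
    N≗ j i = trans (_∣_.equality (p∣N p∣ℓ j i)) (ℤₚ.*-comm (N′ j i) p)
    ℓ′≢0 : ℓ′ ≢ 0ℤ
    ℓ′≢0 refl = ℓ≢0 ℓ≡ℓ′p
    smaller : ∣ ℓ′ ∣ ℕ.< suc (suc m)
    smaller = subst (∣ ℓ′ ∣ ℕ.<_) (trans (sym (ℤₚ.abs-* ℓ′ p)) (trans (cong ∣_∣ (sym ℓ≡ℓ′p)) eq))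
      (ℕₚ.m<m*n ∣ ℓ′ ∣ q {{ℕ.≢-nonZero (ℓ′≢0 ∘ ℤₚ.∣i∣≡0⇒i≡0)}} (ℕ.nonTrivial⇒n>1 q))
    sim′ : Similarity A B ℓ′ N′
    sim′ = record
      { walk = λ k j → ℤₚ.*-cancelˡ-≡ p _ _ (begin
          p * (iter A ones k ∙ N′ j)           ≡⟨ sym (∙-scaleʳ p (iter A ones k) (N′ j)) ⟩
          iter A ones k ∙ (λ i → p * N′ j i)   ≡⟨ ∙-congʳ (iter A ones k) (sym ∘ N≗ j) ⟩
          iter A ones k ∙ N j                  ≡⟨ walk k j ⟩
          ℓ * iter B ones k j                  ≡⟨ cong (_* iter B ones k j) ℓ≡ℓ′p ⟩
          ℓ′ * p * iter B ones k j             ≡⟨ lem ℓ′ p (iter B ones k j) ⟩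
          p * (ℓ′ * iter B ones k j) ∎)
      ; gram = λ k i j → ℤₚ.*-cancelˡ-≡ p _ _ (ℤₚ.*-cancelˡ-≡ p _ _ (begin
          p * (p * (N′ i ∙ iter A (N′ j) k))           ≡⟨ cong (p *_) (sym (∙-scaleʳ p (N′ i) (iter A (N′ j) k))) ⟩
          p * (N′ i ∙ (λ x → p * iter A (N′ j) k x))   ≡⟨ sym (∙-scaleˡ p (N′ i) (λ x → p * iter A (N′ j) k x)) ⟩
          (λ x → p * N′ i x) ∙ (λ x → p * iter A (N′ j) k x)
            ≡⟨ ∙-cong {y′ = iter A (N j) k} (sym ∘ N≗ i) (λ x → trans (sym (iter-scale A p (N′ j) k x)) (iter-cong A (sym ∘ N≗ j) k x)) ⟩
          N i ∙ iter A (N j) k                         ≡⟨ gram k i j ⟩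
          ℓ * ℓ * iter B (unit j) k i                  ≡⟨ cong (λ l → l * l * iter B (unit j) k i) ℓ≡ℓ′p ⟩
          ℓ′ * p * (ℓ′ * p) * iter B (unit j) k i      ≡⟨ lem′ ℓ′ p (iter B (unit j) k i) ⟩
          p * (p * (ℓ′ * ℓ′ * iter B (unit j) k i)) ∎))
      }
      where
      open ≡-Reasoning
      lem : ∀ l p b → l * p * b ≡ p * (l * b)
      lem = solve-∀
      lem′ : ∀ l p b → l * p * (l * p) * b ≡ p * (p * (l * l * b))
      lem′ = solve-∀

-- Krylov combinations

kry : ∀ {n s} → Matrix n → Vector ℤ s → Vector ℤ n
kry A c i = (λ k → iter A ones (toℕ k) i) ∙ c

∙-kry : ∀ {n s} (A : Matrix n) v (c : Vector ℤ s) → v ∙ kry A c ≡ (λ k → iter A ones (toℕ k) ∙ v) ∙ c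
∙-kry A v c = ∙-*ᵥ (λ i k → iter A ones (toℕ k) i) v c

*ᵥ-kry : ∀ {n s} (A : Matrix n) (c : Vector ℤ s) → A *ᵥ kry A c ≗ kry A (0ℤ ∷ c)
*ᵥ-kry A c i = begin
  A i ∙ kry A c                              ≡⟨ ∙-kry A (A i) c ⟩
  (λ k → iter A ones (toℕ k) ∙ A i) ∙ c      ≡⟨ ∙-cong {y = c} (λ k → ∙-comm (iter A ones (toℕ k)) (A i)) (λ _ → refl) ⟩
  (λ k → iter A ones (suc (toℕ k)) i) ∙ c    ≡⟨ sym (ℤₚ.+-identityˡ _) ⟩
  kry A (0ℤ ∷ c) i ∎
  where open ≡-Reasoning

kry-init-last : ∀ {n s} (A : Matrix n) (c : Vector ℤ (suc s)) i →
  kry A c i ≡ kry A (c ∘ inject₁) i + iter A ones s i * c (fromℕ s)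
kry-init-last {s = s} A c i = trans (sum-init-last (λ k → iter A ones (toℕ k) i * c k))
  (cong₂ _+_ (sum-cong λ k → cong (λ m → iter A ones m i * c (inject₁ k)) (toℕ-inject₁ k))
             (cong (λ m → iter A ones m i * c (fromℕ s)) (toℕ-fromℕ s)))

pad : ∀ {n} → Vector ℤ n → Vector ℤ (suc n)
pad {zero}  c _       = 0ℤ
pad {suc n} c zero    = c zero
pad {suc n} c (suc k) = pad (c ∘ suc) k

∙-pad : ∀ {n} (a : ℕ → ℤ) (c : Vector ℤ n) → (λ k → a (toℕ k)) ∙ pad c ≡ (λ k → a (toℕ k)) ∙ c
∙-pad {zero}  a c = trans (ℤₚ.+-identityʳ (a 0 * 0ℤ)) (ℤₚ.*-zeroʳ (a 0))
∙-pad {suc n} a c = cong (_+_ (a 0 * c zero)) (∙-pad (a ∘ suc) (c ∘ suc))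

kry-pad : ∀ {n s} (A : Matrix n) (c : Vector ℤ s) → kry A (pad c) ≗ kry A c
kry-pad A c i = ∙-pad (λ k → iter A ones k i) c

pad-last : ∀ {m n} (c : Vector ℤ n) j → (∀ k → j Fin.< k → m ∣ c k) → m ∣ pad c (suc j)
pad-last {n = suc zero}    c zero    h = ∣0
pad-last {n = suc (suc n)} c zero    h = h (suc zero) (s≤s z≤n)
pad-last {n = suc n}       c (suc j) h = pad-last (c ∘ suc) j (λ k j<k → h (suc k) (s≤s j<k))

∣-∙ : ∀ {m n} (x y : Vector ℤ n) → (∀ i → m ∣ y i) → m ∣ x ∙ y
∣-∙ x y d = ∣-sum (λ i → x i * y i) (λ i → Div.∣n⇒∣m*n (x i) (d i))

∣-∙² : ∀ {m n} (x y : Vector ℤ n) → (∀ i → m ∣ x i) → (∀ i → m ∣ y i) → m * m ∣ x ∙ y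
∣-∙² {m} x y d e = ∣-sum (λ i → x i * y i) (λ i → Div.∣-trans (Div.*-monoʳ-∣ m (e i)) (Div.*-monoˡ-∣ (y i) (d i)))

adjugate-*ᵥ : ∀ {n} (M : Matrix n) v k → adjugate M k ∙ (M *ᵥ v) ≡ det M * v k
adjugate-*ᵥ M v k = begin
  adjugate M k ∙ (M *ᵥ v)                   ≡⟨ ∙-*ᵥ M (adjugate M k) v ⟩
  (λ j → transpose M j ∙ adjugate M k) ∙ v  ≡⟨ ∙-cong {y = v} (λ j → trans (∙-comm (transpose M j) (adjugate M k)) (adjugate-⊡ M k j)) (λ _ → refl) ⟩
  (λ j → det M * unit k j) ∙ v              ≡⟨ ∙-scaleˡ (det M) (unit k) v ⟩
  det M * (unit k ∙ v)                      ≡⟨ cong (det M *_) (unit-∙ k v) ⟩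
  det M * v k ∎
  where open ≡-Reasoning

*ᵥ-adjugate : ∀ {n} (M : Matrix n) v r → M r ∙ (adjugate M *ᵥ v) ≡ det M * v r
*ᵥ-adjugate M v r = begin
  M r ∙ (adjugate M *ᵥ v)                     ≡⟨ ∙-*ᵥ (adjugate M) (M r) v ⟩
  (λ j → transpose (adjugate M) j ∙ M r) ∙ v  ≡⟨ ∙-cong {y = v} (λ j → trans (∙-comm (transpose (adjugate M) j) (M r)) (⊡-adjugate M r j)) (λ _ → refl) ⟩
  (λ j → det M * unit r j) ∙ v                ≡⟨ ∙-scaleˡ (det M) (unit r) v ⟩
  det M * (unit r ∙ v)                        ≡⟨ cong (det M *_) (unit-∙ r v) ⟩
  det M * v r ∎
  where open ≡-Reasoning

∣-det : ∀ {m n} (R : Matrix n) u → (∀ r → m ∣ R r ∙ u) → ∀ i → m ∣ det R * u i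
∣-det R u d i = ∣-subst (adjugate-*ᵥ R u i) (∣-∙ (adjugate R i) (R *ᵥ u) d)

last-nondivisible : ∀ {n} m (c : Vector ℤ n) →
  (∀ j → m ∣ c j) ⊎ ∃[ j ] ¬ (m ∣ c j) × (∀ k → j Fin.< k → m ∣ c k)
last-nondivisible {zero}  m c = inj₁ λ ()
last-nondivisible {suc n} m c with last-nondivisible m (c ∘ suc)
... | inj₂ (j , ¬d , after) = inj₂ (suc j , ¬d , λ { (suc k) (s≤s j<k) → after k j<k })
... | inj₁ d with m Div.∣? c zero
...   | yes d₀ = inj₁ λ { zero → d₀ ; (suc j) → d j }
...   | no ¬d₀ = inj₂ (zero , ¬d₀ , λ { (suc k) _ → d k })

-- Linear algebra modulo 2

infix 4 2∣_

2∣_ : ℤ → Set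
2∣ x = + 2 ∣ x

parity : ∀ x → (2∣ x) ⊎ x ≡[ + 2 ] 1ℤ
parity x with x ℤ.% + 2 in eq | ℤ.n%d<d x (+ 2)
... | zero        | _ = inj₁ (divides (x ℤ./ + 2) (trans (ℤ.a≡a%n+[a/n]*n x (+ 2)) (trans (cong (λ r → + r + (x ℤ./ + 2) * + 2) eq) (ℤₚ.+-identityˡ _))))
... | suc zero    | _ = inj₂ (congruent (divides (x ℤ./ + 2) (trans (cong (_- 1ℤ) (trans (ℤ.a≡a%n+[a/n]*n x (+ 2)) (cong (λ r → + r + (x ℤ./ + 2) * + 2) eq))) (lem (x ℤ./ + 2 * + 2)))))
  where
  lem : ∀ y → 1ℤ + y - 1ℤ ≡ y
  lem = solve-∀
... | suc (suc _) | s≤s (s≤s ())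

odd⇒≡1 : ∀ {x} → ¬ (2∣ x) → x ≡[ + 2 ] 1ℤ
odd⇒≡1 {x} odd with parity x
... | inj₁ even = contradiction even odd
... | inj₂ x≡1  = x≡1

≡1⇒odd : ∀ {x} → x ≡[ + 2 ] 1ℤ → ¬ (2∣ x)
≡1⇒odd {x} (congruent d) e = contradiction (Div.∣⇒∣ᵤ (∣-subst (lem x) (Div.∣m∣n⇒∣m-n e d))) λ 2∣1 → contradiction (ℕ∣.∣⇒≤ 2∣1) λ { (s≤s ()) }
  where
  lem : ∀ x → x - (x - 1ℤ) ≡ 1ℤ
  lem = solve-∀

mod⇒∣ : ∀ {m x} → x ≡[ m ] 0ℤ → m ∣ x
mod⇒∣ {m} {x} (congruent d) = ∣-subst (ℤₚ.+-identityʳ x) d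

∣⇒mod : ∀ {m x} → m ∣ x → x ≡[ m ] 0ℤ
∣⇒mod {m} {x} d = congruent (∣-subst (sym (ℤₚ.+-identityʳ x)) d)

∣-mod : ∀ {m x y} → x ≡[ m ] y → m ∣ y → m ∣ x
∣-mod eq d = mod⇒∣ (mod-trans eq (∣⇒mod d))

∙-mod : ∀ {m n} (x : Vector ℤ n) {y y′ : Vector ℤ n} → (∀ i → y i ≡[ m ] y′ i) → x ∙ y ≡[ m ] x ∙ y′
∙-mod x {y} {y′} eq = mod-sum (λ i → x i * y i) (λ i → x i * y′ i) (λ i → mod-* (mod-refl {x = x i}) (eq i))

∙-modˡ : ∀ {m n} {x x′ : Vector ℤ n} (y : Vector ℤ n) → (∀ i → x i ≡[ m ] x′ i) → x ∙ y ≡[ m ] x′ ∙ y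
∙-modˡ {x = x} {x′} y eq = mod-sum (λ i → x i * y i) (λ i → x′ i * y i) (λ i → mod-* (eq i) (mod-refl {x = y i}))

∙-punchIn : ∀ {n} j (x y : Vector ℤ (suc n)) → x ∙ y ≡ x j * y j + (x ∘ punchIn j) ∙ (y ∘ punchIn j)
∙-punchIn j x y = sum-punchIn j (λ k → x k * y k)

underdetermined : ∀ {m s} (M : Fin m → Vector ℤ s) → m ℕ.< s →
  ∃[ f ] (∃[ k ] ¬ (2∣ f k)) × (∀ i → 2∣ M i ∙ f)
underdetermined {zero} {suc s} M _ = ones , (zero , ≡1⇒odd {1ℤ} mod-refl) , λ ()
underdetermined {suc m} {suc s} M (s≤s m<s) with last-nondivisible (+ 2) (M zero)
... | inj₁ even = proj₁ sol , proj₁ (proj₂ sol) , rows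
  where
  sol = underdetermined (M ∘ suc) (ℕₚ.m<n⇒m<1+n m<s)
  rows : ∀ i → 2∣ M i ∙ proj₁ sol
  rows zero    = ∣-subst (∙-comm (proj₁ sol) (M zero)) (∣-∙ (proj₁ sol) (M zero) even)
  rows (suc i) = proj₂ (proj₂ sol) i
... | inj₂ (j , odd , _) = f , (punchIn j (proj₁ fodd) , subst (λ x → ¬ (2∣ x)) (sym (f-punchIn (proj₁ fodd))) (proj₂ fodd)) , rows
  where
  M′ : Fin m → Vector ℤ s
  M′ i k = 1ℤ * M (suc i) (punchIn j k) + - M (suc i) j * M zero (punchIn j k)
  sol = underdetermined M′ m<s
  f′ = proj₁ sol
  fodd = proj₁ (proj₂ sol)
  S = (M zero ∘ punchIn j) ∙ f′
  f : Vector ℤ (suc s)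
  f = insertAt f′ j (- S)
  f-j : f j ≡ - S
  f-j = insertAt-lookup f′ j (- S)
  f-punchIn : ∀ k → f (punchIn j k) ≡ f′ k
  f-punchIn = insertAt-punchIn f′ j (- S)
  split : ∀ v → v ∙ f ≡ v j * - S + (v ∘ punchIn j) ∙ f′
  split v = trans (∙-punchIn j v f) (cong₂ _+_ (cong (v j *_) f-j) (∙-congʳ (v ∘ punchIn j) f-punchIn))
  rows : ∀ i → 2∣ M i ∙ f
  rows zero = ∣-subst (sym (trans (split (M zero)) (lem (M zero j) S))) (Div.∣n⇒∣m*n (- S) (_≡[_]_.difference (odd⇒≡1 odd)))
    where
    lem : ∀ a s → a * - s + s ≡ - s * (a - 1ℤ)
    lem = solve-∀
  rows (suc i) = ∣-subst (trans (∙-linearˡ 1ℤ (- M (suc i) j) (M (suc i) ∘ punchIn j) (M zero ∘ punchIn j) f′)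
    (sym (trans (split (M (suc i))) (lem (M (suc i) j) S ((M (suc i) ∘ punchIn j) ∙ f′))))) (proj₂ (proj₂ sol) i)
    where
    lem : ∀ a s t → a * - s + t ≡ 1ℤ * t + - a * s
    lem = solve-∀

linComb : ∀ {n s} → Vector ℤ s → (Fin s → Vector ℤ n) → Vector ℤ n
linComb c X i = (λ k → X k i) ∙ c

∙-linComb : ∀ {n s} v (c : Vector ℤ s) (X : Fin s → Vector ℤ n) → v ∙ linComb c X ≡ (λ k → X k ∙ v) ∙ c
∙-linComb v c X = ∙-*ᵥ (λ i k → X k i) v c

Dependent : ∀ {n s} → (Fin s → Vector ℤ n) → Set
Dependent X = ∃[ f ] (∃[ k ] ¬ (2∣ f k)) × (∀ i → 2∣ linComb f X i)

dependent-or-dual : ∀ {n s} (X : Fin s → Vector ℤ n) →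
  Dependent X ⊎ Σ[ Z ∈ (Fin s → Vector ℤ n) ] ∀ k l → Z k ∙ X l ≡[ + 2 ] unit k l
dependent-or-dual {n} {zero} X = inj₂ ((λ ()) , λ ())
dependent-or-dual {n} {suc s} X with dependent-or-dual (X ∘ suc)
... | inj₁ (f , (k , odd) , dep) = inj₁ (0ℤ ∷ f , (suc k , odd) , λ i →
  ∣-subst (sym (trans (cong (_+ linComb f (X ∘ suc) i) (ℤₚ.*-zeroʳ (X zero i))) (ℤₚ.+-identityˡ (linComb f (X ∘ suc) i)))) (dep i))
... | inj₂ (Z , dual) with last-nondivisible (+ 2) y
  where
  b : Vector ℤ s
  b k = Z k ∙ X zero
  y : Vector ℤ n
  y i = 1ℤ * X zero i + -1ℤ * linComb b (X ∘ suc) i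
...   | inj₁ even = inj₁ (1ℤ ∷ (λ k → -1ℤ * (Z k ∙ X zero)) , (zero , ≡1⇒odd {1ℤ} mod-refl) , λ i →
        ∣-subst (cong₂ _+_ (ℤₚ.*-comm 1ℤ (X zero i)) (sym (∙-scaleʳ -1ℤ (λ k → X (suc k) i) (λ k → Z k ∙ X zero)))) (even i))
...   | inj₂ (i , odd , _) = inj₂ (ζ ∷ Z′ , dual′)
  where
  b : Vector ℤ s
  b k = Z k ∙ X zero
  ζ : Vector ℤ n
  ζ j = 1ℤ * unit i j + -1ℤ * linComb (λ k → X (suc k) i) Z j
  ζ∙ : ∀ v → ζ ∙ v ≡ v i + - ((λ k → Z k ∙ v) ∙ (λ k → X (suc k) i))
  ζ∙ v = trans (∙-linearˡ 1ℤ -1ℤ (unit i) (linComb (λ k → X (suc k) i) Z) v)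
    (trans (cong₂ (λ a c → 1ℤ * a + -1ℤ * c) (unit-∙ i v) (trans (∙-comm (linComb (λ k → X (suc k) i) Z) v) (∙-linComb v (λ k → X (suc k) i) Z)))
      (lem (v i) ((λ k → Z k ∙ v) ∙ (λ k → X (suc k) i))))
    where
    lem : ∀ a c → 1ℤ * a + -1ℤ * c ≡ a + - c
    lem = solve-∀
  ζ∙X₀ : ζ ∙ X zero ≡[ + 2 ] 1ℤ
  ζ∙X₀ = mod-trans (mod-reflexive (trans (ζ∙ (X zero)) (trans (cong (λ c → X zero i + - c) (∙-comm b (λ k → X (suc k) i)))
    (lem (X zero i) (linComb b (X ∘ suc) i))))) (odd⇒≡1 odd)
    where
    lem : ∀ a c → a + - c ≡ 1ℤ * a + -1ℤ * c
    lem = solve-∀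
  ζ∙X : ∀ l → ζ ∙ X (suc l) ≡[ + 2 ] 0ℤ
  ζ∙X l = mod-trans (mod-reflexive (ζ∙ (X (suc l)))) (mod-trans
    (mod-+ (mod-refl {x = X (suc l) i}) (mod-neg (mod-trans (∙-modˡ (λ k → X (suc k) i) (λ k → dual k l))
      (mod-reflexive (trans (∙-cong {y = λ k → X (suc k) i} (λ k → unit-sym k l) (λ _ → refl)) (unit-∙ l (λ k → X (suc k) i)))))))
    (mod-reflexive (ℤₚ.+-inverseʳ (X (suc l) i))))
    where
    mod-neg : ∀ {x y} → x ≡[ + 2 ] y → - x ≡[ + 2 ] - y
    mod-neg {x} {y} (congruent d) = congruent (∣-subst (lem x y) (Div.∣m⇒∣-m d))
      where
      lem : ∀ x y → - (x - y) ≡ - x - - y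
      lem = solve-∀
  Z′ : Fin s → Vector ℤ n
  Z′ k j = 1ℤ * Z k j + - b k * ζ j
  Z′∙ : ∀ k v → Z′ k ∙ v ≡ 1ℤ * (Z k ∙ v) + - b k * (ζ ∙ v)
  Z′∙ k v = ∙-linearˡ 1ℤ (- b k) (Z k) ζ v
  dual′ : ∀ k l → (ζ ∷ Z′) k ∙ X l ≡[ + 2 ] unit k l
  dual′ zero    zero    = ζ∙X₀
  dual′ zero    (suc l) = ζ∙X l
  dual′ (suc k) zero    = mod-trans (mod-reflexive (Z′∙ k (X zero)))
    (mod-trans (mod-+ (mod-refl {x = 1ℤ * b k}) (mod-* (mod-refl {x = - b k}) ζ∙X₀)) (mod-reflexive (lem (b k))))
    where
    lem : ∀ b → 1ℤ * b + - b * 1ℤ ≡ 0ℤ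
    lem = solve-∀
  dual′ (suc k) (suc l) = mod-trans (mod-reflexive (Z′∙ k (X (suc l))))
    (mod-trans (mod-+ (mod-* (mod-refl {x = 1ℤ}) (dual k l)) (mod-* (mod-refl {x = - b k}) (ζ∙X l))) (mod-reflexive (lem (b k) (unit k l))))
    where
    lem : ∀ b u → 1ℤ * u + - b * 0ℤ ≡ u
    lem = solve-∀

sum-++ : ∀ {s t} (f : Vector ℤ (s ℕ.+ t)) → sum f ≡ sum (λ k → f (k Fin.↑ˡ t)) + sum (λ k → f (s Fin.↑ʳ k))
sum-++ {zero}  {t} f = sym (ℤₚ.+-identityˡ (sum f))
sum-++ {suc s} {t} f = trans (cong (_+_ (f zero)) (sum-++ {s} {t} (f ∘ suc)))
  (sym (ℤₚ.+-assoc (f zero) (sum (λ k → f (suc (k Fin.↑ˡ t)))) (sum (λ k → f (suc (s Fin.↑ʳ k))))))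

-- A totally isotropic family in 𝔽₂ⁿ that has a dual family spans, together
-- with it, a space of dimension 2s.
isotropic⇒dependent : ∀ {n s} (X : Fin s → Vector ℤ n) → (∀ k l → 2∣ X k ∙ X l) → n ℕ.< s ℕ.+ s → Dependent X
isotropic⇒dependent {n} {s} X iso n<2s with dependent-or-dual X
... | inj₁ dep = dep
... | inj₂ (Z , dual) with underdetermined (λ i → (λ k → X k i) ++ (λ k → Z k i)) n<2s
...   | f , (k₀ , odd) , eqs = a , a-odd , a-dep
  where
  a b : Vector ℤ s
  a k = f (k Fin.↑ˡ s)
  b k = f (s Fin.↑ʳ k)
  rows : ∀ i → 2∣ 1ℤ * linComb a X i + 1ℤ * linComb b Z i
  rows i = ∣-subst (trans (sum-++ {s} {s} (λ k → ((λ k → X k i) ++ (λ k → Z k i)) k * f k))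
    (trans (cong₂ _+_ (∙-cong {y = a} (λ k → lookup-++ˡ (λ k → X k i) (λ k → Z k i) k) (λ _ → refl))
               (∙-cong {y = b} (λ k → lookup-++ʳ (λ k → X k i) (λ k → Z k i) k) (λ _ → refl)))
      (lem (linComb a X i) (linComb b Z i)))) (eqs i)
    where
    lem : ∀ x y → x + y ≡ 1ℤ * x + 1ℤ * y
    lem = solve-∀
  b-even : ∀ l → 2∣ b l
  b-even l = ∣-mod (mod-sym b≡) (∣-∙ (X l) (λ i → 1ℤ * linComb a X i + 1ℤ * linComb b Z i) rows)
    where
    lem : ∀ y → 1ℤ * 0ℤ + 1ℤ * y ≡ y
    lem = solve-∀
    b≡ : X l ∙ (λ i → 1ℤ * linComb a X i + 1ℤ * linComb b Z i) ≡[ + 2 ] b l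
    b≡ = mod-trans (mod-reflexive (∙-linearʳ 1ℤ 1ℤ (X l) (linComb a X) (linComb b Z)))
      (mod-trans (mod-+ (mod-* (mod-refl {x = 1ℤ}) (∣⇒mod (∣-subst (sym (∙-linComb (X l) a X)) (∣-subst (∙-comm a (λ k → X k ∙ X l)) (∣-∙ a (λ k → X k ∙ X l) (λ k → iso k l))))))
                        (mod-* (mod-refl {x = 1ℤ}) (mod-trans (mod-reflexive (∙-linComb (X l) b Z)) (mod-trans (∙-modˡ b (λ k → dual k l))
                          (mod-reflexive (trans (∙-cong {y = b} (λ k → unit-sym k l) (λ _ → refl)) (unit-∙ l b)))))))
        (mod-reflexive (lem (b l))))
  a-dep : ∀ i → 2∣ linComb a X i
  a-dep i = ∣-subst (ℤₚ.*-identityˡ (linComb a X i)) (Div.∣m+n∣n⇒∣m {m = 1ℤ * linComb a X i} (rows i)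
    (Div.∣n⇒∣m*n 1ℤ (∣-∙ (λ k → Z k i) b b-even)))
  a-odd : ∃[ k ] ¬ (2∣ a k)
  a-odd with last-nondivisible (+ 2) a
  ... | inj₂ (k , odd , _) = k , odd
  ... | inj₁ a-even = contradiction (f-even k₀) odd
    where
    f-even : ∀ k → 2∣ f k
    f-even k with Fin.splitAt s k in eq
    ... | inj₁ k′ = ∣-subst (cong f (splitAt⁻¹-↑ˡ eq)) (a-even k′)
    ... | inj₂ k′ = ∣-subst (cong f (splitAt⁻¹-↑ʳ {m = s} eq)) (b-even k′)

module _ {n} {A : Matrix n} (symA : Symmetric A) (α lam p C : ℤ) (u β r₀ y : Vector ℤ n)
         (eigen : ∀ k → α * (A *ᵥ u) k - lam * u k ≡ p * β k) (y≡ : ∀ k → y k ≡ C * u k - p * r₀ k) where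

  remainder : Vector ℤ n
  remainder k = C * β k + -1ℤ * (α * (A *ᵥ r₀) k - lam * r₀ k)

  eigen-image : ∀ k → α * (A *ᵥ y) k + - lam * y k ≡ p * remainder k
  eigen-image k = begin
    α * (A *ᵥ y) k + - lam * y k
      ≡⟨ cong₂ (λ a b → α * a + - lam * b) (trans (∙-congʳ (A k) (λ s → trans (y≡ s) (lem (C * u s) p (r₀ s)))) (∙-linearʳ C (- p) (A k) u r₀)) (y≡ k) ⟩
    α * (C * (A *ᵥ u) k + - p * (A *ᵥ r₀) k) + - lam * (C * u k - p * r₀ k)
      ≡⟨ lem′ α C ((A *ᵥ u) k) p ((A *ᵥ r₀) k) lam (u k) (r₀ k) ⟩
    C * (α * (A *ᵥ u) k - lam * u k) - p * (α * (A *ᵥ r₀) k - lam * r₀ k)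
      ≡⟨ cong (λ z → C * z - p * (α * (A *ᵥ r₀) k - lam * r₀ k)) (eigen k) ⟩
    C * (p * β k) - p * (α * (A *ᵥ r₀) k - lam * r₀ k)
      ≡⟨ lem″ C p (β k) (α * (A *ᵥ r₀) k - lam * r₀ k) ⟩
    p * remainder k ∎
    where
    open ≡-Reasoning
    lem : ∀ a p r → a - p * r ≡ a + - p * r
    lem = solve-∀
    lem′ : ∀ α C v p w l u r → α * (C * v + - p * w) + - l * (C * u - p * r) ≡ C * (α * v - l * u) - p * (α * w - l * r)
    lem′ = solve-∀
    lem″ : ∀ C p b y → C * (p * b) - p * y ≡ p * (C * b + -1ℤ * y)
    lem″ = solve-∀

  remainder-∙ : remainder ∙ u ≡ C * (u ∙ β) + -1ℤ * (p * (β ∙ r₀))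
  remainder-∙ = trans (∙-linearˡ C -1ℤ β z u) (cong₂ (λ a b → C * a + -1ℤ * b) (∙-comm β u) (trans (∙-comm z u) uz))
    where
    open ≡-Reasoning
    z : Vector ℤ n
    z k = α * (A *ᵥ r₀) k - lam * r₀ k
    lem : ∀ a b c d → a * b - c * d ≡ a * b + - c * d
    lem = solve-∀
    uz : u ∙ z ≡ p * (β ∙ r₀)
    uz = begin
      u ∙ z                                              ≡⟨ ∙-congʳ u (λ k → lem α ((A *ᵥ r₀) k) lam (r₀ k)) ⟩
      u ∙ (λ k → α * (A *ᵥ r₀) k + - lam * r₀ k)         ≡⟨ ∙-linearʳ α (- lam) u (A *ᵥ r₀) r₀ ⟩
      α * (u ∙ (A *ᵥ r₀)) + - lam * (u ∙ r₀)             ≡⟨ cong (λ a → α * a + - lam * (u ∙ r₀)) (sym (*ᵥ-symmetric symA u r₀)) ⟩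
      α * ((A *ᵥ u) ∙ r₀) + - lam * (u ∙ r₀)             ≡⟨ sym (∙-linearˡ α (- lam) (A *ᵥ u) u r₀) ⟩
      (λ k → α * (A *ᵥ u) k + - lam * u k) ∙ r₀          ≡⟨ ∙-cong {y = r₀} (λ k → trans (sym (lem α ((A *ᵥ u) k) lam (u k))) (eigen k)) (λ _ → refl) ⟩
      (λ k → p * β k) ∙ r₀                               ≡⟨ ∙-scaleˡ p β r₀ ⟩
      p * (β ∙ r₀) ∎

-- If W f = p g, Cramer's rule writes f k * det W as p times a determinant,
-- which u annihilates modulo p in its turn.
double-zero : ∀ {n q} (pr : Prime q) (W : Matrix n) (f g u : Vector ℤ n) {i} → ¬ (+ q ∣ u i) →
  W *ᵥ f ≗ (λ r → + q * g r) → (∀ k → + q ∣ transpose W k ∙ u) → + q ∣ g ∙ u → ∀ k → + q * + q ∣ f k * det W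
double-zero {n} {q} pr W f g u {i} p∤uᵢ Wf null gu k =
  ∣-subst (sym eq) (Div.*-monoʳ-∣ p (euclid-cancel pr (u i) (det R) p∤uᵢ (∣-subst (ℤₚ.*-comm (det R) (u i)) (∣-det R u rows i))))
  where
  open ≡-Reasoning
  p = + q
  R : Matrix n
  R = transpose W [ k ≔ g ]
  rows : ∀ r → p ∣ R r ∙ u
  rows r with r ≟ k
  ... | yes refl = ∣-subst (cong (_∙ u) (sym (≔-same (transpose W) k))) gu
  ... | no r≢k   = ∣-subst (cong (_∙ u) (sym (≔-other (transpose W) r≢k))) (null r)
  eq : f k * det W ≡ p * det R
  eq = begin
    f k * det W                        ≡⟨ ℤₚ.*-comm (f k) (det W) ⟩
    det W * f k                        ≡⟨ sym (adjugate-*ᵥ W f k) ⟩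
    adjugate W k ∙ (W *ᵥ f)            ≡⟨ ∙-congʳ (adjugate W k) Wf ⟩
    adjugate W k ∙ (λ r → p * g r)     ≡⟨ ∙-scaleʳ p (adjugate W k) g ⟩
    p * (adjugate W k ∙ g)             ≡⟨ cong (p *_) (adjugate-∙ W k g) ⟩
    p * det R ∎

-- The odd primes: a simple zero of det W at p has no isotropic null vector

module _ {n′ q} (pr : Prime q) {A : Matrix (suc n′)} (symA : Symmetric A) where
  private
    n = suc n′
    p = + q
    instance
      q≢0 : ℕ.NonZero q
      q≢0 = prime⇒nonZero pr
    W = krylov A
    D = det W
    x : ℕ → Vector ℤ n
    x = iter A ones

  module _ {u : Vector ℤ n} {i : Fin n} (p∤uᵢ : ¬ (p ∣ u i)) (null : ∀ k → p ∣ x k ∙ u)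
           (p²∣uu : p * p ∣ u ∙ u) (p²∣uAu : p * p ∣ u ∙ (A *ᵥ u)) where
    private
      p∣p² : p ∣ p * p
      p∣p² = Div.∣n⇒∣m*n p Div.∣-refl

      -- If nonzero modulo p, this column of the adjugate spans the kernel of W there.
      f : Vector ℤ n
      f j = adjugate W j i

      Wf : W *ᵥ f ≗ (λ r → D * unit r i)
      Wf r = ⊡-adjugate W r i

      uᵢD : (λ k → x (toℕ k) ∙ u) ∙ f ≡ u i * D
      uᵢD = begin
        (λ k → x (toℕ k) ∙ u) ∙ f     ≡⟨ sym (∙-krylov A u f) ⟩
        u ∙ (W *ᵥ f)                  ≡⟨ ∙-congʳ u (λ r → trans (Wf r) (cong (D *_) (unit-sym r i))) ⟩
        u ∙ (λ r → D * unit i r)      ≡⟨ ∙-scaleʳ D u (unit i) ⟩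
        D * (u ∙ unit i)              ≡⟨ cong (D *_) (∙-unit i u) ⟩
        D * u i                       ≡⟨ ℤₚ.*-comm D (u i) ⟩
        u i * D ∎
        where open ≡-Reasoning

      p∣D : p ∣ D
      p∣D = euclid-cancel pr (u i) D p∤uᵢ (∣-subst (trans (∙-comm f (λ k → x (toℕ k) ∙ u)) uᵢD)
        (∣-∙ f (λ k → x (toℕ k) ∙ u) (λ k → null (toℕ k))))

      kernel : ∀ j → ¬ (p ∣ f j) → ∀ w → (∀ r → p ∣ (W *ᵥ w) r) → ∀ k → p ∣ f j * w k - w j * f k
      kernel j p∤fⱼ w Ww k = euclid-cancel pr (f j) (z k) p∤fⱼ (∣-subst (cong (_* z k) (det-transpose T)) (∣-det (transpose T) z rows k))
        where
        T : Matrix n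
        T = transpose W [ j ≔ unit i ]
        z : Vector ℤ n
        z k = f j * w k - w j * f k
        Wz : ∀ r → W r ∙ z ≡ f j * (W *ᵥ w) r + - w j * (W *ᵥ f) r
        Wz r = trans (∙-congʳ (W r) (λ k → lem (f j) (w k) (w j) (f k))) (∙-linearʳ (f j) (- w j) (W r) w f)
          where
          lem : ∀ a b c d → a * b - c * d ≡ a * b + - c * d
          lem = solve-∀
        Tz : ∀ r → transpose T r ∙ z ≡ W r ∙ z
        Tz r = sum-cong λ c → term c
          where
          zⱼ≡0 : z j ≡ 0ℤ
          zⱼ≡0 = lem (f j) (w j)
            where
            lem : ∀ a b → a * b - b * a ≡ 0ℤ
            lem = solve-∀
          term : ∀ c → T c r * z c ≡ W r c * z c
          term c with c ≟ j
          ... | yes refl = trans (cong (T c r *_) zⱼ≡0) (trans (ℤₚ.*-zeroʳ (T c r)) (sym (trans (cong (W r c *_) zⱼ≡0) (ℤₚ.*-zeroʳ (W r c)))))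
          ... | no c≢j = cong (λ v → v r * z c) (≔-other (transpose W) c≢j)
        rows : ∀ r → p ∣ transpose T r ∙ z
        rows r = ∣-subst (sym (trans (Tz r) (Wz r))) (Div.∣m∣n⇒∣m+n (Div.∣n⇒∣m*n (f j) (Ww r))
          (Div.∣n⇒∣m*n (- w j) (∣-subst (sym (Wf r)) (Div.∣m⇒∣m*n (unit r i) p∣D))))

      -- The coefficients of X f(X), with the top one dropped.
      shift : Vector ℤ n
      shift = 0ℤ ∷ f ∘ inject₁

      W-shift : p ∣ f (fromℕ n′) → ∀ r → p ∣ (W *ᵥ shift) r
      W-shift p∣top r = Div.∣m+n∣n⇒∣m {m = (W *ᵥ shift) r} (∣-subst eq p∣AWf) (Div.∣n⇒∣m*n (iter A ones n r) p∣top)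
        where
        p∣AWf : p ∣ (A *ᵥ (W *ᵥ f)) r
        p∣AWf = ∣-∙ (A r) (W *ᵥ f) (λ s → ∣-subst (sym (Wf s)) (Div.∣m⇒∣m*n (unit s i) p∣D))
        eq : (A *ᵥ (W *ᵥ f)) r ≡ (W *ᵥ shift) r + iter A ones n r * f (fromℕ n′)
        eq = begin
          (A *ᵥ kry A f) r   ≡⟨ *ᵥ-kry A f r ⟩
          kry A (0ℤ ∷ f) r   ≡⟨ kry-init-last A (0ℤ ∷ f) r ⟩
          kry A ((0ℤ ∷ f) ∘ inject₁) r + iter A ones n r * f (fromℕ n′)
            ≡⟨ cong (_+ iter A ones n r * f (fromℕ n′)) (∙-congʳ (λ k → iter A ones (toℕ k) r) {(0ℤ ∷ f) ∘ inject₁} {shift} λ { zero → refl ; (suc k) → refl }) ⟩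
          (W *ᵥ shift) r + iter A ones n r * f (fromℕ n′) ∎
          where open ≡-Reasoning

      C : ℤ
      C = f (fromℕ n′)

      top-cases : (p * p ∣ D) ⊎ ¬ (p ∣ C)
      top-cases with p Div.∣? C
      ... | no p∤C = inj₂ p∤C
      ... | yes p∣C with last-nondivisible p f
      ...   | inj₁ p∣f = inj₁ (euclid-cancel² pr (u i) D p∤uᵢ (∣-subst uᵢD (∣-∙² (λ k → x (toℕ k) ∙ u) f (λ k → null (toℕ k)) p∣f)))
      ...   | inj₂ (j , p∤fⱼ , after) with view j
      ...     | ‵fromℕ = contradiction p∣C p∤fⱼ
      ...     | ‵inject₁ j′ = contradiction p∣fⱼ p∤fⱼ
        where
        p∣fⱼ : p ∣ f (inject₁ j′)
        p∣fⱼ = euclid-cancel pr (f j) (f j) p∤fⱼ (Div.∣m+n∣n⇒∣m {m = f j * f j}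
          (kernel j p∤fⱼ shift (W-shift p∣C) (suc j′))
          (Div.∣m⇒∣-m (Div.∣n⇒∣m*n (shift j) (after (suc j′) (s≤s (ℕₚ.≤-reflexive (toℕ-inject₁ j′)))))))

      module _ (p∤C : ¬ (p ∣ C)) where
        top = fromℕ n′

        T : Matrix n
        T = transpose W [ top ≔ unit i ]

        T-top : T top ≡ unit i
        T-top = ≔-same (transpose W) top

        T-other : ∀ {c} → c ≢ top → T c ≡ x (toℕ c)
        T-other c≢top = ≔-other (transpose W) c≢top

        -- Au ≡ (λ/α) u modulo p, because the kernel of Wᵀ is a line.
        α lam : ℤ
        α = u i
        lam = (A *ᵥ u) i

        p∣eigen : ∀ k → p ∣ α * (A *ᵥ u) k - lam * u k
        p∣eigen k = euclid-cancel pr C (z k) p∤C (∣-det T z rows k)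
          where
          z : Vector ℤ n
          z k = α * (A *ᵥ u) k - lam * u k
          ∙z : ∀ v → v ∙ z ≡ α * (v ∙ (A *ᵥ u)) + - lam * (v ∙ u)
          ∙z v = trans (∙-congʳ v (λ k → lem α ((A *ᵥ u) k) lam (u k))) (∙-linearʳ α (- lam) v (A *ᵥ u) u)
            where
            lem : ∀ a b c d → a * b - c * d ≡ a * b + - c * d
            lem = solve-∀
          rows : ∀ r → p ∣ T r ∙ z
          rows r with r ≟ top
          ... | yes refl = ∣-subst (sym (trans (cong (_∙ z) T-top) (trans (unit-∙ i z) (lem α lam)))) ∣0
            where
            lem : ∀ a b → a * b - b * a ≡ 0ℤ
            lem = solve-∀
          ... | no r≢top = ∣-subst (sym (trans (cong (_∙ z) (T-other r≢top)) (∙z (x (toℕ r)))))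
            (Div.∣m∣n⇒∣m+n (Div.∣n⇒∣m*n α (∣-subst (*ᵥ-symmetric symA (x (toℕ r)) u) (null (suc (toℕ r)))))
                           (Div.∣n⇒∣m*n (- lam) (null (toℕ r))))

        β : Vector ℤ n
        β k = Div.quotient (p∣eigen k)

        eigen : ∀ k → α * (A *ᵥ u) k - lam * u k ≡ p * β k
        eigen k = trans (_∣_.equality (p∣eigen k)) (ℤₚ.*-comm (β k) p)

        p∣uβ : p ∣ u ∙ β
        p∣uβ = Div.*-cancelˡ-∣ p (∣-subst eq (Div.∣m∣n⇒∣m+n (Div.∣n⇒∣m*n α p²∣uAu) (Div.∣n⇒∣m*n (- lam) p²∣uu)))
          where
          lem : ∀ a b c d → a * b + - c * d ≡ a * b - c * d
          lem = solve-∀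
          eq : α * (u ∙ (A *ᵥ u)) + - lam * (u ∙ u) ≡ p * (u ∙ β)
          eq = trans (sym (∙-linearʳ α (- lam) u (A *ᵥ u) u))
            (trans (∙-congʳ u (λ k → trans (lem α ((A *ᵥ u) k) lam (u k)) (eigen k))) (∙-scaleʳ p u β))

        c : Vector ℤ n
        c = adjugate (transpose T) *ᵥ u

        Tc : transpose T *ᵥ c ≗ (λ r → C * u r)
        Tc r = trans (*ᵥ-adjugate (transpose T) u r) (cong (_* u r) (det-transpose T))

        p∣c-top : p ∣ c top
        p∣c-top = euclid-cancel pr α (c top) p∤uᵢ (Div.∣m+n∣n⇒∣m (∣-subst eq (Div.∣n⇒∣m*n C (Div.∣-trans p∣p² p²∣uu)))
          (∣-sum (λ k → (T (punchIn top k) ∙ u) * c (punchIn top k)) (λ k → Div.∣m⇒∣m*n (c (punchIn top k))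
            (∣-subst (cong (_∙ u) (sym (T-other (punchInᵢ≢i top k)))) (null (toℕ (punchIn top k)))))))
          where
          open ≡-Reasoning
          eq : C * (u ∙ u) ≡ α * c top + sum (λ k → (T (punchIn top k) ∙ u) * c (punchIn top k))
          eq = begin
            C * (u ∙ u)                     ≡⟨ sym (∙-scaleʳ C u u) ⟩
            u ∙ (λ r → C * u r)             ≡⟨ ∙-congʳ u (sym ∘ Tc) ⟩
            u ∙ (transpose T *ᵥ c)          ≡⟨ ∙-*ᵥ (transpose T) u c ⟩
            (λ k → T k ∙ u) ∙ c             ≡⟨ sum-punchIn top (λ k → (T k ∙ u) * c k) ⟩
            (T top ∙ u) * c top + sum (λ k → (T (punchIn top k) ∙ u) * c (punchIn top k))
              ≡⟨ cong (λ y → y * c top + sum (λ k → (T (punchIn top k) ∙ u) * c (punchIn top k))) (trans (cong (_∙ u) T-top) (unit-∙ i u)) ⟩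
            α * c top + sum (λ k → (T (punchIn top k) ∙ u) * c (punchIn top k)) ∎

        c̃ : Vector ℤ n′
        c̃ = c ∘ inject₁

        r₀ : Vector ℤ n
        r₀ k = Div.quotient p∣c-top * unit i k

        u-expansion : ∀ r → kry A c̃ r ≡ C * u r - p * r₀ r
        u-expansion r = begin
          K                                                ≡⟨ lem K (unit i r * c top) ⟩
          (K + unit i r * c top) - unit i r * c top        ≡⟨ cong (_- unit i r * c top) (sym split) ⟩
          (transpose T *ᵥ c) r - unit i r * c top          ≡⟨ cong₂ (λ a b → a - unit i r * b) (Tc r) (_∣_.equality p∣c-top) ⟩
          C * u r - unit i r * (e * p)                     ≡⟨ cong (λ y → C * u r - y) (lem′ (unit i r) e p) ⟩
          C * u r - p * r₀ r ∎
          where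
          open ≡-Reasoning
          e = Div.quotient p∣c-top
          K = kry A c̃ r
          lem : ∀ a b → a ≡ (a + b) - b
          lem = solve-∀
          lem′ : ∀ a e p → a * (e * p) ≡ p * (e * a)
          lem′ = solve-∀
          inject₁≢top : ∀ {k : Fin n′} → inject₁ k ≢ top
          inject₁≢top eq = fromℕ≢inject₁ (sym eq)
          split : (transpose T *ᵥ c) r ≡ K + unit i r * c top
          split = trans (sum-init-last (λ k → T k r * c k)) (cong₂ _+_
            (sum-cong λ k → cong (_* c (inject₁ k)) (trans (cong (λ v → v r) (T-other inject₁≢top)) (cong (λ m → x m r) (toℕ-inject₁ k))))
            (cong (λ v → v r * c top) T-top))

        -- Coefficients of (αX − λ) c̃(X).
        f′ : Vector ℤ n
        f′ k = α * (0ℤ ∷ c̃) k + - lam * pad c̃ k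

        g : Vector ℤ n
        g = remainder symA α lam p C u β r₀ (kry A c̃) eigen u-expansion

        Wf′ : W *ᵥ f′ ≗ (λ r → p * g r)
        Wf′ r = trans (∙-linearʳ α (- lam) (W r) (0ℤ ∷ c̃) (pad c̃))
          (trans (cong₂ (λ a b → α * a + - lam * b) (sym (*ᵥ-kry A c̃ r)) (kry-pad A c̃ r))
            (eigen-image symA α lam p C u β r₀ (kry A c̃) eigen u-expansion r))

        p∣gu : p ∣ g ∙ u
        p∣gu = ∣-subst (sym (remainder-∙ symA α lam p C u β r₀ (kry A c̃) eigen u-expansion))
          (Div.∣m∣n⇒∣m+n (Div.∣n⇒∣m*n C p∣uβ) (Div.∣n⇒∣m*n -1ℤ (Div.∣m⇒∣m*n (β ∙ r₀) Div.∣-refl)))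

        p²∣f′D : ∀ k → p * p ∣ f′ k * D
        p²∣f′D = double-zero pr W f′ g u p∤uᵢ Wf′ (λ k → null (toℕ k)) p∣gu

        f′-nonzero : ¬ (∀ k → p ∣ f′ k)
        f′-nonzero p∣f′ with last-nondivisible p c̃
        ... | inj₂ (j , p∤cⱼ , after) = p∤cⱼ (euclid-cancel pr α (c̃ j) p∤uᵢ
          (Div.∣m+n∣n⇒∣m {m = α * c̃ j} (p∣f′ (suc j)) (Div.∣n⇒∣m*n (- lam) (pad-last c̃ j after))))
        ... | inj₁ p∣c̃ = p∤uᵢ (euclid-cancel pr C (u i) p∤C (Div.∣m+n∣n⇒∣m {m = C * u i}
          (∣-subst (u-expansion i) (∣-∙ (λ k → x (toℕ k) i) c̃ p∣c̃)) (Div.∣m⇒∣-m (Div.∣m⇒∣m*n (r₀ i) Div.∣-refl))))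

        p²∣D : p * p ∣ D
        p²∣D = [ (λ p∣f′ → contradiction p∣f′ f′-nonzero) , (λ (k , p∤f′ₖ , _) → euclid-cancel² pr (f′ k) D p∤f′ₖ (p²∣f′D k)) ]′
          (last-nondivisible p f′)

    isotropic⇒p²∣det : p * p ∣ D
    isotropic⇒p²∣det = [ (λ d → d) , p²∣D ]′ top-cases

-- The prime 2

sum-symmetric : ∀ {n} m (a : Fin n → Vector ℤ n) → (∀ i j → a i j ≡ a j i) → (∀ i j → i ≢ j → m ∣ a i j) →
  sum (λ i → sum (a i)) ≡[ m * + 2 ] sum (λ i → a i i)
sum-symmetric {zero}  m a symm off = mod-refl {x = 0ℤ}
sum-symmetric {suc n} m a symm off = mod-trans (mod-reflexive split) (mod-trans
  (mod-+ (mod-refl {x = a zero zero}) (mod-+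
    (sum-symmetric m (λ i j → a (suc i) (suc j)) (λ i j → symm (suc i) (suc j)) (λ i j i≢j → off (suc i) (suc j) (i≢j ∘ λ { refl → refl })))
    (∣⇒mod {x = S * + 2} (Div.*-monoˡ-∣ (+ 2) (∣-sum (λ j → a zero (suc j)) (λ j → off zero (suc j) λ ()))))))
  (mod-reflexive (cong (_+_ (a zero zero)) (ℤₚ.+-identityʳ (sum (λ i → a (suc i) (suc i)))))))
  where
  S R : ℤ
  S = sum (λ j → a zero (suc j))
  R = sum (λ i → sum (λ j → a (suc i) (suc j)))
  lem : ∀ x s r → x + s + (s + r) ≡ x + (r + s * + 2)
  lem = solve-∀
  split : a zero zero + S + sum (λ i → a (suc i) zero + sum (λ j → a (suc i) (suc j))) ≡ a zero zero + (R + S * + 2)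
  split = trans (cong (λ s → a zero zero + S + s) (trans (sum-+ (λ i → a (suc i) zero) (λ i → sum (λ j → a (suc i) (suc j))))
    (cong (_+ R) (sum-cong λ i → symm (suc i) zero)))) (lem (a zero zero) S R)

even-or-odd : ∀ n → ∃[ h ] (n ≡ h ℕ.+ h ⊎ n ≡ suc (h ℕ.+ h))
even-or-odd zero = 0 , inj₁ refl
even-or-odd (suc n) with even-or-odd n
... | h , inj₁ eq = h , inj₂ (cong suc eq)
... | h , inj₂ eq = suc h , inj₁ (cong suc (trans eq (sym (ℕₚ.+-suc h h))))

square-mod-2 : ∀ y → y * y ≡[ + 2 ] y
square-mod-2 y with parity y
... | inj₁ e = mod-trans (∣⇒mod (Div.∣m⇒∣m*n y e)) (mod-sym (∣⇒mod e))
... | inj₂ o = mod-trans (mod-* o (mod-refl {x = y})) (mod-reflexive (ℤₚ.*-identityˡ y))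

ZeroDiagonal : ∀ {n} → Matrix n → Set
ZeroDiagonal A = ∀ i → A i i ≡ 0ℤ

module _ {n} {A : Matrix n} (symA : Symmetric A) (diagA : ZeroDiagonal A) where
  private
    x : ℕ → Vector ℤ n
    x = iter A ones

  alternating-even : ∀ v → 2∣ v ∙ (A *ᵥ v)
  alternating-even v = ∣-subst (sum-cong λ i → *-sum (v i) (λ j → A i j * v j)) (∣-mod
    (sum-symmetric 1ℤ (λ i j → v i * (A i j * v j)) swap (λ i j _ → divides (v i * (A i j * v j)) (sym (ℤₚ.*-identityʳ _))))
    (∣-subst (sym (sum-zero λ i → trans (cong (λ a → v i * (a * v i)) (diagA i)) (ℤₚ.*-zeroʳ (v i)))) ∣0))
    where
    lem : ∀ a b c → a * (b * c) ≡ c * (b * a)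
    lem = solve-∀
    swap : ∀ i j → v i * (A i j * v j) ≡ v j * (A j i * v i)
    swap i j = trans (cong (λ a → v i * (a * v j)) (symA i j)) (lem (v i) (A j i) (v j))

  walks-even : ∀ k → 0 ℕ.< k → 2∣ walks A k
  walks-even k = go k (<-wellFounded k)
    where
    go : ∀ k → Acc ℕ._<_ k → 0 ℕ.< k → 2∣ walks A k
    go k (acc rec) 0<k with even-or-odd k
    go k (acc rec) () | zero , inj₁ refl
    go k (acc rec) 0<k | suc h , inj₁ refl = ∣-subst (iter-∙-iter symA ones ones (suc h) (suc h))
      (∣-mod (mod-sum (λ i → x (suc h) i * x (suc h) i) (λ i → 1ℤ * x (suc h) i)
                (λ i → mod-trans (square-mod-2 (x (suc h) i)) (mod-reflexive (sym (ℤₚ.*-identityˡ (x (suc h) i))))))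
             (go (suc h) (rec (ℕₚ.m<m+n (suc h) (s≤s z≤n))) (s≤s z≤n)))
    go k (acc rec) 0<k | h , inj₂ refl = ∣-subst (trans (iter-∙-iter symA ones ones h (suc h)) (cong (walks A) (ℕₚ.+-suc h h)))
      (alternating-even (x h))

  monic : ∀ s (f : Vector ℤ (suc s)) → ∃[ k ] ¬ (2∣ f k) → (∀ i → 2∣ kry A f i) →
    ∃[ t ] t ≤ s × Σ[ c ∈ Vector ℤ t ] (∀ i → x t i ≡[ + 2 ] kry A c i)
  monic s f odd dep with parity (f (fromℕ s))
  ... | inj₂ (congruent d) = s , ℕₚ.≤-refl , f ∘ inject₁ , λ i → congruent (∣-subst (lem (kry A (f ∘ inject₁) i) (x s i) (f (fromℕ s)))
          (Div.∣m∣n⇒∣m+n (∣-subst (kry-init-last A f i) (dep i)) (Div.∣m∣n⇒∣m+n (Div.∣n⇒∣m*n (- x s i) d)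
            (Div.∣n⇒∣m*n (- kry A (f ∘ inject₁) i) Div.∣-refl))))
    where
    lem : ∀ K x l → (K + x * l) + (- x * (l - 1ℤ) + - K * + 2) ≡ x - K
    lem = solve-∀
  monic zero f (zero , odd) dep | inj₁ even = contradiction even odd
  monic (suc s) f (k , odd) dep | inj₁ even with monic s (f ∘ inject₁) (lower k odd)
      (λ i → Div.∣m+n∣n⇒∣m {m = kry A (f ∘ inject₁) i} (∣-subst (kry-init-last A f i) (dep i)) (Div.∣n⇒∣m*n (x (suc s) i) even))
    where
    lower : ∀ k → ¬ (2∣ f k) → ∃[ k ] ¬ (2∣ f (inject₁ k))
    lower k odd with view k
    ... | ‵fromℕ     = contradiction even odd
    ... | ‵inject₁ j = j , odd
  ... | t , t≤s , rest = t , ℕₚ.m≤n⇒m≤1+n t≤s , rest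

  module _ {t} (c : Vector ℤ t) (xₜ≡ : ∀ i → x t i ≡[ + 2 ] kry A c i) where

    reach : ∀ k → Σ[ d ∈ Vector ℤ t ] (∀ i → x k i ≡[ + 2 ] kry A d i)
    reach zero = base c xₜ≡
      where
      base : ∀ {t} (c : Vector ℤ t) → (∀ i → x t i ≡[ + 2 ] kry A c i) → Σ[ d ∈ Vector ℤ t ] (∀ i → x 0 i ≡[ + 2 ] kry A d i)
      base {zero}  c eq = c , eq
      base {suc t} c eq = unit zero , λ i → mod-reflexive (sym (∙-unit {suc t} zero (λ k → x (toℕ k) i)))
    reach (suc k) with reach k
    ... | d , x≡ = (λ j → 1ℤ * (0ℤ ∷ d) (inject₁ j) + (0ℤ ∷ d) (fromℕ t) * c j) , λ i →
      mod-trans (∙-mod (A i) x≡) (mod-trans (mod-reflexive (trans (*ᵥ-kry A d i) (kry-init-last A (0ℤ ∷ d) i)))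
        (mod-trans (mod-+ (mod-refl {x = kry A ((0ℤ ∷ d) ∘ inject₁) i}) (mod-* (xₜ≡ i) (mod-refl {x = (0ℤ ∷ d) (fromℕ t)})))
          (mod-reflexive (trans (lem (kry A ((0ℤ ∷ d) ∘ inject₁) i) (kry A c i) ((0ℤ ∷ d) (fromℕ t)))
            (sym (∙-linearʳ 1ℤ ((0ℤ ∷ d) (fromℕ t)) (λ k → x (toℕ k) i) ((0ℤ ∷ d) ∘ inject₁) c))))))
      where
      lem : ∀ a b l → a + b * l ≡ 1ℤ * a + l * b
      lem = solve-∀

    reduce : ∀ {s} (f : Vector ℤ s) → Σ[ d ∈ Vector ℤ t ] (∀ i → kry A f i ≡[ + 2 ] kry A d i)
    reduce f = (λ l → (λ k → coeff k l) ∙ f) , λ i →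
      mod-trans (∙-modˡ f (λ k → proj₂ (reach (toℕ k)) i)) (mod-reflexive (trans
        (∙-cong {y = f} (λ k → ∙-comm (λ l → x (toℕ l) i) (coeff k)) (λ _ → refl))
        (sym (∙-*ᵥ (λ l k → coeff k l) (λ l → x (toℕ l) i) f))))
      where
      coeff : _ → Vector ℤ t
      coeff k = proj₁ (reach (toℕ k))

  extend : ∀ {t r} → t ℕ.≤′ r → (c : Vector ℤ t) → Σ[ d ∈ Vector ℤ r ] (∀ i → kry A c i ≡ kry A d i)
  extend (ℕ.≤′-reflexive refl) c = c , λ _ → refl
  extend (ℕ.≤′-step t≤r) c with extend t≤r c
  ... | d , eq = pad d , λ i → trans (eq i) (sym (kry-pad A d i))

  span : ∀ {s r} (f : Vector ℤ (suc s)) → ∃[ k ] ¬ (2∣ f k) → (∀ i → 2∣ kry A f i) → s ≤ r →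
    ∀ {l} (c : Vector ℤ l) → Σ[ d ∈ Vector ℤ r ] (∀ i → kry A c i ≡[ + 2 ] kry A d i)
  span {s} f odd dep s≤r c with monic s f odd dep
  ... | t , t≤s , g , xₜ≡ with reduce g xₜ≡ c
  ...   | d , c≡d with extend (ℕₚ.≤⇒≤′ (ℕₚ.≤-trans t≤s s≤r)) d
  ...     | e , d≡e = e , λ i → mod-trans (c≡d i) (mod-reflexive (d≡e i))

  -- Modulo 4 the mixed terms of the quadratic form cancel in pairs.
  quadratic-mod-4 : ∀ {r} (v : Vector ℤ r) k →
    kry A v ∙ iter A (kry A v) k ≡[ + 4 ] (λ i → walks A (toℕ i ℕ.+ toℕ i ℕ.+ k)) ∙ (λ i → v i * v i)
  quadratic-mod-4 v k = mod-trans (mod-reflexive eq) (mod-trans (sum-symmetric (+ 2) a a-sym a-even) (mod-reflexive diag))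
    where
    open ≡-Reasoning
    y = kry A v
    a : _ → _ → ℤ
    a i j = walks A (toℕ j ℕ.+ (k ℕ.+ toℕ i)) * v j * v i
    move : ∀ i → x i ∙ iter A y k ≡ (λ j → walks A (toℕ j ℕ.+ (k ℕ.+ i))) ∙ v
    move i = begin
      x i ∙ iter A y k                       ≡⟨ sym (iter-symmetric symA (x i) y k) ⟩
      iter A (x i) k ∙ y                     ≡⟨ ∙-cong {y = y} (iter-+ A ones k i) (λ _ → refl) ⟩
      x (k ℕ.+ i) ∙ y                        ≡⟨ ∙-kry A (x (k ℕ.+ i)) v ⟩
      (λ j → x (toℕ j) ∙ x (k ℕ.+ i)) ∙ v    ≡⟨ ∙-cong {y = v} (λ j → iter-∙-iter symA ones ones (toℕ j) (k ℕ.+ i)) (λ _ → refl) ⟩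
      (λ j → walks A (toℕ j ℕ.+ (k ℕ.+ i))) ∙ v ∎
    eq : y ∙ iter A y k ≡ sum (λ i → sum (a i))
    eq = begin
      y ∙ iter A y k                                   ≡⟨ ∙-comm y (iter A y k) ⟩
      iter A y k ∙ y                                   ≡⟨ ∙-kry A (iter A y k) v ⟩
      (λ i → x (toℕ i) ∙ iter A y k) ∙ v               ≡⟨ ∙-cong {y = v} (λ i → move (toℕ i)) (λ _ → refl) ⟩
      (λ i → (λ j → walks A (toℕ j ℕ.+ (k ℕ.+ toℕ i))) ∙ v) ∙ v
        ≡⟨ sum-cong (λ i → sym (sum-* (v i) (λ j → walks A (toℕ j ℕ.+ (k ℕ.+ toℕ i)) * v j))) ⟩
      sum (λ i → sum (a i)) ∎
    index : ∀ i j k → j ℕ.+ (k ℕ.+ i) ≡ i ℕ.+ j ℕ.+ k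
    index i j k = trans (ℕₚ.+-comm j (k ℕ.+ i)) (trans (ℕₚ.+-assoc k i j) (ℕₚ.+-comm k (i ℕ.+ j)))
    lem : ∀ w a b → w * a * b ≡ w * b * a
    lem = solve-∀
    a-sym : ∀ i j → a i j ≡ a j i
    a-sym i j = trans (cong (λ m → walks A m * v j * v i)
      (trans (index (toℕ i) (toℕ j) k) (trans (cong (ℕ._+ k) (ℕₚ.+-comm (toℕ i) (toℕ j))) (sym (index (toℕ j) (toℕ i) k)))))
      (lem (walks A (toℕ i ℕ.+ (k ℕ.+ toℕ j))) (v j) (v i))
    positive : ∀ {r} (i j : Fin r) → i ≢ j → 0 ℕ.< toℕ j ℕ.+ (k ℕ.+ toℕ i)
    positive zero    zero    i≢j = contradiction refl i≢j
    positive (suc i) zero    _   = ℕₚ.<-≤-trans (s≤s z≤n) (ℕₚ.m≤n+m (suc (toℕ i)) k)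
    positive i       (suc j) _   = s≤s z≤n
    a-even : ∀ i j → i ≢ j → 2∣ a i j
    a-even i j i≢j = Div.∣m⇒∣m*n (v i) (Div.∣m⇒∣m*n (v j) (walks-even (toℕ j ℕ.+ (k ℕ.+ toℕ i)) (positive i j i≢j)))
    diag : sum (λ i → a i i) ≡ (λ i → walks A (toℕ i ℕ.+ toℕ i ℕ.+ k)) ∙ (λ i → v i * v i)
    diag = sum-cong λ i → trans (cong (λ m → walks A m * v i * v i) (index (toℕ i) (toℕ i) k)) (ℤₚ.*-assoc (walks A (toℕ i ℕ.+ toℕ i ℕ.+ k)) (v i) (v i))

  quadratic-shift : ∀ (u y β : Vector ℤ n) → (∀ i → u i ≡ 1ℤ * y i + + 2 * β i) → ∀ k →
    u ∙ iter A u k ≡[ + 4 ] y ∙ iter A y k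
  quadratic-shift u y β eq k = congruent (divides (β ∙ iter A y k + β ∙ iter A β k)
    (trans (cong (_- y ∙ iter A y k) expansion) (lem (y ∙ iter A y k) (β ∙ iter A y k) (β ∙ iter A β k))))
    where
    open ≡-Reasoning
    iter-u : ∀ z → z ∙ iter A u k ≡ 1ℤ * (z ∙ iter A y k) + + 2 * (z ∙ iter A β k)
    iter-u z = trans (∙-congʳ z (λ i → trans (iter-cong A eq k i) (iter-linear A 1ℤ (+ 2) y β k i)))
      (∙-linearʳ 1ℤ (+ 2) z (iter A y k) (iter A β k))
    expansion : u ∙ iter A u k ≡ 1ℤ * (1ℤ * (y ∙ iter A y k) + + 2 * (β ∙ iter A y k)) + + 2 * (1ℤ * (β ∙ iter A y k) + + 2 * (β ∙ iter A β k))
    expansion = begin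
      u ∙ iter A u k                                          ≡⟨ ∙-cong {y = iter A u k} eq (λ _ → refl) ⟩
      (λ i → 1ℤ * y i + + 2 * β i) ∙ iter A u k               ≡⟨ ∙-linearˡ 1ℤ (+ 2) y β (iter A u k) ⟩
      1ℤ * (y ∙ iter A u k) + + 2 * (β ∙ iter A u k)          ≡⟨ cong₂ (λ p q → 1ℤ * p + + 2 * q) (trans (iter-u y)
          (cong (λ p → 1ℤ * (y ∙ iter A y k) + + 2 * p) (trans (sym (iter-symmetric symA y β k)) (∙-comm (iter A y k) β)))) (iter-u β) ⟩
      1ℤ * (1ℤ * (y ∙ iter A y k) + + 2 * (β ∙ iter A y k)) + + 2 * (1ℤ * (β ∙ iter A y k) + + 2 * (β ∙ iter A β k)) ∎
    lem : ∀ p q r → 1ℤ * (1ℤ * p + + 2 * q) + + 2 * (1ℤ * q + + 2 * r) - p ≡ (q + r) * + 4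
    lem = solve-∀

spread : ∀ n → Vector ℤ ⌈ n /2⌉ → Vector ℤ n
spread (suc zero)    a zero          = a zero
spread (suc (suc n)) a zero          = a zero
spread (suc (suc n)) a (suc zero)    = 0ℤ
spread (suc (suc n)) a (suc (suc k)) = spread n (a ∘ suc) k

spread-zero : ∀ n (a : Vector ℤ ⌈ suc n /2⌉) → spread (suc n) a zero ≡ a zero
spread-zero zero    a = refl
spread-zero (suc n) a = refl

spread-index : ∀ n (a : Vector ℤ ⌈ n /2⌉) i → ∃[ l ] spread n a l ≡ a i
spread-index (suc zero)    a zero    = zero , refl
spread-index (suc (suc n)) a zero    = zero , refl
spread-index (suc (suc n)) a (suc i) = suc (suc (proj₁ (spread-index n (a ∘ suc) i))) , proj₂ (spread-index n (a ∘ suc) i)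

∙-spread : ∀ n (g : ℕ → ℤ) a → (λ k → g (toℕ k)) ∙ spread n a ≡ (λ i → g (toℕ i ℕ.+ toℕ i)) ∙ a
∙-spread zero          g a = refl
∙-spread (suc zero)    g a = refl
∙-spread (suc (suc n)) g a = cong (_+_ (g 0 * a zero)) (begin
  g 1 * 0ℤ + (λ k → g (suc (suc (toℕ k)))) ∙ spread n (a ∘ suc)
    ≡⟨ cong₂ _+_ (ℤₚ.*-zeroʳ (g 1)) (∙-spread n (λ k → g (suc (suc k))) (a ∘ suc)) ⟩
  0ℤ + (λ i → g (suc (suc (toℕ i ℕ.+ toℕ i)))) ∙ (a ∘ suc)
    ≡⟨ ℤₚ.+-identityˡ _ ⟩
  (λ i → g (suc (suc (toℕ i ℕ.+ toℕ i)))) ∙ (a ∘ suc)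
    ≡⟨ ∙-cong {y = a ∘ suc} (λ i → cong (g ∘ suc) (sym (ℕₚ.+-suc (toℕ i) (toℕ i)))) (λ _ → refl) ⟩
  (λ i → g (suc (toℕ i) ℕ.+ suc (toℕ i))) ∙ (a ∘ suc) ∎)
  where open ≡-Reasoning

∏ : ∀ {n} → Vector ℤ n → ℤ
∏ {zero}  e = 1ℤ
∏ {suc n} e = e zero * ∏ (e ∘ suc)

∏-replicate : ∀ n x → ∏ {n} (λ _ → x) ≡ x ℤ.^ n
∏-replicate zero    x = refl
∏-replicate (suc n) x = cong (x *_) (∏-replicate n x)

det-scale-rows : ∀ {n} (e : Vector ℤ n) (M : Matrix n) → det (λ i j → e i * M i j) ≡ ∏ e * det M
det-scale-rows {zero}  e M = refl
det-scale-rows {suc n} e M = trans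
  (sum-cong {f = λ j → (± j) * (e zero * M zero j * det (λ i k → e (suc i) * minor j i k))} λ j →
    trans (cong (λ d → (± j) * (e zero * M zero j * d)) (det-scale-rows (e ∘ suc) (minor j)))
          (lem (± j) (e zero) (M zero j) (∏ (e ∘ suc)) (det (minor j))))
  (*-sum (∏ e) (λ j → (± j) * (M zero j * det (minor j))))
  where
  minor : Fin (suc n) → Matrix n
  minor j i k = M (suc i) (punchIn j k)
  lem : ∀ s e m p d → s * (e * m * (p * d)) ≡ e * p * (s * (m * d))
  lem = solve-∀

-- ε₀ is 2 when n is even and 1 when n is odd, so that the Gram matrix of the
-- Krylov vectors is divisible columnwise by (ε₀, 2, …, 2) with odd determinant.
module _ {n′} {A : Matrix (suc n′)} (symA : Symmetric A) (diagA : ZeroDiagonal A)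
         (ε₀ κ₀ : ℤ) (ε₀κ₀≡2 : ε₀ * κ₀ ≡ + 2) (ε₀∣w : ∀ k → ε₀ ∣ walks A k)
         (d : ℤ) (d-odd : ¬ (2∣ d)) (D≢0 : det (krylov A) ≢ 0ℤ)
         (D² : det (krylov A) * det (krylov A) ≡ ε₀ * (+ 2) ℤ.^ n′ * (d * d)) where
  private
    n = suc n′
    W = krylov A
    x : ℕ → Vector ℤ n
    x = iter A ones

    ε κ : Vector ℤ n
    ε = ε₀ ∷ λ _ → + 2
    κ = κ₀ ∷ λ _ → 1ℤ

    εκ≡2 : ∀ l → ε l * κ l ≡ + 2
    εκ≡2 zero    = ε₀κ₀≡2
    εκ≡2 (suc l) = refl

    ε∣w : ∀ k l → ε l ∣ walks A (k ℕ.+ toℕ l)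
    ε∣w k zero    = ε₀∣w (k ℕ.+ 0)
    ε∣w k (suc l) = walks-even symA diagA (k ℕ.+ suc (toℕ l)) (ℕₚ.<-≤-trans (s≤s z≤n) (ℕₚ.m≤n+m (suc (toℕ l)) k))

    M : Matrix n
    M k l = Div.quotient (ε∣w (toℕ k) l)

    Mε : ∀ k l → ε l * M k l ≡ x (toℕ k) ∙ x (toℕ l)
    Mε k l = trans (ℤₚ.*-comm (ε l) (M k l)) (trans (sym (_∣_.equality (ε∣w (toℕ k) l))) (sym (iter-∙-iter symA ones ones (toℕ k) (toℕ l))))

    m = det M
    D = det W

    ε₀2^n≢0 : ε₀ * (+ 2) ℤ.^ n′ ≢ 0ℤ
    ε₀2^n≢0 eq = [ D≢0 , D≢0 ]′ (ℤₚ.i*j≡0⇒i≡0∨j≡0 D (trans D² (cong (_* (d * d)) eq)))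

    m≡d² : m ≡ d * d
    m≡d² = ℤₚ.*-cancelˡ-≡ (ε₀ * (+ 2) ℤ.^ n′) m (d * d) {{ℤ.≢-nonZero ε₀2^n≢0}} (begin
      ε₀ * (+ 2) ℤ.^ n′ * m                        ≡⟨ cong (λ p → ε₀ * p * m) (sym (∏-replicate n′ (+ 2))) ⟩
      ∏ ε * m                                      ≡⟨ cong (∏ ε *_) (sym (det-transpose M)) ⟩
      ∏ ε * det (transpose M)                      ≡⟨ sym (det-scale-rows ε (transpose M)) ⟩
      det (λ l k → ε l * M k l)                    ≡⟨ det-ext {n} {λ l k → ε l * M k l} {transpose W ⊡ W} (λ l k → trans (Mε k l) (∙-comm (x (toℕ k)) (x (toℕ l)))) ⟩
      det (transpose W ⊡ W)                        ≡⟨ det-⊡ (transpose W) W ⟩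
      det (transpose W) * D                        ≡⟨ cong (_* D) (det-transpose W) ⟩
      D * D                                        ≡⟨ D² ⟩
      ε₀ * (+ 2) ℤ.^ n′ * (d * d) ∎)
      where open ≡-Reasoning

    m≡1 : m ≡[ + 2 ] 1ℤ
    m≡1 = mod-trans (mod-reflexive m≡d²) (mod-trans (square-mod-2 d) (odd⇒≡1 d-odd))

    x-W : ∀ k z → x (toℕ k) ∙ (W *ᵥ (λ l → κ l * z l)) ≡ + 2 * (M k ∙ z)
    x-W k z = begin
      x (toℕ k) ∙ (W *ᵥ (λ l → κ l * z l))                   ≡⟨ ∙-krylov A (x (toℕ k)) (λ l → κ l * z l) ⟩
      (λ l → x (toℕ l) ∙ x (toℕ k)) ∙ (λ l → κ l * z l)      ≡⟨ sum-cong term ⟩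
      sum (λ l → + 2 * (M k l * z l))                        ≡⟨ *-sum (+ 2) (λ l → M k l * z l) ⟩
      + 2 * (M k ∙ z) ∎
      where
      open ≡-Reasoning
      lem : ∀ e m κ z → e * m * (κ * z) ≡ e * κ * (m * z)
      lem = solve-∀
      term : ∀ l → (x (toℕ l) ∙ x (toℕ k)) * (κ l * z l) ≡ + 2 * (M k l * z l)
      term l = trans (cong (_* (κ l * z l)) (trans (∙-comm (x (toℕ l)) (x (toℕ k))) (sym (Mε k l))))
        (trans (lem (ε l) (M k l) (κ l) (z l)) (cong (_* (M k l * z l)) (εκ≡2 l)))

    kernel-even : ∀ z → (∀ k → + 4 ∣ x (toℕ k) ∙ (W *ᵥ (λ l → κ l * z l))) → ∀ l → 2∣ z l
    kernel-even z h l = euclid-cancel prime[2] m (z l) (≡1⇒odd m≡1)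
      (∣-det M z (λ k → Div.*-cancelˡ-∣ (+ 2) (∣-subst (x-W k z) (h k))) l)

    null⇒image : ∀ u → (∀ k → 2∣ x k ∙ u) → ∃[ c ] (∀ i → u i ≡[ + 2 ] (W *ᵥ c) i)
    null⇒image u null = c , λ i → mod-trans (mod-reflexive (sym (ℤₚ.*-identityˡ (u i))))
      (mod-trans (mod-* (mod-sym m≡1) (mod-refl {x = u i})) (mod-reflexive (sym (Wc i))))
      where
      h c′ c : Vector ℤ n
      h k = Div.quotient (null (toℕ k))
      c′ = adjugate M *ᵥ h
      c l = κ l * c′ l
      z : Vector ℤ n
      z i = 1ℤ * (W *ᵥ c) i + - m * u i
      z⊥ : ∀ k → x (toℕ k) ∙ z ≡ 0ℤ
      z⊥ k = begin
        x (toℕ k) ∙ z                                           ≡⟨ ∙-linearʳ 1ℤ (- m) (x (toℕ k)) (W *ᵥ c) u ⟩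
        1ℤ * (x (toℕ k) ∙ (W *ᵥ c)) + - m * (x (toℕ k) ∙ u)
          ≡⟨ cong₂ (λ p q → 1ℤ * p + - m * q) (trans (x-W k c′) (cong (+ 2 *_) (*ᵥ-adjugate M h k))) (_∣_.equality (null (toℕ k))) ⟩
        1ℤ * (+ 2 * (m * h k)) + - m * (h k * + 2)              ≡⟨ lem m (h k) ⟩
        0ℤ ∎
        where
        open ≡-Reasoning
        lem : ∀ m h → 1ℤ * (+ 2 * (m * h)) + - m * (h * + 2) ≡ 0ℤ
        lem = solve-∀
      z≡0 : ∀ i → z i ≡ 0ℤ
      z≡0 i = [ (λ D≡0 → contradiction (trans (sym (det-transpose W)) D≡0) D≢0) , (λ eq → eq) ]′
        (ℤₚ.i*j≡0⇒i≡0∨j≡0 (det (transpose W)) (Div.0∣⇒≡0 (∣-det (transpose W) z (λ k → ∣-subst (sym (z⊥ k)) ∣0) i)))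
      Wc : ∀ i → (W *ᵥ c) i ≡ m * u i
      Wc i = trans (lem ((W *ᵥ c) i) m (u i)) (trans (cong (_+ m * u i) (z≡0 i)) (ℤₚ.+-identityˡ (m * u i)))
        where
        lem : ∀ w m u → w ≡ (1ℤ * w + - m * u) + m * u
        lem = solve-∀

  module _ (spanning : ∀ (c : Vector ℤ n) → Σ[ v ∈ Vector ℤ ⌈ n /2⌉ ] (∀ i → kry A c i ≡[ + 2 ] kry A v i))
           (κ₀∣ : ∀ (v : Vector ℤ ⌈ n /2⌉) → 2∣ ones ∙ kry A v → κ₀ ∣ v zero) where

    isotropic⇒even : NoIsotropic A 2
    isotropic⇒even u (null , iso) i = ∣-mod (u≡y i) (∣-∙ (λ k → x (toℕ k) i) v v-even)
      where
      c = null⇒image u null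
      v = proj₁ (spanning (proj₁ c))
      y = kry A v
      u≡y : ∀ i → u i ≡[ + 2 ] y i
      u≡y i = mod-trans (proj₂ c i) (proj₂ (spanning (proj₁ c)) i)
      β : Vector ℤ n
      β i = Div.quotient (_≡[_]_.difference (u≡y i))
      u≡ : ∀ i → u i ≡ 1ℤ * y i + + 2 * β i
      u≡ i = trans (lem (u i) (y i)) (trans (cong (_+_ (1ℤ * y i)) (_∣_.equality (_≡[_]_.difference (u≡y i)))) (cong (_+_ (1ℤ * y i)) (ℤₚ.*-comm (β i) (+ 2))))
        where
        lem : ∀ u y → u ≡ 1ℤ * y + (u - y)
        lem = solve-∀
      squares : Vector ℤ ⌈ n /2⌉
      squares i = v i * v i
      w : Vector ℤ n
      w = spread n squares
      w-orthogonal : ∀ k → + 4 ∣ x k ∙ (W *ᵥ w)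
      w-orthogonal k = ∣-subst (sym eq) (∣-mod (mod-sym (mod-trans (quadratic-shift symA diagA u y β u≡ k) (quadratic-mod-4 symA diagA v k))) (iso k))
        where
        eq : x k ∙ (W *ᵥ w) ≡ (λ i → walks A (toℕ i ℕ.+ toℕ i ℕ.+ k)) ∙ squares
        eq = trans (∙-krylov A (x k) w) (trans (∙-cong {y = w} (λ l → iter-∙-iter symA ones ones (toℕ l) k) (λ _ → refl))
          (∙-spread n (λ l → walks A (l ℕ.+ k)) squares))
      κ₀∣w₀ : κ₀ ∣ w zero
      κ₀∣w₀ = ∣-subst (sym (spread-zero n′ squares)) (Div.∣m⇒∣m*n (v zero) (κ₀∣ v (∣-mod (mod-sym (∙-mod ones u≡y)) (null 0))))
      z : Vector ℤ n
      z = Div.quotient κ₀∣w₀ ∷ (w ∘ suc)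
      w≡κz : ∀ l → w l ≡ κ l * z l
      w≡κz zero    = trans (_∣_.equality κ₀∣w₀) (ℤₚ.*-comm (Div.quotient κ₀∣w₀) κ₀)
      w≡κz (suc l) = sym (ℤₚ.*-identityˡ (w (suc l)))
      w-even : ∀ l → 2∣ w l
      w-even l = ∣-subst (sym (w≡κz l)) (Div.∣n⇒∣m*n (κ l) (kernel-even z
        (λ k → ∣-subst (∙-congʳ (x (toℕ k)) (λ i → ∙-congʳ (W i) w≡κz)) (w-orthogonal (toℕ k))) l))
      v-even : ∀ i → 2∣ v i
      v-even i with spread-index n squares i
      ... | l , eq = [ (λ e → e) , (λ e → e) ]′ (euclid prime[2] (v i) (v i) (∣-subst eq (w-even l)))

pos-^ : ∀ k → + (2 ℕ.^ k) ≡ (+ 2) ℤ.^ k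
pos-^ zero    = refl
pos-^ (suc k) = trans (ℤₚ.pos-* 2 (2 ℕ.^ k)) (cong (+ 2 *_) (pos-^ k))

module _ {n} {A : Matrix n} (symA : Symmetric A) (diagA : ZeroDiagonal A) where

  walks-0 : walks A 0 ≡ + n
  walks-0 = go n
    where
    go : ∀ n → ones {n} ∙ ones ≡ + n
    go zero    = refl
    go (suc n) = cong (_+_ 1ℤ) (go n)

  even-count : ∀ h → n ≡ h ℕ.+ h → ∀ k → 2∣ walks A k
  even-count h n≡ zero    = ∣-subst (sym (trans walks-0 (cong +_ n≡))) (Div.∣ᵤ⇒∣ (ℕ∣.divides h (trans (cong (h ℕ.+_) (sym (ℕₚ.+-identityʳ h))) (ℕₚ.*-comm 2 h))))
  even-count h n≡ (suc k) = walks-even symA diagA (suc k) (s≤s z≤n)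

no-isotropic-2 : ∀ {n′} {A : Matrix (suc n′)} → Symmetric A → ZeroDiagonal A → ∀ d → ¬ (2∣ d) → det (krylov A) ≢ 0ℤ →
  det (krylov A) ≡ d * + (2 ℕ.^ ⌊ suc n′ /2⌋) → NoIsotropic A 2
no-isotropic-2 {n′} {A} symA diagA d d-odd D≢0 D≡ with even-or-odd (suc n′)
... | h , inj₁ n≡2h = isotropic⇒even symA diagA (+ 2) 1ℤ refl w-even d d-odd D≢0 D²
  (span symA diagA (proj₁ dep) (proj₁ (proj₂ dep)) (proj₂ (proj₂ dep)) (ℕₚ.≤-reflexive h≡))
  (λ v _ → divides (v zero) (sym (ℤₚ.*-identityʳ (v zero))))
  where
  w-even = even-count symA diagA h n≡2h
  h≡ : h ≡ ⌈ suc n′ /2⌉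
  h≡ = trans (ℕₚ.n≡⌈n+n/2⌉ h) (cong ⌈_/2⌉ (sym n≡2h))
  dep = isotropic⇒dependent (λ (k : Fin (suc h)) → iter A ones (toℕ k))
    (λ k l → ∣-subst (sym (iter-∙-iter symA ones ones (toℕ k) (toℕ l))) (w-even (toℕ k ℕ.+ toℕ l)))
    (subst (ℕ._< suc h ℕ.+ suc h) (sym n≡2h) (s≤s (ℕₚ.+-monoʳ-≤ h (ℕₚ.n≤1+n h))))
  lem : ∀ d p → d * p * (d * p) ≡ p * p * (d * d)
  lem = solve-∀
  D² : det (krylov A) * det (krylov A) ≡ + 2 * (+ 2) ℤ.^ n′ * (d * d)
  D² = trans (cong₂ _*_ D≡ D≡) (trans (lem d (+ (2 ℕ.^ ⌊ suc n′ /2⌋))) (cong (_* (d * d)) (begin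
    + (2 ℕ.^ ⌊ suc n′ /2⌋) * + (2 ℕ.^ ⌊ suc n′ /2⌋)  ≡⟨ cong (λ k → + (2 ℕ.^ k) * + (2 ℕ.^ k)) (trans (cong ⌊_/2⌋ n≡2h) (sym (ℕₚ.n≡⌊n+n/2⌋ h))) ⟩
    + (2 ℕ.^ h) * + (2 ℕ.^ h)                        ≡⟨ sym (ℤₚ.pos-* (2 ℕ.^ h) (2 ℕ.^ h)) ⟩
    + (2 ℕ.^ h ℕ.* 2 ℕ.^ h)                          ≡⟨ cong +_ (sym (ℕₚ.^-distribˡ-+-* 2 h h)) ⟩
    + (2 ℕ.^ (h ℕ.+ h))                              ≡⟨ cong (λ k → + (2 ℕ.^ k)) (sym n≡2h) ⟩
    + (2 ℕ.^ suc n′)                                 ≡⟨ pos-^ (suc n′) ⟩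
    + 2 * (+ 2) ℤ.^ n′ ∎)))
    where open ≡-Reasoning
... | h , inj₂ n≡1+2h = isotropic⇒even symA diagA 1ℤ (+ 2) refl (λ k → divides (walks A k) (sym (ℤₚ.*-identityʳ (walks A k)))) d d-odd D≢0 D²
  (span symA diagA (0ℤ ∷ proj₁ dep) (suc (proj₁ (proj₁ (proj₂ dep))) , proj₂ (proj₁ (proj₂ dep))) dep′ (ℕₚ.≤-reflexive 1+h≡))
  head-even
  where
  x : ℕ → Vector ℤ (suc n′)
  x = iter A ones
  2h≡n′ : h ℕ.+ h ≡ n′
  2h≡n′ = ℕₚ.suc-injective (sym n≡1+2h)
  1+h≡ : suc h ≡ ⌈ suc n′ /2⌉
  1+h≡ = cong suc (trans (ℕₚ.n≡⌊n+n/2⌋ h) (cong ⌊_/2⌋ 2h≡n′))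
  dep = isotropic⇒dependent (λ (k : Fin (suc h)) → x (suc (toℕ k)))
    (λ k l → ∣-subst (sym (iter-∙-iter symA ones ones (suc (toℕ k)) (suc (toℕ l)))) (walks-even symA diagA (suc (toℕ k ℕ.+ suc (toℕ l))) (s≤s z≤n)))
    (subst (ℕ._< suc h ℕ.+ suc h) (sym n≡1+2h) (s≤s (ℕₚ.≤-reflexive (sym (ℕₚ.+-suc h h)))))
  dep′ : ∀ i → 2∣ kry A (0ℤ ∷ proj₁ dep) i
  dep′ i = ∣-subst (sym (ℤₚ.+-identityˡ ((λ k → x (suc (toℕ k)) i) ∙ proj₁ dep))) (proj₂ (proj₂ dep) i)
  head-even : ∀ (v : Vector ℤ ⌈ suc n′ /2⌉) → 2∣ ones ∙ kry A v → 2∣ v zero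
  head-even v e = euclid-cancel prime[2] (x 0 ∙ ones) (v zero) n-odd
    (Div.∣m+n∣n⇒∣m {m = (x 0 ∙ ones) * v zero} (∣-subst (∙-kry A ones v) e)
      (∣-sum (λ k → (x (suc (toℕ k)) ∙ ones) * v (suc k)) (λ k → Div.∣m⇒∣m*n (v (suc k))
        (∣-subst (∙-comm ones (x (suc (toℕ k)))) (walks-even symA diagA (suc (toℕ k)) (s≤s z≤n))))))
    where
    n-odd : ¬ (2∣ x 0 ∙ ones)
    n-odd = subst (λ m → ¬ (2∣ m)) (sym (trans (walks-0 symA diagA) (cong +_ n≡1+2h)))
      (≡1⇒odd (congruent (divides (+ h) (trans (lem (+ (h ℕ.+ h))) (trans (ℤₚ.pos-+ h h) (lem′ (+ h)))))))
      where
      lem : ∀ y → 1ℤ + y - 1ℤ ≡ y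
      lem = solve-∀
      lem′ : ∀ y → y + y ≡ y * + 2
      lem′ = solve-∀
  lem : ∀ d p → d * p * (d * p) ≡ p * p * (d * d)
  lem = solve-∀
  D² : det (krylov A) * det (krylov A) ≡ 1ℤ * (+ 2) ℤ.^ n′ * (d * d)
  D² = trans (cong₂ _*_ D≡ D≡) (trans (lem d (+ (2 ℕ.^ ⌊ suc n′ /2⌋))) (cong (_* (d * d)) (begin
    + (2 ℕ.^ ⌊ suc n′ /2⌋) * + (2 ℕ.^ ⌊ suc n′ /2⌋)  ≡⟨ cong (λ k → + (2 ℕ.^ k) * + (2 ℕ.^ k)) (trans (cong ⌈_/2⌉ (sym 2h≡n′)) (sym (ℕₚ.n≡⌈n+n/2⌉ h))) ⟩
    + (2 ℕ.^ h) * + (2 ℕ.^ h)                        ≡⟨ sym (ℤₚ.pos-* (2 ℕ.^ h) (2 ℕ.^ h)) ⟩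
    + (2 ℕ.^ h ℕ.* 2 ℕ.^ h)                          ≡⟨ cong +_ (sym (ℕₚ.^-distribˡ-+-* 2 h h)) ⟩
    + (2 ℕ.^ (h ℕ.+ h))                              ≡⟨ cong (λ k → + (2 ℕ.^ k)) 2h≡n′ ⟩
    + (2 ℕ.^ n′)                                     ≡⟨ pos-^ n′ ⟩
    (+ 2) ℤ.^ n′                                     ≡⟨ sym (ℤₚ.*-identityˡ ((+ 2) ℤ.^ n′)) ⟩
    1ℤ * (+ 2) ℤ.^ n′ ∎)))
    where open ≡-Reasoning

-- Square-free walk determinants

prime∣2^ : ∀ {q} → Prime q → ∀ k → q ℕ∣.∣ 2 ℕ.^ k → q ≡ 2
prime∣2^ pr zero    q∣1 = contradiction (subst Prime (ℕ∣.∣1⇒≡1 q∣1) pr) ¬prime[1]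
prime∣2^ pr (suc k) q∣2^ with euclidsLemma 2 (2 ℕ.^ k) pr q∣2^
... | inj₂ q∣ = prime∣2^ pr k q∣
... | inj₁ q∣2 with prime⇒irreducible prime[2] q∣2
...   | inj₁ q≡1 = contradiction (subst Prime q≡1 pr) ¬prime[1]
...   | inj₂ q≡2 = q≡2

no-isotropic : ∀ {n} {G : Graph (suc n)} → 𝓕 (suc n) G → ∀ q → Prime q → NoIsotropic (adjacency G) q
no-isotropic {n} {G} (D≢0 , d , D≡ , d-odd , sqfree) q pr u (null , iso) i with q ℕₚ.≟ 2
... | yes refl = no-isotropic-2 (adjacency-symmetric G) diag d (d-odd ∘ Div.∣⇒∣ᵤ) D≢0 D≡ u (null , iso) i
  where
  diag : ZeroDiagonal (adjacency G)
  diag i = cong (λ b → if b then 1ℤ else 0ℤ) (irrefl G i)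
... | no q≢2 with + q Div.∣? u i
...   | yes q∣uᵢ = q∣uᵢ
...   | no q∤uᵢ = contradiction (subst Prime (sqfree (+ q) (Div.∣⇒∣ᵤ q²∣d)) pr) ¬prime[1]
  where
  h = ⌊ suc n /2⌋
  q²∣D : + q * + q ∣ detW G
  q²∣D = isotropic⇒p²∣det pr (adjacency-symmetric G) {u} {i} q∤uᵢ null (iso 0) (iso 1)
  q²∣d : + q * + q ∣ d
  q²∣d = euclid-cancel² pr (+ (2 ℕ.^ h)) d (q≢2 ∘ prime∣2^ pr h ∘ Div.∣⇒∣ᵤ)
    (∣-subst (trans D≡ (ℤₚ.*-comm d (+ (2 ℕ.^ h)))) q²∣D)

cospectral-order : ∀ {n m} {G : Graph n} {H : Graph m} → Cospectral G H → n ≡ m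
cospectral-order (λs , (len≡n , _) , (len≡m , _)) = trans (sym len≡n) len≡m

cospectral⇒≅ : ∀ {n} {G H : Graph (suc n)} → 𝓕 (suc n) G →
  Cospectral G H → Cospectral (complement G) (complement H) → G ≅ H
cospectral⇒≅ {n} {G} {H} inF cosp cospᶜ =
  let ℓ , N , sim , ℓ²≡1 = descent {A = A} {B} (no-isotropic {n} {G} inF) (<-wellFounded ∣ det (krylov B) ∣) D′≢0 (proj₂ (similarity symA symB w≡w))
  in unimodular⇒≅ {G = G} {H} sim ℓ²≡1
  where
  A = adjacency G
  B = adjacency H
  symA = adjacency-symmetric G
  symB = adjacency-symmetric H
  w≡w : ∀ k → walks A k ≡ walks B k
  w≡w = cospectral-walks {suc n} {G} {H} cosp cospᶜ
  D′≢0 : det (krylov B) ≢ 0ℤ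
  D′≢0 D′≡0 = [ proj₁ inF , proj₁ inF ]′ (ℤₚ.i*j≡0⇒i≡0∨j≡0 (det (krylov A))
    (trans (krylov-det² symA symB w≡w) (cong (_* det (krylov B)) D′≡0)))

theorem1p1 : (n : ℕ) → 1 ≤ n → (G : Graph n) → 𝓕 n G → DGS G
theorem1p1 (suc n) _ G inF {m} H cosp cospᶜ = go H (cospectral-order {suc n} {m} {G} {H} cosp) cosp cospᶜ
  where
  go : ∀ {m} (H : Graph m) → suc n ≡ m → Cospectral G H → Cospectral (complement G) (complement H) → G ≅ H
  go H refl = cospectral⇒≅ {n} {G} {H} inF
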